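{- As congruences between formal power series in $q$ with integer coefficients (coefficientwise), \[ \sum_{n\ge0}\overline{p}_3(3n)(-q)^n\equiv \frac{\varphi(q^3)}{\varphi(q)^4}\pmod{9\cdot 2^3}, \] \[ \sum_{n\ge0}\overline{p}_3(3n+1)(-q)^n\equiv 6\,\frac{\varphi(q^3)^4}{\varphi(q)^8}\,B(-q)\pmod{9\cdot 2^4}, \] \[ \sum_{n\ge0}\overline{p}_3(3n+2)(-q)^n\equiv 24\,\frac{\varphi(q^3)^3}{\varphi(q)^8}\,B(-q)^2\pmod{9\cdot 2^5}. \]
   Context: $\overline{p}_3(n)$ denotes the number of overpartition triples of $n$ (triples of overpartitions whose parts together sum to $n$, where an overpartition is a partition in which the first occurrence of each distinct part may be overlined), with $\overline{p}_3(0)=1$; equivalently $\sum_{n\ge0}\overline{p}_3(n)q^n=1/\varphi(-q)^3$. Here $(a;q)_\infty=\prod_{n\ge0}(1-aq^n)$, $\varphi(q)=\sum_{n=-\infty}^{\infty}q^{n^2}$, and \[B(q)=\frac{(q;q)_\infty (q^6;q^6)_\infty^2}{(q^2;q^2)_\infty (q^3;q^3)_\infty}.\] -}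

module Defs where

open import Data.Nat as ℕ using (ℕ; zero; suc; _∸_)
open import Data.Nat.DivMod using (_/_; _%_)
open import Data.Integer as ℤ using (ℤ; +_; -_; _+_; _*_; _-_)
open import Data.Integer.Divisibility using (_∣_)
open import Data.List using (List; []; _∷_)
open import Relation.Nullary.Decidable using (does)
open import Data.Bool using (if_then_else_)

PS : Set
PS = ℕ → ℤ

sumTo : (ℕ → ℤ) → ℕ → ℤ
sumTo f zero    = f zero
sumTo f (suc n) = sumTo f n + f (suc n)

one : PS
one zero    = + 1
one (suc _) = + 0

mul : PS → PS → PS
mul f g n = sumTo (λ i → f i * g (n ∸ i)) n

pow : PS → ℕ → PS
pow f zero    = one
pow f (suc k) = mul f (pow f k)

scale : ℤ → PS → PS
scale c f n = c * f n

-- Multiplicative inverse of a series with constant term 1: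
-- g 0 = 1,  g n = - Σ_{i=1}^{n} f i * g (n - i).
-- invL f n = [g n, g (n-1), ..., g 0]
invL : PS → ℕ → List ℤ
invL f zero    = + 1 ∷ []
invL f (suc n) = (- go 0 (invL f n)) ∷ invL f n
  where
  go : ℕ → List ℤ → ℤ
  go k []       = + 0
  go k (x ∷ xs) = f (suc k) * x + go (suc k) xs

headZ : List ℤ → ℤ
headZ []      = + 0
headZ (x ∷ _) = x

inv : PS → PS
inv f n = headZ (invL f n)

-- f / g  (g with constant term 1)
div : PS → PS → PS
div f g = mul f (inv g)

negq : PS → PS
negq f n = (ℤ.-1ℤ ℤ.^ n) * f n

dil : (m : ℕ) → .{{_ : ℕ.NonZero m}} → PS → PS
dil m f n = if does (n % m ℕ.≟ 0) then f (n / m) else + 0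

-- φ(q) = Σ_{k ∈ ℤ} q^{k²}: coefficient of q^n is #{k ∈ ℤ : k² = n};
-- every such k satisfies |k| ≤ n, so it suffices to count k = i - n, 0 ≤ i ≤ 2n.
φ : PS
φ n = sumTo (λ i → let k = (+ i) - (+ n) in
                    if does (k * k ℤ.≟ + n) then + 1 else + 0) (n ℕ.+ n)

-- (q^m;q^m)_∞ = ∏_{j≥1} (1 - q^{m j}), m ≥ 1.
-- factor e = 1 - q^e (e ≥ 1)
factor : ℕ → PS
factor e zero = + 1
factor e (suc n) = if does (suc n ℕ.≟ e) then ℤ.-1ℤ else + 0

qprodFin : ℕ → ℕ → PS
qprodFin m zero    = one
qprodFin m (suc N) = mul (qprodFin m N) (factor (m ℕ.* suc N))

-- coefficient n of the infinite product: factors with m j > n do not affect it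
qpoch : (m : ℕ) → .{{_ : ℕ.NonZero m}} → PS
qpoch m n = qprodFin m n n

B : PS
B = div (mul (qpoch 1) (pow (qpoch 6) 2)) (mul (qpoch 2) (qpoch 3))

-- overpartition triples: Σ p̄₃(n) q^n = 1/φ(-q)^3
pbar3 : PS
pbar3 = inv (pow (negq φ) 3)

section3 : ℕ → PS
section3 r = negq (λ n → pbar3 (3 ℕ.* n ℕ.+ r))

_≡_[mod_] : PS → PS → ℤ → Set
f ≡ g [mod M ] = ∀ n → M ∣ (f n - g n)

{-# OPTIONS --safe #-}

-- Write ψ = φ(-q) and let section r f be the series with coefficients f(3n+r).  The sections of ψ are
-- a = φ(-q³), -2B and 0, where Jacobi's triple product identifies the theta series in section 1 with B.
-- The product of ψ over the three values of q^{1/3} is D = a³ - 8qB³; on the product side ψ = f₁²/f₂ with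
-- fₘ = (q^m;q^m)_∞, and multiplicativity of this norm gives D a = ψ⁴.  Inverting ψ³, whose sections are
-- D, -6a²B and 12aB², yields the sections of its inverse: with i = 1/D = a/ψ⁴,
--   i + 72 q a³B³i³,   6 a²B i² + 144 q a²B⁴i³,   24 aB² i² + 288 q aB⁵i³.
module Submission where

open import Defs
open import Algebra.Bundles using (CommutativeRing)
open import Algebra.Solver.Ring.AlmostCommutativeRing using (fromCommutativeRing; _-Raw-AlmostCommutative⟶_)
import Algebra.Properties.Semiring.Exp
import Algebra.Properties.Semiring.Mult.TCOptimised
import Algebra.Solver.Ring
open import Algebra.Structures using (IsCommutativeRing)
open import Data.Bool.Base using (if_then_else_)
open import Data.Integer as ℤ using (ℤ; +_)
open import Data.Integer.Divisibility.Signed using (divides; ∣⇒∣ᵤ)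
import Data.Integer.Properties as ℤ
open import Data.Integer.Solver using (module +-*-Solver)
open import Data.List.Base using (List; []; _∷_)
open import Data.Maybe.Base using (Maybe; just; nothing)
open import Data.Nat.Base as ℕ using (ℕ; zero; suc; _∸_; _≤_; _<_; z≤n; s≤s)
open import Data.Nat.DivMod using (_%_; _/_; m≡m%n+[m/n]*n; m%n<n; m/n≤m; [m+kn]%n≡m%n; m<n⇒m%n≡m)
import Data.Nat.Properties as ℕ
open import Data.Nat.Solver using () renaming (module +-*-Solver to ℕ-Solver)
open import Data.Sum.Base using (_⊎_; inj₁; inj₂)
open import Level using (0ℓ)
open import Relation.Binary.PropositionalEquality as ≡ using (_≡_; _≢_)
import Relation.Binary.Reasoning.Setoid
open import Relation.Nullary.Decidable using (yes; no; does)
open import Relation.Nullary.Negation using (contradiction)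

-- The relation D a = ψ⁴ comes from Euler factors. For m prime to 3, a factor 1 - q^(mj) with j
-- prime to 3 is its own norm, while 1 - q^(3mk) has norm (1 - q^(mk))³; so the norm of fₘ is
-- fₘ⁴/f₃ₘ. As ψ = f₁²/f₂ and a = f₃²/f₆, the norm of ψ is f₁⁸f₆/(f₂⁴f₃²) = ψ⁴/a. The three formulas
-- are exact, and each congruence drops the last term. Inverting ψ³ = (w₀, w₁, w₂) needs w₀² -
-- qw₁w₂, qw₂² - w₀w₁ and w₁² - w₀w₂: hence 72 = 6 · 12, 144 = 12², and 288 = 96 + 192 once a³ is
-- eliminated in favour of D. Infinite products, q^(1/3) and cube roots of unity have no direct
-- counterpart among integer series. Product identities are proved exactly for finite products and
-- carried over up to a given degree; conjugation is replaced by polynomial identities for triples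
-- of sections. The work is done for ψ, and the signs (-q)^n of the statement return at the end
-- through the automorphism q ↦ -q.

-- The two-sided sequence …, v 2, v 1, u 0, u 1, u 2, … read at the integer position r - M.
twoSided : ∀ {a} {A : Set a} → (ℕ → A) → (ℕ → A) → ℕ → ℕ → A
twoSided u v zero    r       = u r
twoSided u v (suc M) zero    = v (suc M)
twoSided u v (suc M) (suc r) = twoSided u v M r

-- A ring solver with integer coefficients over any commutative ring.

module IntegerCoefficients {c ℓ} (R : CommutativeRing c ℓ) where

  open CommutativeRing R hiding (zero)
  open import Algebra.Properties.Ring ring using (-0#≈0#; -‿involutive; -‿+-comm; -‿distribˡ-*; -‿distribʳ-*)
  open import Algebra.Properties.Semiring.Mult.TCOptimised semiring using (_×_; 1+×; ×-homo-+; ×1-homo-*)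
  open import Relation.Binary.Reasoning.Setoid setoid

  -- The canonical homomorphism from the integers. The optimised multiple makes `embed (+ 1)` reduce
  -- to `1#`, so the solver's unit laws hold by `refl`.
  embed : ℤ → Carrier
  embed (+ n)      = n × 1#
  embed ℤ.-[1+ n ] = - (suc n × 1#)

  embed-neg : ∀ i → embed (ℤ.- i) ≈ - embed i
  embed-neg (+ zero)   = sym -0#≈0#
  embed-neg (+ suc n)  = refl
  embed-neg ℤ.-[1+ n ] = sym (-‿involutive _)

  embed-⊖ : ∀ m n → embed (m ℤ.⊖ n) ≈ m × 1# - n × 1#
  embed-⊖ zero    zero    = sym (-‿inverseʳ 0#)
  embed-⊖ zero    (suc n) = sym (+-identityˡ _)
  embed-⊖ (suc m) zero    = sym (trans (+-congˡ -0#≈0#) (+-identityʳ _))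
  embed-⊖ (suc m) (suc n) = begin
    embed (suc m ℤ.⊖ suc n)               ≡⟨ ≡.cong embed (ℤ.[1+m]⊖[1+n]≡m⊖n m n) ⟩
    embed (m ℤ.⊖ n)                       ≈⟨ embed-⊖ m n ⟩
    m × 1# - n × 1#                       ≈⟨ +-congʳ (+-identityˡ _) ⟨
    0# + m × 1# - n × 1#                  ≈⟨ +-congʳ (+-congʳ (-‿inverseʳ 1#)) ⟨
    1# - 1# + m × 1# - n × 1#             ≈⟨ +-congʳ (+-assoc _ _ _) ⟩
    1# + (- 1# + m × 1#) - n × 1#         ≈⟨ +-congʳ (+-congˡ (+-comm _ _)) ⟩
    1# + (m × 1# - 1#) - n × 1#           ≈⟨ +-congʳ (+-assoc _ _ _) ⟨
    1# + m × 1# - 1# - n × 1#             ≈⟨ +-assoc _ _ _ ⟩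
    1# + m × 1# + (- 1# - n × 1#)         ≈⟨ +-congˡ (-‿+-comm _ _) ⟩
    1# + m × 1# - (1# + n × 1#)           ≈⟨ +-cong (1+× m 1#) (-‿cong (1+× n 1#)) ⟨
    suc m × 1# - suc n × 1#               ∎

  embed-+ : ∀ i j → embed (i ℤ.+ j) ≈ embed i + embed j
  embed-+ (+ m)      (+ n)      = ×-homo-+ 1# m n
  embed-+ (+ m)      ℤ.-[1+ n ] = embed-⊖ m (suc n)
  embed-+ ℤ.-[1+ m ] (+ n)      = trans (embed-⊖ n (suc m)) (+-comm _ _)
  embed-+ ℤ.-[1+ m ] ℤ.-[1+ n ] = begin
    - (suc (suc (m ℕ.+ n)) × 1#)      ≡⟨ ≡.cong (λ k → - (suc k × 1#)) (ℕ.+-suc m n) ⟨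
    - ((suc m ℕ.+ suc n) × 1#)        ≈⟨ -‿cong (×-homo-+ 1# (suc m) (suc n)) ⟩
    - (suc m × 1# + suc n × 1#)       ≈⟨ -‿+-comm _ _ ⟨
    - (suc m × 1#) - suc n × 1#       ∎

  embed-+* : ∀ m j → embed (+ m ℤ.* j) ≈ m × 1# * embed j
  embed-+* m (+ n)      = trans (reflexive (≡.cong embed (≡.sym (ℤ.pos-* m n)))) (×1-homo-* m n)
  embed-+* m ℤ.-[1+ n ] = begin
    embed (+ m ℤ.* ℤ.- (+ suc n))   ≡⟨ ≡.cong embed (ℤ.neg-distribʳ-* (+ m) (+ suc n)) ⟨
    embed (ℤ.- (+ m ℤ.* + suc n))   ≈⟨ embed-neg (+ m ℤ.* + suc n) ⟩
    - embed (+ m ℤ.* + suc n)       ≈⟨ -‿cong (embed-+* m (+ suc n)) ⟩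
    - (m × 1# * (suc n × 1#))       ≈⟨ -‿distribʳ-* _ _ ⟩
    m × 1# * - (suc n × 1#)         ∎

  embed-* : ∀ i j → embed (i ℤ.* j) ≈ embed i * embed j
  embed-* (+ m)      j = embed-+* m j
  embed-* ℤ.-[1+ m ] j = begin
    embed (ℤ.- (+ suc m) ℤ.* j)     ≡⟨ ≡.cong embed (ℤ.neg-distribˡ-* (+ suc m) j) ⟨
    embed (ℤ.- (+ suc m ℤ.* j))     ≈⟨ embed-neg (+ suc m ℤ.* j) ⟩
    - embed (+ suc m ℤ.* j)         ≈⟨ -‿cong (embed-+* (suc m) j) ⟩
    - (suc m × 1# * embed j)        ≈⟨ -‿distribˡ-* _ _ ⟩
    - (suc m × 1#) * embed j        ∎

  embed-homomorphism : CommutativeRing.rawRing ℤ.+-*-commutativeRing -Raw-AlmostCommutative⟶ fromCommutativeRing R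
  embed-homomorphism = record
    { ⟦_⟧ = embed ; +-homo = embed-+ ; *-homo = embed-* ; -‿homo = embed-neg ; 0-homo = refl ; 1-homo = refl }

  -- Compares the integers themselves, since equality in `R` may be undecidable; the solver asks
  -- only for soundness.
  embed-≟ : ∀ i j → Maybe (embed i ≈ embed j)
  embed-≟ i j with i ℤ.≟ j
  ... | yes i≡j = just (reflexive (≡.cong embed i≡j))
  ... | no  _   = nothing

  module Solver = Algebra.Solver.Ring (CommutativeRing.rawRing ℤ.+-*-commutativeRing) (fromCommutativeRing R) embed-homomorphism embed-≟

-- Finite sums and the finite triple product.

module Identities {c ℓ} (R : CommutativeRing c ℓ) where

  open CommutativeRing R hiding (zero)
  open IntegerCoefficients R using (embed)
  open IntegerCoefficients.Solver R
  open import Relation.Binary.Reasoning.Setoid setoid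
  open import Algebra.Properties.Semiring.Exp semiring using (_^_; ^-homo-*)

  1′ : ∀ {n} → Polynomial n
  1′ = con (+ 1)

  ∑ : (ℕ → Carrier) → ℕ → Carrier
  ∑ f zero    = f zero
  ∑ f (suc n) = ∑ f n + f (suc n)

  ∏ : (ℕ → Carrier) → ℕ → Carrier
  ∏ f zero    = 1#
  ∏ f (suc n) = ∏ f n * f n

  ∑-cong : ∀ {f g} n → (∀ r → r ≤ n → f r ≈ g r) → ∑ f n ≈ ∑ g n
  ∑-cong zero    f≈g = f≈g 0 z≤n
  ∑-cong (suc n) f≈g =
    +-cong (∑-cong n λ r r≤n → f≈g r (ℕ.m≤n⇒m≤1+n r≤n)) (f≈g (suc n) ℕ.≤-refl)

  ∑-+ : ∀ f g n → ∑ (λ r → f r + g r) n ≈ ∑ f n + ∑ g n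
  ∑-+ f g zero    = refl
  ∑-+ f g (suc n) = trans (+-congʳ (∑-+ f g n))
    (solve 4 (λ a b c d → (a :+ b) :+ (c :+ d) := (a :+ c) :+ (b :+ d)) refl _ _ _ _)

  ∑-*ˡ : ∀ x f n → ∑ (λ r → x * f r) n ≈ x * ∑ f n
  ∑-*ˡ x f zero    = refl
  ∑-*ˡ x f (suc n) = trans (+-congʳ (∑-*ˡ x f n)) (sym (distribˡ x _ _))

  ∑-suc : ∀ f n → ∑ f (suc n) ≈ f 0 + ∑ (λ r → f (suc r)) n
  ∑-suc f zero    = refl
  ∑-suc f (suc n) = trans (+-congʳ (∑-suc f n)) (+-assoc _ _ _)

  -- The finite triple product, with d n playing the role of 1/(Q;Q)ₙ and t A j = (-1)ʲ A^(j(j+1)/2) B^(j(j-1)/2),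
  -- t B j being the term of index -j.  Shifting the centre of the sum adds a factor 1 - BQᴹ, by Pascal's rule for d.
  module FiniteJacobi (A B : Carrier) (d : ℕ → Carrier)
    (d-zero : d 0 ≈ 1#)
    (d-suc  : ∀ n → (1# - (A * B) ^ suc n) * d (suc n) ≈ d n) where

    Q : Carrier
    Q = A * B

    t : Carrier → ℕ → Carrier
    t X zero    = 1#
    t X (suc j) = - (X * Q ^ j) * t X j

    s : ℕ → ℕ → Carrier
    s = twoSided (t A) (t B)

    -- For every integer k the terms satisfy t(k - 1) = -B Q^(-k) t(k). At k = r - M the factor Q^r
    -- clears the negative power and leaves Q^M.
    s-descend : ∀ M r → Q ^ r * s (suc M) r ≈ - (B * Q ^ M) * s M r
    s-descend zero    zero    =
      solve 1 (λ b → 1′ :* ((:- (b :* 1′)) :* 1′) := (:- (b :* 1′)) :* 1′) refl B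
    s-descend zero    (suc r) =
      solve 4 (λ a b q x → a :* b :* q :* x := (:- (b :* 1′)) :* ((:- (a :* q)) :* x)) refl A B (Q ^ r) (t A r)
    s-descend (suc M) zero    = *-identityˡ _
    s-descend (suc M) (suc r) = begin
      Q ^ suc r * s (suc M) r         ≈⟨ *-assoc _ _ _ ⟩
      Q * (Q ^ r * s (suc M) r)       ≈⟨ *-congˡ (s-descend M r) ⟩
      Q * (- (B * Q ^ M) * s M r)     ≈⟨ solve 4 (λ q b m x → q :* ((:- (b :* m)) :* x) := (:- (b :* (q :* m))) :* x) refl Q B (Q ^ M) (s M r) ⟩
      - (B * (Q ^ suc M)) * s M r     ∎

    -- The recurrence t(k + 1) = -A Q^k t(k) at k = r - M; the hypothesis makes p = L - k, so that
    -- Q^p turns Q^k into Q^L.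
    s-ascend : ∀ M r L p → L ℕ.+ M ≡ r ℕ.+ p → Q ^ p * s M (suc r) ≈ - (A * Q ^ L) * s M r
    s-ascend zero r L p eq = begin
      Q ^ p * (- (A * Q ^ r) * t A r) ≈⟨ solve 4 (λ p a r x → p :* ((:- (a :* r)) :* x) := (:- (a :* (r :* p))) :* x) refl (Q ^ p) A (Q ^ r) (t A r) ⟩
      - (A * (Q ^ r * Q ^ p)) * t A r ≈⟨ *-congʳ (-‿cong (*-congˡ (sym (^-homo-* Q r p)))) ⟩
      - (A * Q ^ (r ℕ.+ p)) * t A r   ≡⟨ ≡.cong (λ k → - (A * Q ^ k) * t A r) (≡.trans (≡.sym eq) (ℕ.+-identityʳ L)) ⟩
      - (A * Q ^ L) * t A r           ∎
    s-ascend (suc M) zero L p eq = begin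
      Q ^ p * s M 0                          ≡⟨ ≡.cong₂ (λ k x → Q ^ k * x) (≡.trans (≡.sym eq) (ℕ.+-suc L M)) (s-zero M) ⟩
      Q ^ suc (L ℕ.+ M) * t B M              ≈⟨ *-congʳ (*-congˡ (^-homo-* Q L M)) ⟩
      (A * B) * (Q ^ L * Q ^ M) * t B M      ≈⟨ solve 5 (λ a b l m x → (a :* b) :* (l :* m) :* x := (:- (a :* l)) :* ((:- (b :* m)) :* x)) refl A B (Q ^ L) (Q ^ M) (t B M) ⟩
      - (A * Q ^ L) * (- (B * Q ^ M) * t B M) ∎
      where
      s-zero : ∀ M → s M 0 ≡ t B M
      s-zero zero    = ≡.refl
      s-zero (suc M) = ≡.refl
    s-ascend (suc M) (suc r) L p eq =
      s-ascend M r L p (ℕ.suc-injective (≡.trans (≡.sym (ℕ.+-suc L M)) eq))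

    -- By `d-suc` this is d (n - 1) for positive n, and it vanishes at 0. That boundary value lets
    -- both index shifts below be carried out over the full range.
    e : ℕ → Carrier
    e n = (1# - Q ^ n) * d n

    e-zero : e 0 ≈ 0#
    e-zero = trans (*-congʳ (-‿inverseʳ 1#)) (zeroˡ _)

    conv-eˡ : ∀ (f : ℕ → Carrier) n → ∑ (λ r → f r * (e r * d (suc n ∸ r))) (suc n) ≈ ∑ (λ r → f (suc r) * (d r * d (n ∸ r))) n
    conv-eˡ f n = begin
      ∑ (λ r → f r * (e r * d (suc n ∸ r))) (suc n)
        ≈⟨ ∑-suc _ n ⟩
      f 0 * (e 0 * d (suc n)) + ∑ (λ r → f (suc r) * (e (suc r) * d (n ∸ r))) n
        ≈⟨ +-cong (trans (*-congˡ (trans (*-congʳ e-zero) (zeroˡ _))) (zeroʳ _))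
                  (∑-cong n λ r _ → *-congˡ (*-congʳ (d-suc r))) ⟩
      0# + ∑ (λ r → f (suc r) * (d r * d (n ∸ r))) n
        ≈⟨ +-identityˡ _ ⟩
      ∑ (λ r → f (suc r) * (d r * d (n ∸ r))) n ∎

    conv-eʳ : ∀ (f : ℕ → Carrier) n → ∑ (λ r → f r * (d r * e (suc n ∸ r))) (suc n) ≈ ∑ (λ r → f r * (d r * d (n ∸ r))) n
    conv-eʳ f n = begin
      ∑ (λ r → f r * (d r * e (suc n ∸ r))) n + f (suc n) * (d (suc n) * e (n ∸ n))
        ≈⟨ +-cong (∑-cong n λ r r≤n → *-congˡ (*-congˡ (below r r≤n)))
                  (trans (*-congˡ (trans (*-congˡ top) (zeroʳ _))) (zeroʳ _)) ⟩
      ∑ (λ r → f r * (d r * d (n ∸ r))) n + 0#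
        ≈⟨ +-identityʳ _ ⟩
      ∑ (λ r → f r * (d r * d (n ∸ r))) n ∎
      where
      below : ∀ r → r ≤ n → e (suc n ∸ r) ≈ d (n ∸ r)
      below r r≤n = trans (reflexive (≡.cong e (ℕ.+-∸-assoc 1 r≤n))) (d-suc (n ∸ r))
      top : e (n ∸ n) ≈ 0#
      top = trans (reflexive (≡.cong e (ℕ.n∸n≡0 n))) e-zero

    -- Multiplied by (Q;Q)ₙ this is the sum of f r against the Gaussian binomial coefficients
    -- [n choose r].
    T : (ℕ → Carrier) → ℕ → Carrier
    T f n = ∑ (λ r → f r * (d r * d (n ∸ r))) n

    Q-split : ∀ n r → r ≤ n → Q ^ n ≈ Q ^ r * Q ^ (n ∸ r)
    Q-split n r r≤n = trans (reflexive (≡.cong (Q ^_) (≡.sym (ℕ.m+[n∸m]≡n r≤n)))) (^-homo-* Q r (n ∸ r))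

    -- Splits 1 - xy as (1 - x) + x(1 - y) for x = Q^r and y = Q^(n + 1 - r); each bracket lowers
    -- the index of one factor d.
    pascalˡ : ∀ f n → (1# - Q ^ suc n) * T f (suc n) ≈ T (λ r → f (suc r) + Q ^ r * f r) n
    pascalˡ f n = begin
      (1# - Q ^ suc n) * T f (suc n)
        ≈⟨ sym (∑-*ˡ _ _ (suc n)) ⟩
      ∑ (λ r → (1# - Q ^ suc n) * (f r * (d r * d (suc n ∸ r)))) (suc n)
        ≈⟨ ∑-cong (suc n) (λ r r≤n → trans (*-congʳ (+-congˡ (-‿cong (Q-split (suc n) r r≤n))))
             (solve 5 (λ x y f a b → (1′ :- x :* y) :* (f :* (a :* b)) :=
                                        f :* ((1′ :- x) :* a :* b) :+ x :* f :* (a :* ((1′ :- y) :* b))) refl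
               (Q ^ r) (Q ^ (suc n ∸ r)) (f r) (d r) (d (suc n ∸ r)))) ⟩
      ∑ (λ r → f r * (e r * d (suc n ∸ r)) + Q ^ r * f r * (d r * e (suc n ∸ r))) (suc n)
        ≈⟨ ∑-+ _ _ (suc n) ⟩
      ∑ (λ r → f r * (e r * d (suc n ∸ r))) (suc n) + ∑ (λ r → Q ^ r * f r * (d r * e (suc n ∸ r))) (suc n)
        ≈⟨ +-cong (conv-eˡ f n) (conv-eʳ (λ r → Q ^ r * f r) n) ⟩
      T (λ r → f (suc r)) n + T (λ r → Q ^ r * f r) n
        ≈⟨ sym (∑-+ _ _ n) ⟩
      ∑ (λ r → f (suc r) * (d r * d (n ∸ r)) + Q ^ r * f r * (d r * d (n ∸ r))) n
        ≈⟨ ∑-cong n (λ r _ → sym (distribʳ _ _ _)) ⟩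
      T (λ r → f (suc r) + Q ^ r * f r) n ∎

    -- The other splitting, 1 - xy = (1 - y) + y(1 - x), which is the other form of Pascal's rule.
    pascalʳ : ∀ f n → (1# - Q ^ suc n) * T f (suc n) ≈ T (λ r → f r + Q ^ (n ∸ r) * f (suc r)) n
    pascalʳ f n = begin
      (1# - Q ^ suc n) * T f (suc n)
        ≈⟨ sym (∑-*ˡ _ _ (suc n)) ⟩
      ∑ (λ r → (1# - Q ^ suc n) * (f r * (d r * d (suc n ∸ r)))) (suc n)
        ≈⟨ ∑-cong (suc n) (λ r r≤n → trans (*-congʳ (+-congˡ (-‿cong (Q-split (suc n) r r≤n))))
             (solve 5 (λ x y f a b → (1′ :- x :* y) :* (f :* (a :* b)) :=
                                      f :* (a :* ((1′ :- y) :* b)) :+ y :* f :* ((1′ :- x) :* a :* b)) refl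
               (Q ^ r) (Q ^ (suc n ∸ r)) (f r) (d r) (d (suc n ∸ r)))) ⟩
      ∑ (λ r → f r * (d r * e (suc n ∸ r)) + Q ^ (suc n ∸ r) * f r * (e r * d (suc n ∸ r))) (suc n)
        ≈⟨ ∑-+ _ _ (suc n) ⟩
      ∑ (λ r → f r * (d r * e (suc n ∸ r))) (suc n) + ∑ (λ r → Q ^ (suc n ∸ r) * f r * (e r * d (suc n ∸ r))) (suc n)
        ≈⟨ +-cong (conv-eʳ f n) (conv-eˡ (λ r → Q ^ (suc n ∸ r) * f r) n) ⟩
      T f n + T (λ r → Q ^ (n ∸ r) * f (suc r)) n
        ≈⟨ sym (∑-+ _ _ n) ⟩
      ∑ (λ r → f r * (d r * d (n ∸ r)) + Q ^ (n ∸ r) * f (suc r) * (d r * d (n ∸ r))) n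
        ≈⟨ ∑-cong n (λ r _ → sym (distribʳ _ _ _)) ⟩
      T (λ r → f r + Q ^ (n ∸ r) * f (suc r)) n ∎

    T-scale : ∀ x {f g} n → (∀ r → r ≤ n → f r ≈ x * g r) → T f n ≈ x * T g n
    T-scale x n f≈xg = trans (∑-cong n λ r r≤n → trans (*-congʳ (f≈xg r r≤n)) (*-assoc _ _ _)) (∑-*ˡ x _ n)

    -- After `pascalˡ` the summand is s M r plus Q^r s (M + 1) r, and `s-descend` makes the second a
    -- multiple of the first by a factor independent of r.
    T-sucM : ∀ M → (1# - Q ^ suc M) * T (s (suc M)) (suc M) ≈ (1# - B * Q ^ M) * T (s M) M
    T-sucM M = trans (pascalˡ (s (suc M)) M) (T-scale _ M λ r _ →
      trans (+-congˡ (s-descend M r))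
        (solve 2 (λ x y → y :+ (:- x) :* y := (1′ :- x) :* y) refl (B * Q ^ M) (s M r)))

    T-sucL : ∀ L M → (1# - Q ^ suc (L ℕ.+ M)) * T (s M) (suc (L ℕ.+ M)) ≈ (1# - A * Q ^ L) * T (s M) (L ℕ.+ M)
    T-sucL L M = trans (pascalʳ (s M) (L ℕ.+ M)) (T-scale _ (L ℕ.+ M) λ r r≤n →
      trans (+-congˡ (s-ascend M r L (L ℕ.+ M ∸ r) (≡.sym (ℕ.m+[n∸m]≡n r≤n))))
        (solve 2 (λ x y → y :+ (:- x) :* y := (1′ :- x) :* y) refl (A * Q ^ L) (s M r)))

    E : ℕ → Carrier
    E = ∏ (λ j → 1# - Q ^ suc j)

    -- A step in M moves the centre and a step in L extends the sum on the right. Each peels one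
    -- factor of a product and one factor of (Q;Q) at L + M.
    finite-jacobi : ∀ L M → E (L ℕ.+ M) * T (s M) (L ℕ.+ M)
                            ≈ ∏ (λ j → 1# - A * Q ^ j) L * ∏ (λ j → 1# - B * Q ^ j) M
    finite-jacobi zero zero = *-congˡ (trans (*-identityˡ _) (trans (*-cong d-zero d-zero) (*-identityˡ _)))
    finite-jacobi zero (suc M) = begin
      E M * (1# - Q ^ suc M) * T (s (suc M)) (suc M)   ≈⟨ *-assoc _ _ _ ⟩
      E M * ((1# - Q ^ suc M) * T (s (suc M)) (suc M)) ≈⟨ *-congˡ (T-sucM M) ⟩
      E M * ((1# - B * Q ^ M) * T (s M) M)             ≈⟨ solve 3 (λ x y z → x :* (y :* z) := x :* z :* y) refl _ _ _ ⟩
      E M * T (s M) M * (1# - B * Q ^ M)               ≈⟨ *-congʳ (finite-jacobi zero M) ⟩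
      1# * ∏ (λ j → 1# - B * Q ^ j) M * (1# - B * Q ^ M) ≈⟨ *-assoc _ _ _ ⟩
      1# * (∏ (λ j → 1# - B * Q ^ j) M * (1# - B * Q ^ M)) ∎
    finite-jacobi (suc L) M = begin
      E (L ℕ.+ M) * (1# - Q ^ suc (L ℕ.+ M)) * T (s M) (suc (L ℕ.+ M))
        ≈⟨ *-assoc _ _ _ ⟩
      E (L ℕ.+ M) * ((1# - Q ^ suc (L ℕ.+ M)) * T (s M) (suc (L ℕ.+ M)))
        ≈⟨ *-congˡ (T-sucL L M) ⟩
      E (L ℕ.+ M) * ((1# - A * Q ^ L) * T (s M) (L ℕ.+ M))
        ≈⟨ solve 3 (λ x y z → x :* (y :* z) := x :* z :* y) refl _ _ _ ⟩
      E (L ℕ.+ M) * T (s M) (L ℕ.+ M) * (1# - A * Q ^ L)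
        ≈⟨ *-congʳ (finite-jacobi L M) ⟩
      ∏ (λ j → 1# - A * Q ^ j) L * ∏ (λ j → 1# - B * Q ^ j) M * (1# - A * Q ^ L)
        ≈⟨ solve 3 (λ x y z → x :* y :* z := x :* z :* y) refl _ _ _ ⟩
      ∏ (λ j → 1# - A * Q ^ j) L * (1# - A * Q ^ L) * ∏ (λ j → 1# - B * Q ^ j) M ∎

-- The cubic extension by ω with ω³ = q: products, norm and inversion.

module Twisted {r ℓ} (R : CommutativeRing r ℓ) (q : CommutativeRing.Carrier R) where

  open CommutativeRing R hiding (zero)
  open IntegerCoefficients R using (embed)
  open IntegerCoefficients.Solver R
  open import Relation.Binary.Reasoning.Setoid setoid

  private
    k : ∀ {n} → ℕ → Polynomial n
    k i = con (+ i)

  mul₀ mul₁ mul₂ : (f₀ f₁ f₂ g₀ g₁ g₂ : Carrier) → Carrier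
  mul₀ f₀ f₁ f₂ g₀ g₁ g₂ = f₀ * g₀ + q * (f₁ * g₂ + f₂ * g₁)
  mul₁ f₀ f₁ f₂ g₀ g₁ g₂ = f₀ * g₁ + f₁ * g₀ + q * (f₂ * g₂)
  mul₂ f₀ f₁ f₂ g₀ g₁ g₂ = f₀ * g₂ + f₁ * g₁ + f₂ * g₀

  mul₀-cong : ∀ {f₀ f₁ f₂ g₀ g₁ g₂ f₀′ f₁′ f₂′ g₀′ g₁′ g₂′} → f₀ ≈ f₀′ → f₁ ≈ f₁′ → f₂ ≈ f₂′ →
    g₀ ≈ g₀′ → g₁ ≈ g₁′ → g₂ ≈ g₂′ → mul₀ f₀ f₁ f₂ g₀ g₁ g₂ ≈ mul₀ f₀′ f₁′ f₂′ g₀′ g₁′ g₂′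
  mul₀-cong a b c x y z = +-cong (*-cong a x) (*-congˡ (+-cong (*-cong b z) (*-cong c y)))

  mul₁-cong : ∀ {f₀ f₁ f₂ g₀ g₁ g₂ f₀′ f₁′ f₂′ g₀′ g₁′ g₂′} → f₀ ≈ f₀′ → f₁ ≈ f₁′ → f₂ ≈ f₂′ →
    g₀ ≈ g₀′ → g₁ ≈ g₁′ → g₂ ≈ g₂′ → mul₁ f₀ f₁ f₂ g₀ g₁ g₂ ≈ mul₁ f₀′ f₁′ f₂′ g₀′ g₁′ g₂′
  mul₁-cong a b c x y z = +-cong (+-cong (*-cong a y) (*-cong b x)) (*-congˡ (*-cong c z))

  mul₂-cong : ∀ {f₀ f₁ f₂ g₀ g₁ g₂ f₀′ f₁′ f₂′ g₀′ g₁′ g₂′} → f₀ ≈ f₀′ → f₁ ≈ f₁′ → f₂ ≈ f₂′ →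
    g₀ ≈ g₀′ → g₁ ≈ g₁′ → g₂ ≈ g₂′ → mul₂ f₀ f₁ f₂ g₀ g₁ g₂ ≈ mul₂ f₀′ f₁′ f₂′ g₀′ g₁′ g₂′
  mul₂-cong a b c x y z = +-cong (+-cong (*-cong a z) (*-cong b y)) (*-cong c x)

  -- f₀ + ωf₁ + ω²f₂ with ω³ = q is represented by (f₀, f₁, f₂); the norm is the product of its conjugates.
  norm : (f₀ f₁ f₂ : Carrier) → Carrier
  norm f₀ f₁ f₂ =
    f₀ * f₀ * f₀ + q * (f₁ * f₁ * f₁) + q * q * (f₂ * f₂ * f₂) - embed (+ 3) * q * (f₀ * f₁ * f₂)

  norm-cong : ∀ {f₀ f₁ f₂ g₀ g₁ g₂} → f₀ ≈ g₀ → f₁ ≈ g₁ → f₂ ≈ g₂ → norm f₀ f₁ f₂ ≈ norm g₀ g₁ g₂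
  norm-cong p r s =
    +-cong (+-cong (+-cong (*-cong (*-cong p p) p) (*-congˡ (*-cong (*-cong r r) r))) (*-congˡ (*-cong (*-cong s s) s)))
           (-‿cong (*-congˡ (*-cong (*-cong p r) s)))

  private
    Nₚ : ∀ {n} (q f₀ f₁ f₂ : Polynomial n) → Polynomial n
    Nₚ q f₀ f₁ f₂ = f₀ :* f₀ :* f₀ :+ q :* (f₁ :* f₁ :* f₁) :+ q :* q :* (f₂ :* f₂ :* f₂) :- k 3 :* q :* (f₀ :* f₁ :* f₂)
    m₀ m₁ m₂ : ∀ {n} (q f₀ f₁ f₂ g₀ g₁ g₂ : Polynomial n) → Polynomial n
    m₀ q f₀ f₁ f₂ g₀ g₁ g₂ = f₀ :* g₀ :+ q :* (f₁ :* g₂ :+ f₂ :* g₁)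
    m₁ q f₀ f₁ f₂ g₀ g₁ g₂ = f₀ :* g₁ :+ f₁ :* g₀ :+ q :* (f₂ :* g₂)
    m₂ q f₀ f₁ f₂ g₀ g₁ g₂ = f₀ :* g₂ :+ f₁ :* g₁ :+ f₂ :* g₀

  -- The norm is the determinant of multiplication by an element of the extension, hence
  -- multiplicative; the solver checks the resulting polynomial identity.
  norm-* : ∀ f₀ f₁ f₂ g₀ g₁ g₂ →
    norm (mul₀ f₀ f₁ f₂ g₀ g₁ g₂) (mul₁ f₀ f₁ f₂ g₀ g₁ g₂) (mul₂ f₀ f₁ f₂ g₀ g₁ g₂) ≈ norm f₀ f₁ f₂ * norm g₀ g₁ g₂
  norm-* f₀ f₁ f₂ g₀ g₁ g₂ = solve 7 (λ q f₀ f₁ f₂ g₀ g₁ g₂ →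
      Nₚ q (m₀ q f₀ f₁ f₂ g₀ g₁ g₂) (m₁ q f₀ f₁ f₂ g₀ g₁ g₂) (m₂ q f₀ f₁ f₂ g₀ g₁ g₂)
      := Nₚ q f₀ f₁ f₂ :* Nₚ q g₀ g₁ g₂) refl q f₀ f₁ f₂ g₀ g₁ g₂

  module Inverse {w₀ w₁ w₂ p₀ p₁ p₂ : Carrier}
    (e₀ : mul₀ w₀ w₁ w₂ p₀ p₁ p₂ ≈ 1#) (e₁ : mul₁ w₀ w₁ w₂ p₀ p₁ p₂ ≈ 0#) (e₂ : mul₂ w₀ w₁ w₂ p₀ p₁ p₂ ≈ 0#) where

    -- The product of the two other conjugates of w, so that multiplying it by w gives the norm.
    a₀ a₁ a₂ : Carrier
    a₀ = w₀ * w₀ - q * (w₁ * w₂)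
    a₁ = q * (w₂ * w₂) - w₀ * w₁
    a₂ = w₁ * w₁ - w₀ * w₂

    -- With a the conjugate product, norm(w) p = (a w) p = a (w p) = a. The first step is a
    -- polynomial identity; the last uses w p = 1 in components.
    inverse₀ : norm w₀ w₁ w₂ * p₀ ≈ a₀
    inverse₀ = begin
      norm w₀ w₁ w₂ * p₀
        ≈⟨ solve 7 (λ q w₀ w₁ w₂ p₀ p₁ p₂ → Nₚ q w₀ w₁ w₂ :* p₀ :=
             m₀ q (w₀ :* w₀ :- q :* (w₁ :* w₂)) (q :* (w₂ :* w₂) :- w₀ :* w₁) (w₁ :* w₁ :- w₀ :* w₂)
                  (m₀ q w₀ w₁ w₂ p₀ p₁ p₂) (m₁ q w₀ w₁ w₂ p₀ p₁ p₂) (m₂ q w₀ w₁ w₂ p₀ p₁ p₂)) refl q w₀ w₁ w₂ p₀ p₁ p₂ ⟩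
      mul₀ a₀ a₁ a₂ (mul₀ w₀ w₁ w₂ p₀ p₁ p₂) (mul₁ w₀ w₁ w₂ p₀ p₁ p₂) (mul₂ w₀ w₁ w₂ p₀ p₁ p₂)
        ≈⟨ +-cong (*-congˡ e₀) (*-congˡ (+-cong (*-congˡ e₂) (*-congˡ e₁))) ⟩
      mul₀ a₀ a₁ a₂ 1# 0# 0#
        ≈⟨ solve 4 (λ q x y z → m₀ q x y z (k 1) (k 0) (k 0) := x) refl q a₀ a₁ a₂ ⟩
      a₀ ∎

    inverse₁ : norm w₀ w₁ w₂ * p₁ ≈ a₁
    inverse₁ = begin
      norm w₀ w₁ w₂ * p₁
        ≈⟨ solve 7 (λ q w₀ w₁ w₂ p₀ p₁ p₂ → Nₚ q w₀ w₁ w₂ :* p₁ :=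
             m₁ q (w₀ :* w₀ :- q :* (w₁ :* w₂)) (q :* (w₂ :* w₂) :- w₀ :* w₁) (w₁ :* w₁ :- w₀ :* w₂)
                  (m₀ q w₀ w₁ w₂ p₀ p₁ p₂) (m₁ q w₀ w₁ w₂ p₀ p₁ p₂) (m₂ q w₀ w₁ w₂ p₀ p₁ p₂)) refl q w₀ w₁ w₂ p₀ p₁ p₂ ⟩
      mul₁ a₀ a₁ a₂ (mul₀ w₀ w₁ w₂ p₀ p₁ p₂) (mul₁ w₀ w₁ w₂ p₀ p₁ p₂) (mul₂ w₀ w₁ w₂ p₀ p₁ p₂)
        ≈⟨ +-cong (+-cong (*-congˡ e₁) (*-congˡ e₀)) (*-congˡ (*-congˡ e₂)) ⟩
      mul₁ a₀ a₁ a₂ 1# 0# 0#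
        ≈⟨ solve 4 (λ q x y z → m₁ q x y z (k 1) (k 0) (k 0) := y) refl q a₀ a₁ a₂ ⟩
      a₁ ∎

    inverse₂ : norm w₀ w₁ w₂ * p₂ ≈ a₂
    inverse₂ = begin
      norm w₀ w₁ w₂ * p₂
        ≈⟨ solve 7 (λ q w₀ w₁ w₂ p₀ p₁ p₂ → Nₚ q w₀ w₁ w₂ :* p₂ :=
             m₂ q (w₀ :* w₀ :- q :* (w₁ :* w₂)) (q :* (w₂ :* w₂) :- w₀ :* w₁) (w₁ :* w₁ :- w₀ :* w₂)
                  (m₀ q w₀ w₁ w₂ p₀ p₁ p₂) (m₁ q w₀ w₁ w₂ p₀ p₁ p₂) (m₂ q w₀ w₁ w₂ p₀ p₁ p₂)) refl q w₀ w₁ w₂ p₀ p₁ p₂ ⟩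
      mul₂ a₀ a₁ a₂ (mul₀ w₀ w₁ w₂ p₀ p₁ p₂) (mul₁ w₀ w₁ w₂ p₀ p₁ p₂) (mul₂ w₀ w₁ w₂ p₀ p₁ p₂)
        ≈⟨ +-cong (+-cong (*-congˡ e₂) (*-congˡ e₁)) (*-congˡ e₀) ⟩
      mul₂ a₀ a₁ a₂ 1# 0# 0#
        ≈⟨ solve 4 (λ q x y z → m₂ q x y z (k 1) (k 0) (k 0) := z) refl q a₀ a₁ a₂ ⟩
      a₂ ∎

  module CubeOfBinomial (a b : Carrier) where

    -- These are a³ + q c³, 3a²c and 3ac², the components of (a + cω)³ with c = -2b. `D` is at the
    -- same time the norm of a + cω, which ties the cube to the norm.
    c D w₁ w₂ : Carrier
    c = - (embed (+ 2) * b)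
    D = a * a * a - embed (+ 8) * (q * (b * b * b))
    w₁ = - (embed (+ 6) * (a * a * b))
    w₂ = embed (+ 12) * (a * b * b)

    cube₀ : mul₀ a c 0# (mul₀ a c 0# a c 0#) (mul₁ a c 0# a c 0#) (mul₂ a c 0# a c 0#) ≈ D
    cube₀ = solve 3 (λ q a b → let c = :- (k 2 :* b); z = k 0 in
      m₀ q a c z (m₀ q a c z a c z) (m₁ q a c z a c z) (m₂ q a c z a c z)
      := a :* a :* a :- k 8 :* (q :* (b :* b :* b))) refl q a b

    cube₁ : mul₁ a c 0# (mul₀ a c 0# a c 0#) (mul₁ a c 0# a c 0#) (mul₂ a c 0# a c 0#) ≈ w₁
    cube₁ = solve 3 (λ q a b → let c = :- (k 2 :* b); z = k 0 in
      m₁ q a c z (m₀ q a c z a c z) (m₁ q a c z a c z) (m₂ q a c z a c z)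
      := :- (k 6 :* (a :* a :* b))) refl q a b

    cube₂ : mul₂ a c 0# (mul₀ a c 0# a c 0#) (mul₁ a c 0# a c 0#) (mul₂ a c 0# a c 0#) ≈ w₂
    cube₂ = solve 3 (λ q a b → let c = :- (k 2 :* b); z = k 0 in
      m₂ q a c z (m₀ q a c z a c z) (m₁ q a c z a c z) (m₂ q a c z a c z)
      := k 12 :* (a :* b :* b)) refl q a b

    norm-binomial : norm a c 0# ≈ D
    norm-binomial = solve 3 (λ q a b → Nₚ q a (:- (k 2 :* b)) (k 0)
      := a :* a :* a :- k 8 :* (q :* (b :* b :* b))) refl q a b

    -- The triple is a cube of an element of norm `D`, so its norm is D³ by multiplicativity.
    norm-cube : norm D w₁ w₂ ≈ D * D * D
    norm-cube = solve 3 (λ q a b → let D = a :* a :* a :- k 8 :* (q :* (b :* b :* b)) in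
      Nₚ q D (:- (k 6 :* (a :* a :* b))) (k 12 :* (a :* b :* b)) := D :* D :* D) refl q a b

    module Sections {v p₀ p₁ p₂ : Carrier} (Dav : D * a * v ≈ 1#)
      (e₀ : mul₀ D w₁ w₂ p₀ p₁ p₂ ≈ 1#) (e₁ : mul₁ D w₁ w₂ p₀ p₁ p₂ ≈ 0#) (e₂ : mul₂ D w₁ w₂ p₀ p₁ p₂ ≈ 0#) where

      open Inverse {w₀ = D} e₀ e₁ e₂

      i i³ : Carrier
      i = a * v
      i³ = i * i * i

      Di : D * i ≈ 1#
      Di = trans (sym (*-assoc _ _ _)) Dav

      -- Dividing by the norm D³ is multiplying by i³, since i is inverse to `D`.
      unnorm : ∀ {p x} → norm D w₁ w₂ * p ≈ x → p ≈ x * i³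
      unnorm {p} {x} e = begin
        p                              ≈⟨ solve 1 (λ p → p := (k 1 :* k 1 :* k 1) :* p) refl p ⟩
        1# * 1# * 1# * p               ≈⟨ *-congʳ (*-cong (*-cong Di Di) Di) ⟨
        D * i * (D * i) * (D * i) * p  ≈⟨ solve 3 (λ d i p → d :* i :* (d :* i) :* (d :* i) :* p := d :* d :* d :* p :* (i :* i :* i)) refl D i p ⟩
        D * D * D * p * i³             ≈⟨ *-congʳ (*-congʳ norm-cube) ⟨
        norm D w₁ w₂ * p * i³          ≈⟨ *-congʳ e ⟩
        x * i³ ∎

      p₀-eq : p₀ ≈ i + embed (+ 72) * (q * (a * a * a) * (b * b * b) * i³)
      p₀-eq = begin
        p₀ ≈⟨ unnorm inverse₀ ⟩
        (D * D - q * (w₁ * w₂)) * i³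
          -- The product -q w₁ w₂ contributes 6 · 12 = 72, and D² cancels two of the three factors
          -- i.
          ≈⟨ solve 5 (λ q a b d i → (d :* d :- q :* (:- (k 6 :* (a :* a :* b)) :* (k 12 :* (a :* b :* b)))) :* (i :* i :* i)
               := d :* i :* (d :* i) :* i :+ k 72 :* (q :* (a :* a :* a) :* (b :* b :* b) :* (i :* i :* i))) refl q a b D i ⟩
        D * i * (D * i) * i + embed (+ 72) * (q * (a * a * a) * (b * b * b) * i³)
          ≈⟨ +-congʳ (*-congʳ (*-cong Di Di)) ⟩
        1# * 1# * i + embed (+ 72) * (q * (a * a * a) * (b * b * b) * i³)
          ≈⟨ +-congʳ (trans (*-congʳ (*-identityˡ 1#)) (*-identityˡ i)) ⟩
        i + embed (+ 72) * (q * (a * a * a) * (b * b * b) * i³) ∎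

      p₁-eq : p₁ ≈ embed (+ 6) * (a * a * a * a * (v * v) * b) + embed (+ 144) * (q * (a * a) * (b * b * b * b) * i³)
      p₁-eq = begin
        p₁ ≈⟨ unnorm inverse₁ ⟩
        (q * (w₂ * w₂) - D * w₁) * i³
          -- The term q w₂² contributes 12² = 144; in -D w₁ a single D cancels, leaving i² = a² v².
          ≈⟨ solve 5 (λ q a b d v → let i = a :* v in
               (q :* (k 12 :* (a :* b :* b) :* (k 12 :* (a :* b :* b))) :- d :* (:- (k 6 :* (a :* a :* b)))) :* (i :* i :* i)
               := d :* i :* (k 6 :* (a :* a :* a :* a :* (v :* v) :* b)) :+ k 144 :* (q :* (a :* a) :* (b :* b :* b :* b) :* (i :* i :* i))) refl q a b D v ⟩
        D * i * (embed (+ 6) * (a * a * a * a * (v * v) * b)) + embed (+ 144) * (q * (a * a) * (b * b * b * b) * i³)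
          ≈⟨ +-congʳ (trans (*-congʳ Di) (*-identityˡ _)) ⟩
        embed (+ 6) * (a * a * a * a * (v * v) * b) + embed (+ 144) * (q * (a * a) * (b * b * b * b) * i³) ∎

      p₂-eq : p₂ ≈ embed (+ 24) * (a * a * a * (v * v) * (b * b)) + embed (+ 288) * (q * a * (b * b * b * b * b) * i³)
      p₂-eq = begin
        p₂ ≈⟨ unnorm inverse₂ ⟩
        (w₁ * w₁ - D * w₂) * i³
          -- Here `D` is expanded: w₁² - D w₂ = 24a⁴b² + 96qab⁵, and 24a⁴b² = 24ab² D + 192qab⁵,
          -- which accounts for 288.
          ≈⟨ solve 4 (λ q a b v → let i = a :* v; d = a :* a :* a :- k 8 :* (q :* (b :* b :* b)) in
               (:- (k 6 :* (a :* a :* b)) :* (:- (k 6 :* (a :* a :* b))) :- d :* (k 12 :* (a :* b :* b))) :* (i :* i :* i)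
               := d :* i :* (k 24 :* (a :* a :* a :* (v :* v) :* (b :* b))) :+ k 288 :* (q :* a :* (b :* b :* b :* b :* b) :* (i :* i :* i))) refl q a b v ⟩
        D * i * (embed (+ 24) * (a * a * a * (v * v) * (b * b))) + embed (+ 288) * (q * a * (b * b * b * b * b) * i³)
          ≈⟨ +-congʳ (trans (*-congʳ Di) (*-identityˡ _)) ⟩
        embed (+ 24) * (a * a * a * (v * v) * (b * b)) + embed (+ 288) * (q * a * (b * b * b * b * b) * i³) ∎

-- Formal power series

open import Data.Product.Base using (_,_; ∃-syntax; _×_)
open ≡ using (refl; sym; trans; cong; cong₂; subst)
open import Data.Integer using (-_; _+_; _*_; _-_)

-- A record instead of a bare family of equations, so that `f` and `g` can be inferred from the type
-- of a proof.
record _≋_ (f g : PS) : Set where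
  constructor coeffwise
  field coeff : ∀ n → f n ≡ g n
open _≋_ public

infix 4 _≋_

-- f ≡ g modulo q^(n+1).
Agree : ℕ → PS → PS → Set
Agree n f g = ∀ i → i ≤ n → f i ≡ g i

tail : PS → PS
tail f n = f (suc n)

_⊞_ : PS → PS → PS
(f ⊞ g) n = f n + g n

⊟_ : PS → PS
(⊟ f) n = - f n

zeroPS : PS
zeroPS _ = + 0

sumTo-cong : ∀ {f g} n → (∀ i → i ≤ n → f i ≡ g i) → sumTo f n ≡ sumTo g n
sumTo-cong zero    f≡g = f≡g 0 z≤n
sumTo-cong (suc n) f≡g = cong₂ _+_ (sumTo-cong n λ i i≤n → f≡g i (ℕ.m≤n⇒m≤1+n i≤n)) (f≡g (suc n) ℕ.≤-refl)

sumTo-suc : ∀ f n → sumTo f (suc n) ≡ f 0 + sumTo (tail f) n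
sumTo-suc f zero    = refl
sumTo-suc f (suc n) = trans (cong (_+ f (suc (suc n))) (sumTo-suc f n)) (ℤ.+-assoc (f 0) _ _)

-- Writing f as its constant term plus q times its tail. The ring laws follow from this by induction
-- on the degree.
mul-suc : ∀ f g n → mul f g (suc n) ≡ f 0 * g (suc n) + mul (tail f) g n
mul-suc f g n = sumTo-suc _ n

mul-agree : ∀ n {f f′ g g′} → Agree n f f′ → Agree n g g′ → Agree n (mul f g) (mul f′ g′)
mul-agree n p q i i≤n = sumTo-cong i λ j j≤i →
  cong₂ _*_ (p j (ℕ.≤-trans j≤i i≤n)) (q (i ∸ j) (ℕ.≤-trans (ℕ.m∸n≤m i j) i≤n))

agree : ∀ {f g} n → f ≋ g → Agree n f g
agree n p i _ = coeff p i

mul-cong : ∀ {f f′ g g′} → f ≋ f′ → g ≋ g′ → mul f g ≋ mul f′ g′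
mul-cong p q = coeffwise λ n → mul-agree n (agree n p) (agree n q) n ℕ.≤-refl

module _ where
  open +-*-Solver

  -- `mul-suc` opens only the left factor, so the step opens both in turn and uses the two preceding
  -- degrees.
  mul-comm′ : ∀ n f g → mul f g n ≡ mul g f n
  mul-comm′ zero          f g = ℤ.*-comm (f 0) (g 0)
  mul-comm′ (suc zero)    f g =
    solve 4 (λ a b c d → a :* b :+ c :* d := d :* c :+ b :* a) refl (f 0) (g 1) (f 1) (g 0)
  mul-comm′ (suc (suc n)) f g = begin
    mul f g (2 ℕ.+ n)                                                ≡⟨ mul-suc f g (suc n) ⟩
    f 0 * g (2 ℕ.+ n) + mul (tail f) g (suc n)                       ≡⟨ cong (λ x → f 0 * g (2 ℕ.+ n) + x) (mul-comm′ (suc n) (tail f) g) ⟩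
    f 0 * g (2 ℕ.+ n) + mul g (tail f) (suc n)                       ≡⟨ cong (λ x → f 0 * g (2 ℕ.+ n) + x) (mul-suc g (tail f) n) ⟩
    f 0 * g (2 ℕ.+ n) + (g 0 * f (2 ℕ.+ n) + mul (tail g) (tail f) n) ≡⟨ cong (λ x → f 0 * g (2 ℕ.+ n) + (g 0 * f (2 ℕ.+ n) + x)) (mul-comm′ n (tail g) (tail f)) ⟩
    f 0 * g (2 ℕ.+ n) + (g 0 * f (2 ℕ.+ n) + mul (tail f) (tail g) n) ≡⟨ solve 3 (λ a b c → a :+ (b :+ c) := b :+ (a :+ c)) refl (f 0 * g (2 ℕ.+ n)) (g 0 * f (2 ℕ.+ n)) (mul (tail f) (tail g) n) ⟩
    g 0 * f (2 ℕ.+ n) + (f 0 * g (2 ℕ.+ n) + mul (tail f) (tail g) n) ≡⟨ cong (λ x → g 0 * f (2 ℕ.+ n) + x) (mul-suc f (tail g) n) ⟨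
    g 0 * f (2 ℕ.+ n) + mul f (tail g) (suc n)                       ≡⟨ cong (λ x → g 0 * f (2 ℕ.+ n) + x) (mul-comm′ (suc n) f (tail g)) ⟩
    g 0 * f (2 ℕ.+ n) + mul (tail g) f (suc n)                       ≡⟨ mul-suc g f (suc n) ⟨
    mul g f (2 ℕ.+ n)                                                ∎
    where open ≡.≡-Reasoning

  mul-distribʳ′ : ∀ n f g h → mul (f ⊞ g) h n ≡ mul f h n + mul g h n
  mul-distribʳ′ zero    f g h = ℤ.*-distribʳ-+ (h 0) (f 0) (g 0)
  mul-distribʳ′ (suc n) f g h = begin
    mul (f ⊞ g) h (suc n)                                           ≡⟨ mul-suc (f ⊞ g) h n ⟩
    (f 0 + g 0) * h (suc n) + mul (tail f ⊞ tail g) h n             ≡⟨ cong (λ x → (f 0 + g 0) * h (suc n) + x) (mul-distribʳ′ n (tail f) (tail g) h) ⟩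
    (f 0 + g 0) * h (suc n) + (mul (tail f) h n + mul (tail g) h n) ≡⟨ solve 5 (λ a b c x y → (a :+ b) :* c :+ (x :+ y) := (a :* c :+ x) :+ (b :* c :+ y)) refl (f 0) (g 0) (h (suc n)) (mul (tail f) h n) (mul (tail g) h n) ⟩
    f 0 * h (suc n) + mul (tail f) h n + (g 0 * h (suc n) + mul (tail g) h n) ≡⟨ cong₂ _+_ (mul-suc f h n) (mul-suc g h n) ⟨
    mul f h (suc n) + mul g h (suc n)                               ∎
    where open ≡.≡-Reasoning

  mul-scale′ : ∀ n c f g → mul (scale c f) g n ≡ c * mul f g n
  mul-scale′ zero    c f g = ℤ.*-assoc c (f 0) (g 0)
  mul-scale′ (suc n) c f g = begin
    mul (scale c f) g (suc n)                            ≡⟨ mul-suc (scale c f) g n ⟩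
    c * f 0 * g (suc n) + mul (scale c (tail f)) g n     ≡⟨ cong (λ x → c * f 0 * g (suc n) + x) (mul-scale′ n c (tail f) g) ⟩
    c * f 0 * g (suc n) + c * mul (tail f) g n           ≡⟨ solve 4 (λ c a b x → c :* a :* b :+ c :* x := c :* (a :* b :+ x)) refl c (f 0) (g (suc n)) (mul (tail f) g n) ⟩
    c * (f 0 * g (suc n) + mul (tail f) g n)             ≡⟨ cong (c *_) (mul-suc f g n) ⟨
    c * mul f g (suc n)                                  ∎
    where open ≡.≡-Reasoning

  mul-assoc′ : ∀ n f g h → mul (mul f g) h n ≡ mul f (mul g h) n
  mul-assoc′ zero    f g h = ℤ.*-assoc (f 0) (g 0) (h 0)
  mul-assoc′ (suc n) f g h = begin
    mul (mul f g) h (suc n)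
      ≡⟨ mul-suc (mul f g) h n ⟩
    f 0 * g 0 * h (suc n) + mul (tail (mul f g)) h n
      ≡⟨ cong (λ x → f 0 * g 0 * h (suc n) + x) (mul-agree n {g = h} (λ i _ → mul-suc f g i) (λ _ _ → refl) n ℕ.≤-refl) ⟩
    f 0 * g 0 * h (suc n) + mul (scale (f 0) (tail g) ⊞ mul (tail f) g) h n
      ≡⟨ cong (λ x → f 0 * g 0 * h (suc n) + x) (mul-distribʳ′ n (scale (f 0) (tail g)) (mul (tail f) g) h) ⟩
    f 0 * g 0 * h (suc n) + (mul (scale (f 0) (tail g)) h n + mul (mul (tail f) g) h n)
      ≡⟨ cong₂ (λ x y → f 0 * g 0 * h (suc n) + (x + y)) (mul-scale′ n (f 0) (tail g) h) (mul-assoc′ n (tail f) g h) ⟩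
    f 0 * g 0 * h (suc n) + (f 0 * mul (tail g) h n + mul (tail f) (mul g h) n)
      ≡⟨ solve 5 (λ a b c x y → a :* b :* c :+ (a :* x :+ y) := a :* (b :* c :+ x) :+ y) refl (f 0) (g 0) (h (suc n)) (mul (tail g) h n) (mul (tail f) (mul g h) n) ⟩
    f 0 * (g 0 * h (suc n) + mul (tail g) h n) + mul (tail f) (mul g h) n
      ≡⟨ cong (λ x → f 0 * x + mul (tail f) (mul g h) n) (mul-suc g h n) ⟨
    f 0 * mul g h (suc n) + mul (tail f) (mul g h) n
      ≡⟨ mul-suc f (mul g h) n ⟨
    mul f (mul g h) (suc n) ∎
    where open ≡.≡-Reasoning

mul-zeroˡ′ : ∀ n f → mul zeroPS f n ≡ + 0
mul-zeroˡ′ zero    f = refl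
mul-zeroˡ′ (suc n) f = trans (mul-suc zeroPS f n) (trans (ℤ.+-identityˡ _) (mul-zeroˡ′ n f))

mul-identityˡ : ∀ f → mul one f ≋ f
mul-identityˡ f = coeffwise λ where
  zero    → ℤ.*-identityˡ (f 0)
  (suc n) → trans (mul-suc one f n) (trans (cong (_+_ (+ 1 * f (suc n))) (mul-zeroˡ′ n f))
              (trans (ℤ.+-identityʳ _) (ℤ.*-identityˡ _)))

mul-comm : ∀ f g → mul f g ≋ mul g f
mul-comm f g = coeffwise λ n → mul-comm′ n f g

mul-distribʳ : ∀ h f g → mul (f ⊞ g) h ≋ mul f h ⊞ mul g h
mul-distribʳ h f g = coeffwise λ n → mul-distribʳ′ n f g h

≋-refl : ∀ {f} → f ≋ f
≋-refl = coeffwise λ _ → refl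

≋-sym : ∀ {f g} → f ≋ g → g ≋ f
≋-sym p = coeffwise λ n → sym (coeff p n)

≋-trans : ∀ {f g h} → f ≋ g → g ≋ h → f ≋ h
≋-trans p q = coeffwise λ n → trans (coeff p n) (coeff q n)

-- The operations are opaque so that unification never unfolds a series into its coefficients.
opaque
  infixl 6 _⊕_
  infixl 7 _⊛_
  infix  8 ⊖_

  _⊕_ _⊛_ : PS → PS → PS
  _⊕_ = _⊞_
  _⊛_ = mul

  ⊖_ : PS → PS
  ⊖_ = ⊟_

  ⊛-coeff : ∀ f g n → (f ⊛ g) n ≡ mul f g n
  ⊛-coeff f g n = refl

  ⊕-coeff : ∀ f g n → (f ⊕ g) n ≡ f n + g n
  ⊕-coeff f g n = refl

  ⊖-coeff : ∀ f n → (⊖ f) n ≡ - f n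
  ⊖-coeff f n = refl

  PS-isCommutativeRing : IsCommutativeRing _≋_ _⊕_ _⊛_ ⊖_ zeroPS one
  PS-isCommutativeRing = record
    { isRing = record
      { +-isAbelianGroup = record
        { isGroup = record
          { isMonoid = record
            { isSemigroup = record
              { isMagma = record
                { isEquivalence = record { refl = ≋-refl ; sym = ≋-sym ; trans = ≋-trans }
                ; ∙-cong = λ p q → coeffwise λ n → cong₂ _+_ (coeff p n) (coeff q n)
                }
              ; assoc = λ f g h → coeffwise λ n → ℤ.+-assoc (f n) (g n) (h n)
              }
            ; identity = (λ f → coeffwise λ n → ℤ.+-identityˡ (f n)) , (λ f → coeffwise λ n → ℤ.+-identityʳ (f n))
            }
          ; inverse = (λ f → coeffwise λ n → ℤ.+-inverseˡ (f n)) , (λ f → coeffwise λ n → ℤ.+-inverseʳ (f n))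
          ; ⁻¹-cong = λ p → coeffwise λ n → cong -_ (coeff p n)
          }
        ; comm = λ f g → coeffwise λ n → ℤ.+-comm (f n) (g n)
        }
      ; *-cong = mul-cong
      ; *-assoc = λ f g h → coeffwise λ n → mul-assoc′ n f g h
      ; *-identity = mul-identityˡ , λ f → ≋-trans (mul-comm f one) (mul-identityˡ f)
      ; distrib = (λ h f g → ≋-trans (mul-comm h (f ⊞ g)) (≋-trans (mul-distribʳ h f g)
                    (coeffwise λ n → cong₂ _+_ (mul-comm′ n f h) (mul-comm′ n g h)))) , mul-distribʳ
      }
    ; *-comm = mul-comm
    }

PS-ring : CommutativeRing 0ℓ 0ℓ
PS-ring = record { isCommutativeRing = PS-isCommutativeRing }

⊛-mul : ∀ f g → f ⊛ g ≋ mul f g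
⊛-mul f g = coeffwise (⊛-coeff f g)

⊛-agree : ∀ n {f f′ g g′} → Agree n f f′ → Agree n g g′ → Agree n (f ⊛ g) (f′ ⊛ g′)
⊛-agree n {f} {f′} {g} {g′} p q i i≤n =
  trans (⊛-coeff f g i) (trans (mul-agree n p q i i≤n) (sym (⊛-coeff f′ g′ i)))

-- The local function of invL cannot be named; unification recovers it.
invL-go : PS → ℕ → ℕ → List ℤ → ℤ
inv-suc : ∀ f n → inv f (suc n) ≡ - invL-go f n 0 (invL f n)
invL-go = _
inv-suc f n with 0 | invL f n
... | k | xs = refl

-- The loop pairs f (k + 1), f (k + 2), ... with a list of coefficients stored in reverse, so it is
-- a Cauchy product. The offset `k` and the shifted series `h` are general because the loop advances
-- both.
invL-go-mul : ∀ f n h k m → (∀ i → f (suc (k ℕ.+ i)) ≡ h i) → invL-go f n k (invL f m) ≡ mul h (inv f) m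
invL-go-mul f n h k zero    f≡h =
  trans (ℤ.+-identityʳ _) (cong (_* + 1) (trans (cong (λ j → f (suc j)) (sym (ℕ.+-identityʳ k))) (f≡h 0)))
invL-go-mul f n h k (suc m) f≡h = trans
  (cong₂ _+_ (cong (_* inv f (suc m)) (trans (cong (λ j → f (suc j)) (sym (ℕ.+-identityʳ k))) (f≡h 0)))
    (invL-go-mul f n (tail h) (suc k) m λ i → trans (cong (λ j → f (suc j)) (sym (ℕ.+-suc k i))) (f≡h (suc i))))
  (sym (mul-suc h (inv f) m))

⊛-inv : ∀ f → f 0 ≡ + 1 → f ⊛ inv f ≋ one
⊛-inv f f0≡1 = ≋-trans (⊛-mul f (inv f)) (coeffwise go)
  where
  open ≡.≡-Reasoning
  go : ∀ n → mul f (inv f) n ≡ one n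
  go zero    = trans (ℤ.*-identityʳ (f 0)) f0≡1
  go (suc n) = begin
    mul f (inv f) (suc n)                                          ≡⟨ mul-suc f (inv f) n ⟩
    f 0 * inv f (suc n) + mul (tail f) (inv f) n                   ≡⟨ cong₂ (λ x y → x * y + mul (tail f) (inv f) n) f0≡1 (inv-suc f n) ⟩
    + 1 * - invL-go f n 0 (invL f n) + mul (tail f) (inv f) n      ≡⟨ cong (λ x → + 1 * - x + mul (tail f) (inv f) n) (invL-go-mul f n (tail f) 0 n λ _ → refl) ⟩
    + 1 * - mul (tail f) (inv f) n + mul (tail f) (inv f) n        ≡⟨ cong (_+ mul (tail f) (inv f) n) (ℤ.*-identityˡ (- mul (tail f) (inv f) n)) ⟩
    - mul (tail f) (inv f) n + mul (tail f) (inv f) n              ≡⟨ ℤ.+-inverseˡ (mul (tail f) (inv f) n) ⟩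
    + 0 ∎

-- Monomials and truncated Euler products.

shift : ℕ → PS → PS
shift zero    f = f
shift (suc e) f zero    = + 0
shift (suc e) f (suc n) = shift e f n

mono : ℕ → PS
mono e = shift e one

mono-⊛ : ∀ e f → mono e ⊛ f ≋ shift e f
mono-⊛ e f = ≋-trans (⊛-mul (mono e) f) (coeffwise (go e))
  where
  go : ∀ e n → mul (mono e) f n ≡ shift e f n
  go zero    n       = coeff (mul-identityˡ f) n
  go (suc e) zero    = refl
  go (suc e) (suc n) = trans (mul-suc (mono (suc e)) f n) (trans (ℤ.+-identityˡ _) (go e n))

shift-+ : ∀ a b f → shift a (shift b f) ≋ shift (a ℕ.+ b) f
shift-+ a b f = coeffwise (go a)
  where
  go : ∀ a n → shift a (shift b f) n ≡ shift (a ℕ.+ b) f n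
  go zero    n       = refl
  go (suc a) zero    = refl
  go (suc a) (suc n) = go a n

mono-+ : ∀ a b → mono a ⊛ mono b ≋ mono (a ℕ.+ b)
mono-+ a b = ≋-trans (mono-⊛ a (mono b)) (shift-+ a b one)

shift-agree : ∀ e p {f g} → Agree p f g → Agree (e ℕ.+ p) (shift e f) (shift e g)
shift-agree zero    p f≡g i       i≤ = f≡g i i≤
shift-agree (suc e) p f≡g zero    _        = refl
shift-agree (suc e) p f≡g (suc i) (s≤s i≤) = shift-agree e p f≡g i i≤

mono-self : ∀ e → mono e e ≡ + 1
mono-self zero    = refl
mono-self (suc e) = mono-self e

mono-≢ : ∀ e n → e ≡.≢ n → mono e n ≡ + 0
mono-≢ zero    zero    e≢n = contradiction refl e≢n
mono-≢ zero    (suc n) e≢n = refl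
mono-≢ (suc e) zero    e≢n = refl
mono-≢ (suc e) (suc n) e≢n = mono-≢ e n (λ e≡n → e≢n (cong suc e≡n))

factor-mono : ∀ e → factor (suc e) ≋ one ⊕ (⊖ mono (suc e))
factor-mono e = coeffwise λ n →
  trans (go n) (sym (trans (⊕-coeff one (⊖ mono (suc e)) n) (cong (_+_ (one n)) (⊖-coeff (mono (suc e)) n))))
  where
  go′ : ∀ e n → factor (suc e) (suc n) ≡ + 0 + - mono e n
  go′ zero    zero    = refl
  go′ zero    (suc n) = refl
  go′ (suc e) zero    = refl
  go′ (suc e) (suc n) = go′ e n
  go : ∀ n → factor (suc e) n ≡ one n + - mono (suc e) n
  go zero    = refl
  go (suc n) = go′ e n

module PSR = CommutativeRing PS-ring
module Sol = IntegerCoefficients.Solver PS-ring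
open IntegerCoefficients PS-ring using (embed)
open Identities PS-ring using (∏; module FiniteJacobi) renaming (∑ to ∑PS; ∑-cong to ∑PS-cong; ∑-*ˡ to ∑PS-⊛ˡ)
open Algebra.Properties.Semiring.Exp PSR.semiring using (_^_)
open Algebra.Properties.Semiring.Mult.TCOptimised PSR.semiring using (1+×)
module PS-Reasoning = Relation.Binary.Reasoning.Setoid PSR.setoid
open PS-Reasoning
module R = ≡.≡-Reasoning

qprodFin-suc : ∀ m N → qprodFin m (suc N) ≋ qprodFin m N ⊛ factor (m ℕ.* suc N)
qprodFin-suc m N = ≋-sym (⊛-mul _ _)

qprodFin-0 : ∀ m N → qprodFin (suc m) N 0 ≡ + 1
qprodFin-0 m zero    = refl
qprodFin-0 m (suc N) = cong (_* + 1) (qprodFin-0 m N)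

⊛-factor-agree : ∀ f e → Agree e (f ⊛ factor (suc e)) f
⊛-factor-agree f e i i≤e = trans
  (⊛-agree e {f} {f} {factor (suc e)} {one} (λ _ _ → refl) (factor≡1 e) i i≤e)
  (coeff (PSR.*-identityʳ f) i)
  where
  factor≡1 : ∀ e → Agree e (factor (suc e)) one
  factor≡1 e zero    i≤e = refl
  factor≡1 e (suc i) i≤e = trans (coeff (factor-mono e) (suc i))
    (trans (⊕-coeff one _ (suc i)) (trans (ℤ.+-identityˡ _) (trans (⊖-coeff (mono (suc e)) (suc i))
      (cong -_ (mono-≢ e i λ where refl → ℕ.<-irrefl refl i≤e)))))

qprodFin-agree-suc : ∀ m N → Agree N (qprodFin (suc m) (suc N)) (qprodFin (suc m) N)
qprodFin-agree-suc m N i i≤N = trans (coeff (qprodFin-suc (suc m) N) i) (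
  ⊛-factor-agree (qprodFin (suc m) N) (N ℕ.+ m ℕ.* suc N) i (ℕ.≤-trans i≤N (ℕ.m≤m+n N _)))

-- Coefficient i of `qpoch` is read off the i-th partial product. All later factors are 1 modulo
-- q^(i + 1), so the longer products agree with it there.
qpoch-agree : ∀ m N → Agree N (qprodFin (suc m) N) (qpoch (suc m))
qpoch-agree m zero    zero z≤n = refl
qpoch-agree m (suc N) i i≤ with ℕ.m≤n⇒m<n∨m≡n i≤
... | inj₂ refl       = refl
... | inj₁ (s≤s i≤N) = trans (qprodFin-agree-suc m N i i≤N) (qpoch-agree m N i i≤N)

-- Sections modulo 3

-- For r below 3 these are the series with f(q) = f₀(q³) + q f₁(q³) + q² f₂(q³). Replacing q by ω =
-- q^(1/3) makes the triple an element of the cubic extension over the series ring.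
section : ℕ → PS → PS
section r f n = f (3 ℕ.* n ℕ.+ r)

open Twisted PS-ring (mono 1)

tail₃ : PS → PS
tail₃ f n = f (3 ℕ.+ n)

section-tail₃ : ∀ r f → tail (section r f) ≋ section r (tail₃ f)
section-tail₃ r f = coeffwise λ n → cong (λ k → f (k ℕ.+ r)) (ℕ.*-suc 3 n)

⊛-zero : ∀ f g → (f ⊛ g) 0 ≡ f 0 * g 0
⊛-zero f g = ⊛-coeff f g 0

⊛-suc : ∀ f g n → (f ⊛ g) (suc n) ≡ f 0 * g (suc n) + (tail f ⊛ g) n
⊛-suc f g n = trans (⊛-coeff f g (suc n)) (trans (mul-suc f g n) (cong (_+_ (f 0 * g (suc n))) (sym (⊛-coeff (tail f) g n))))

q : PS
q = mono 1

q⊛-suc : ∀ f n → (q ⊛ f) (suc n) ≡ f n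
q⊛-suc f n = coeff (mono-⊛ 1 f) (suc n)

-- Serves the terms carrying a factor q: their degree has already dropped by one, so no successor is
-- left for `⊛-suc` to match.
⊛-unfold : ∀ f g n → (f ⊛ g) n ≡ f 0 * g n + (q ⊛ (tail f ⊛ g)) n
⊛-unfold f g zero    = trans (⊛-zero f g) (sym (trans (cong (_+_ (f 0 * g 0)) (⊛-zero q _)) (ℤ.+-identityʳ _)))
⊛-unfold f g (suc n) = trans (⊛-suc f g n) (cong (_+_ (f 0 * g (suc n))) (sym (q⊛-suc (tail f ⊛ g) n)))

⊛-suc₃ : ∀ f g n → (f ⊛ g) (3 ℕ.+ n) ≡ f 0 * g (3 ℕ.+ n) + (f 1 * g (2 ℕ.+ n) + (f 2 * g (1 ℕ.+ n) + (tail₃ f ⊛ g) n))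
⊛-suc₃ f g n = trans (⊛-suc f g (2 ℕ.+ n)) (cong (_+_ (f 0 * g (3 ℕ.+ n))) (trans (⊛-suc (tail f) g (1 ℕ.+ n))
  (cong (_+_ (f 1 * g (2 ℕ.+ n))) (⊛-suc (tail (tail f)) g n))))

mul₀-coeff : ∀ f₀ f₁ f₂ g₀ g₁ g₂ n →
  mul₀ f₀ f₁ f₂ g₀ g₁ g₂ n ≡ (f₀ ⊛ g₀) n + ((q ⊛ (f₁ ⊛ g₂)) n + (q ⊛ (f₂ ⊛ g₁)) n)
mul₀-coeff f₀ f₁ f₂ g₀ g₁ g₂ n = trans (⊕-coeff _ _ n) (cong (_+_ ((f₀ ⊛ g₀) n))
  (trans (coeff (PSR.distribˡ q (f₁ ⊛ g₂) (f₂ ⊛ g₁)) n) (⊕-coeff _ _ n)))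

mul₁-coeff : ∀ f₀ f₁ f₂ g₀ g₁ g₂ n →
  mul₁ f₀ f₁ f₂ g₀ g₁ g₂ n ≡ (f₀ ⊛ g₁) n + (f₁ ⊛ g₀) n + (q ⊛ (f₂ ⊛ g₂)) n
mul₁-coeff f₀ f₁ f₂ g₀ g₁ g₂ n = trans (⊕-coeff _ _ n) (cong (_+ (q ⊛ (f₂ ⊛ g₂)) n) (⊕-coeff _ _ n))

mul₂-coeff : ∀ f₀ f₁ f₂ g₀ g₁ g₂ n →
  mul₂ f₀ f₁ f₂ g₀ g₁ g₂ n ≡ (f₀ ⊛ g₂) n + (f₁ ⊛ g₁) n + (f₂ ⊛ g₀) n
mul₂-coeff f₀ f₁ f₂ g₀ g₁ g₂ n = trans (⊕-coeff _ _ n) (cong (_+ (f₂ ⊛ g₀) n) (⊕-coeff _ _ n))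

section-+ : ∀ a b f n → f (a ℕ.+ (3 ℕ.* n ℕ.+ b)) ≡ section (a ℕ.+ b) f n
section-+ a b f n = cong f (ℕ-Solver.solve 3 (λ a b x → a :+ (x :+ b) := x :+ (a :+ b)) refl a b (3 ℕ.* n))
  where open ℕ-Solver

section-suc : ∀ r f n → f (3 ℕ.+ (3 ℕ.* n ℕ.+ r)) ≡ section r f (suc n)
section-suc r f n = coeff (≋-sym (section-tail₃ r f)) n

section-suc′ : ∀ r f n → section (3 ℕ.+ r) f n ≡ section r f (suc n)
section-suc′ r f n = trans (sym (section-+ 3 r f n)) (section-suc r f n)

section-⊛-suc : ∀ r f g n → section r (f ⊛ g) (suc n) ≡
  f 0 * section r g (suc n) + (f 1 * section (2 ℕ.+ r) g n + (f 2 * section (1 ℕ.+ r) g n + section r (tail₃ f ⊛ g) n))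
section-⊛-suc r f g n = trans (sym (section-suc r (f ⊛ g) n)) (trans (⊛-suc₃ f g (3 ℕ.* n ℕ.+ r))
  (cong₂ (λ x y → f 0 * x + y) (section-suc r g n)
    (cong₂ (λ x y → f 1 * x + y) (section-+ 2 r g n)
      (cong₂ (λ x y → f 2 * x + y) (section-+ 1 r g n) refl))))

-- Removing three coefficients of f removes one from each of its sections, so both sides obey the
-- same recursion; the induction is on the degree, for all f at once.
section₀-⊛ : ∀ f g → section 0 (f ⊛ g) ≋
  mul₀ (section 0 f) (section 1 f) (section 2 f) (section 0 g) (section 1 g) (section 2 g)
section₀-⊛ f g = coeffwise (go f)
  where
  go : ∀ f n → section 0 (f ⊛ g) n ≡
    mul₀ (section 0 f) (section 1 f) (section 2 f) (section 0 g) (section 1 g) (section 2 g) n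
  go f zero    = trans (⊛-zero f g) (sym (trans (mul₀-coeff _ _ _ _ _ _ 0)
    (trans (cong₂ _+_ (⊛-zero _ _) (cong₂ _+_ (⊛-zero q _) (⊛-zero q _))) (ℤ.+-identityʳ _))))
  go f (suc n) = trans (section-⊛-suc 0 f g n) (trans
    (cong (λ x → f 0 * G₀ (suc n) + (f 1 * G₂ n + (f 2 * G₁ n + x)))
      (trans (go (tail₃ f) n) (trans
        (sym (coeff tails n))
        (mul₀-coeff (tail F₀) (tail F₁) (tail F₂) G₀ G₁ G₂ n))))
    (trans
      (solve 6 (λ a b c x y z → a :+ (b :+ (c :+ (x :+ (y :+ z)))) := (a :+ x) :+ ((b :+ y) :+ (c :+ z))) refl
        (f 0 * G₀ (suc n)) (f 1 * G₂ n) (f 2 * G₁ n)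
        ((tail F₀ ⊛ G₀) n) ((q ⊛ (tail F₁ ⊛ G₂)) n) ((q ⊛ (tail F₂ ⊛ G₁)) n))
      (sym (trans (mul₀-coeff F₀ F₁ F₂ G₀ G₁ G₂ (suc n)) (cong₂ _+_ (⊛-suc F₀ G₀ n) (cong₂ _+_
        (trans (q⊛-suc (F₁ ⊛ G₂) n) (⊛-unfold F₁ G₂ n)) (trans (q⊛-suc (F₂ ⊛ G₁) n) (⊛-unfold F₂ G₁ n))))))))
    where
    open +-*-Solver
    F₀ = section 0 f ; F₁ = section 1 f ; F₂ = section 2 f
    G₀ = section 0 g ; G₁ = section 1 g ; G₂ = section 2 g
    tails : mul₀ (tail F₀) (tail F₁) (tail F₂) G₀ G₁ G₂ ≋
            mul₀ (section 0 (tail₃ f)) (section 1 (tail₃ f)) (section 2 (tail₃ f)) G₀ G₁ G₂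
    tails = mul₀-cong (section-tail₃ 0 f) (section-tail₃ 1 f) (section-tail₃ 2 f) ≋-refl ≋-refl ≋-refl

section₁-⊛ : ∀ f g → section 1 (f ⊛ g) ≋
  mul₁ (section 0 f) (section 1 f) (section 2 f) (section 0 g) (section 1 g) (section 2 g)
section₁-⊛ f g = coeffwise (go f)
  where
  go : ∀ f n → section 1 (f ⊛ g) n ≡
    mul₁ (section 0 f) (section 1 f) (section 2 f) (section 0 g) (section 1 g) (section 2 g) n
  go f zero    = trans (⊛-suc f g 0) (trans (cong (_+_ (f 0 * g 1)) (⊛-zero (tail f) g))
    (sym (trans (mul₁-coeff _ _ _ _ _ _ 0)
      (trans (cong₂ _+_ (cong₂ _+_ (⊛-zero _ _) (⊛-zero _ _)) (⊛-zero q _)) (ℤ.+-identityʳ _)))))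
  go f (suc n) = trans (section-⊛-suc 1 f g n) (trans
    (cong₂ (λ y x → f 0 * G₁ (suc n) + (f 1 * y + (f 2 * G₂ n + x))) (section-suc′ 0 g n)
      (trans (go (tail₃ f) n)
        (trans (sym (coeff tails n)) (mul₁-coeff (tail F₀) (tail F₁) (tail F₂) G₀ G₁ G₂ n))))
    (trans
      (solve 6 (λ a b c x y z → a :+ (b :+ (c :+ ((x :+ y) :+ z))) := ((a :+ x) :+ (b :+ y)) :+ (c :+ z)) refl
        (f 0 * G₁ (suc n)) (f 1 * G₀ (suc n)) (f 2 * G₂ n)
        ((tail F₀ ⊛ G₁) n) ((tail F₁ ⊛ G₀) n) ((q ⊛ (tail F₂ ⊛ G₂)) n))
      (sym (trans (mul₁-coeff F₀ F₁ F₂ G₀ G₁ G₂ (suc n)) (cong₂ _+_ (cong₂ _+_ (⊛-suc F₀ G₁ n) (⊛-suc F₁ G₀ n))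
        (trans (q⊛-suc (F₂ ⊛ G₂) n) (⊛-unfold F₂ G₂ n)))))))
    where
    open +-*-Solver
    F₀ = section 0 f ; F₁ = section 1 f ; F₂ = section 2 f
    G₀ = section 0 g ; G₁ = section 1 g ; G₂ = section 2 g
    tails : mul₁ (tail F₀) (tail F₁) (tail F₂) G₀ G₁ G₂ ≋
            mul₁ (section 0 (tail₃ f)) (section 1 (tail₃ f)) (section 2 (tail₃ f)) G₀ G₁ G₂
    tails = mul₁-cong (section-tail₃ 0 f) (section-tail₃ 1 f) (section-tail₃ 2 f) ≋-refl ≋-refl ≋-refl

section₂-⊛ : ∀ f g → section 2 (f ⊛ g) ≋
  mul₂ (section 0 f) (section 1 f) (section 2 f) (section 0 g) (section 1 g) (section 2 g)
section₂-⊛ f g = coeffwise (go f)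
  where
  go : ∀ f n → section 2 (f ⊛ g) n ≡
    mul₂ (section 0 f) (section 1 f) (section 2 f) (section 0 g) (section 1 g) (section 2 g) n
  go f zero    = trans (⊛-suc f g 1) (trans (cong (_+_ (f 0 * g 2)) (trans (⊛-suc (tail f) g 0)
    (cong (_+_ (f 1 * g 1)) (⊛-zero (tail (tail f)) g))))
    (trans (sym (ℤ.+-assoc (f 0 * g 2) _ _)) (sym (trans (mul₂-coeff _ _ _ _ _ _ 0)
      (cong₂ _+_ (cong₂ _+_ (⊛-zero _ _) (⊛-zero _ _)) (⊛-zero _ _))))))
  go f (suc n) = trans (section-⊛-suc 2 f g n) (trans
    (trans
      (cong₂ (λ y x → f 0 * G₂ (suc n) + (f 1 * y + (f 2 * section 3 g n + x))) (section-suc′ 1 g n)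
        (trans (go (tail₃ f) n)
          (trans (sym (coeff tails n)) (mul₂-coeff (tail F₀) (tail F₁) (tail F₂) G₀ G₁ G₂ n))))
      (cong (λ y → f 0 * G₂ (suc n) + (f 1 * G₁ (suc n) + (f 2 * y + ((tail F₀ ⊛ G₂) n + (tail F₁ ⊛ G₁) n + (tail F₂ ⊛ G₀) n))))
        (section-suc′ 0 g n)))
    (trans
      (solve 6 (λ a b c x y z → a :+ (b :+ (c :+ ((x :+ y) :+ z))) := ((a :+ x) :+ (b :+ y)) :+ (c :+ z)) refl
        (f 0 * G₂ (suc n)) (f 1 * G₁ (suc n)) (f 2 * G₀ (suc n))
        ((tail F₀ ⊛ G₂) n) ((tail F₁ ⊛ G₁) n) ((tail F₂ ⊛ G₀) n))
      (sym (trans (mul₂-coeff F₀ F₁ F₂ G₀ G₁ G₂ (suc n)) (cong₂ _+_ (cong₂ _+_ (⊛-suc F₀ G₂ n) (⊛-suc F₁ G₁ n)) (⊛-suc F₂ G₀ n))))))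
    where
    open +-*-Solver
    F₀ = section 0 f ; F₁ = section 1 f ; F₂ = section 2 f
    G₀ = section 0 g ; G₁ = section 1 g ; G₂ = section 2 g
    tails : mul₂ (tail F₀) (tail F₁) (tail F₂) G₀ G₁ G₂ ≋
            mul₂ (section 0 (tail₃ f)) (section 1 (tail₃ f)) (section 2 (tail₃ f)) G₀ G₁ G₂
    tails = mul₂-cong (section-tail₃ 0 f) (section-tail₃ 1 f) (section-tail₃ 2 f) ≋-refl ≋-refl ≋-refl

-- The Jacobi triple product

scale-⊛ : ∀ c f g → scale c f ⊛ g ≋ scale c (f ⊛ g)
scale-⊛ c f g = coeffwise λ n → trans (⊛-coeff (scale c f) g n)
  (trans (mul-scale′ n c f g) (cong (c *_) (sym (⊛-coeff f g n))))

scale-cong : ∀ c {f g} → f ≋ g → scale c f ≋ scale c g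
scale-cong c f≋g = coeffwise λ n → cong (c *_) (coeff f≋g n)

scale-one-⊛ : ∀ c f → scale c one ⊛ f ≋ scale c f
scale-one-⊛ c f = ≋-trans (scale-⊛ c one f) (scale-cong c (PSR.*-identityˡ f))

∑PS-coeff : ∀ f N n → ∑PS f N n ≡ sumTo (λ r → f r n) N
∑PS-coeff f zero    n = refl
∑PS-coeff f (suc N) n = trans (⊕-coeff _ _ n) (cong (_+ f (suc N) n) (∑PS-coeff f N n))

∏-cong : ∀ {f g} N → (∀ j → f j ≋ g j) → ∏ f N ≋ ∏ g N
∏-cong zero    f≋g = ≋-refl
∏-cong (suc N) f≋g = PSR.*-cong (∏-cong N f≋g) (f≋g N)

qprodFin-∏ : ∀ m N → qprodFin m N ≋ ∏ (λ j → factor (m ℕ.* suc j)) N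
qprodFin-∏ m zero    = ≋-refl
qprodFin-∏ m (suc N) = ≋-trans (qprodFin-suc m N) (PSR.*-congʳ (qprodFin-∏ m N))

divideʳ : ∀ {f g h} → g 0 ≡ + 1 → f ⊛ g ≋ h → f ≋ h ⊛ inv g
divideʳ {f} {g} {h} g0≡1 fg≋h = begin
  f                 ≈⟨ PSR.*-identityʳ f ⟨
  f ⊛ one           ≈⟨ PSR.*-congˡ (⊛-inv g g0≡1) ⟨
  f ⊛ (g ⊛ inv g)   ≈⟨ PSR.*-assoc f g (inv g) ⟨
  f ⊛ g ⊛ inv g     ≈⟨ PSR.*-congʳ fg≋h ⟩
  h ⊛ inv g         ∎

⊛-cancelʳ : ∀ {f g} h → h 0 ≡ + 1 → f ⊛ h ≋ g ⊛ h → f ≋ g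
⊛-cancelʳ h h0≡1 e = ≋-trans (divideʳ h0≡1 e) (≋-sym (divideʳ h0≡1 ≋-refl))

twoSided-index : ∀ {a} {A : Set a} (u v : ℕ → A) M r →
  (∃[ j ] (M ℕ.+ j ≡ r × twoSided u v M r ≡ u j)) ⊎ (∃[ j ] (r ℕ.+ j ≡ M × twoSided u v M r ≡ v j))
twoSided-index u v zero    r       = inj₁ (r , refl , refl)
twoSided-index u v (suc M) zero    = inj₂ (suc M , refl , refl)
twoSided-index u v (suc M) (suc r) with twoSided-index u v M r
... | inj₁ (j , e , p) = inj₁ (j , cong suc e , p)
... | inj₂ (j , e , p) = inj₂ (j , cong suc e , p)

sgn : ℕ → ℤ
sgn j = ℤ.-1ℤ ℤ.^ j

-- Equals x j + m j(j - 1)/2. The recursive form avoids the division and follows the recursion of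
-- the Jacobi terms `t`.
exponent : (m x j : ℕ) → ℕ
exponent m x zero    = 0
exponent m x (suc j) = x ℕ.+ m ℕ.* j ℕ.+ exponent m x j

θ-term : (m x j : ℕ) → PS
θ-term m x j = scale (sgn j) (mono (exponent m x j))

exponent-≥ : ∀ m x j → j ≤ exponent m (suc x) j
exponent-≥ m x zero    = z≤n
exponent-≥ m x (suc j) = s≤s (ℕ.≤-trans (exponent-≥ m x j) (ℕ.m≤n+m _ (x ℕ.+ m ℕ.* j)))

-- Coefficient n uses only the terms of index between -n and n: later ones have order above n.
θ-sum : (a b : ℕ) → PS
θ-sum a b n = sumTo (λ r → twoSided (θ-term (a ℕ.+ b) a) (θ-term (a ℕ.+ b) b) n r n) (n ℕ.+ n)

θ-product : (a b n : ℕ) → PS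
θ-product a b n = ∏ (λ j → factor (a ℕ.+ (a ℕ.+ b) ℕ.* j)) n ⊛ ∏ (λ j → factor (b ℕ.+ (a ℕ.+ b) ℕ.* j)) n

module JacobiTripleProduct (a b : ℕ) where

  m : ℕ
  m = suc a ℕ.+ suc b

  A B′ Q : PS
  A  = mono (suc a)
  B′ = mono (suc b)
  Q  = A ⊛ B′

  Q^-mono : ∀ j → Q ^ j ≋ mono (m ℕ.* j)
  Q^-mono zero    = coeffwise λ n → cong (λ k → mono k n) (sym (ℕ.*-zeroʳ m))
  Q^-mono (suc j) = begin
    Q ⊛ Q ^ j                ≈⟨ PSR.*-cong (mono-+ (suc a) (suc b)) (Q^-mono j) ⟩
    mono m ⊛ mono (m ℕ.* j)  ≈⟨ mono-+ m (m ℕ.* j) ⟩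
    mono (m ℕ.+ m ℕ.* j)     ≡⟨ cong mono (ℕ.*-suc m j) ⟨
    mono (m ℕ.* suc j)       ∎

  mono-Q^ : ∀ x j → mono x ⊛ Q ^ j ≋ mono (x ℕ.+ m ℕ.* j)
  mono-Q^ x j = ≋-trans (PSR.*-congˡ (Q^-mono j)) (mono-+ x (m ℕ.* j))

  factor-Q^ : ∀ x j → factor (suc x ℕ.+ m ℕ.* j) ≋ one ⊕ ⊖ (mono (suc x) ⊛ Q ^ j)
  factor-Q^ x j = ≋-trans (factor-mono (x ℕ.+ m ℕ.* j)) (PSR.+-congˡ (PSR.-‿cong (≋-sym (mono-Q^ (suc x) j))))

  factor-Q^suc : ∀ j → factor (m ℕ.* suc j) ≋ one ⊕ ⊖ (Q ^ suc j)
  factor-Q^suc j = ≋-trans (factor-mono _) (PSR.+-congˡ (PSR.-‿cong (≋-sym (Q^-mono (suc j)))))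

  d : ℕ → PS
  d n = inv (qprodFin m n)

  d-inverse : ∀ n → qprodFin m n ⊛ d n ≋ one
  d-inverse n = ⊛-inv (qprodFin m n) (qprodFin-0 _ n)

  d-zero : d 0 ≋ one
  d-zero = ≋-trans (≋-sym (PSR.*-identityˡ _)) (d-inverse 0)

  d-suc : ∀ n → (one ⊕ ⊖ (Q ^ suc n)) ⊛ d (suc n) ≋ d n
  d-suc n = begin
    (one ⊕ ⊖ (Q ^ suc n)) ⊛ d (suc n)   ≈⟨ divideʳ (qprodFin-0 _ n) (begin
      (one ⊕ ⊖ (Q ^ suc n)) ⊛ d (suc n) ⊛ qprodFin m n
        ≈⟨ Sol.solve 3 (λ x y z → x :* y :* z := z :* x :* y) ≋-refl _ _ _ ⟩
      qprodFin m n ⊛ (one ⊕ ⊖ (Q ^ suc n)) ⊛ d (suc n)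
        ≈⟨ PSR.*-congʳ (PSR.*-congˡ (factor-Q^suc n)) ⟨
      qprodFin m n ⊛ factor (m ℕ.* suc n) ⊛ d (suc n)
        ≈⟨ PSR.*-congʳ (qprodFin-suc m n) ⟨
      qprodFin m (suc n) ⊛ d (suc n)
        ≈⟨ d-inverse (suc n) ⟩
      one ∎) ⟩
    one ⊛ d n ≈⟨ PSR.*-identityˡ (d n) ⟩
    d n ∎
    where open Sol

  open FiniteJacobi A B′ d d-zero d-suc using (t; s; T; E; finite-jacobi)

  E-qprodFin : ∀ N → E N ≋ qprodFin m N
  E-qprodFin N = ≋-sym (≋-trans (qprodFin-∏ m N) (∏-cong N factor-Q^suc))

  t-term : ∀ x j → t (mono x) j ≋ θ-term m x j
  t-term x zero    = coeffwise λ n → sym (ℤ.*-identityˡ (one n))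
  t-term x (suc j) = begin
    ⊖ (mono x ⊛ Q ^ j) ⊛ t (mono x) j
      ≈⟨ PSR.*-cong (PSR.-‿cong (mono-Q^ x j)) (t-term x j) ⟩
    ⊖ mono (x ℕ.+ m ℕ.* j) ⊛ scale (sgn j) (mono (exponent m x j))
      ≈⟨ PSR.*-cong (coeffwise λ n → trans (⊖-coeff (mono (x ℕ.+ m ℕ.* j)) n) (sym (ℤ.-1*i≡-i _))) ≋-refl ⟩
    scale ℤ.-1ℤ (mono (x ℕ.+ m ℕ.* j)) ⊛ scale (sgn j) (mono (exponent m x j))
      ≈⟨ scale-⊛ ℤ.-1ℤ _ _ ⟩
    scale ℤ.-1ℤ (mono (x ℕ.+ m ℕ.* j) ⊛ scale (sgn j) (mono (exponent m x j)))
      ≈⟨ scale-cong ℤ.-1ℤ (≋-trans (PSR.*-comm _ _) (scale-⊛ (sgn j) _ _)) ⟩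
    scale ℤ.-1ℤ (scale (sgn j) (mono (exponent m x j) ⊛ mono (x ℕ.+ m ℕ.* j)))
      ≈⟨ scale-cong ℤ.-1ℤ (scale-cong (sgn j) (≋-trans (PSR.*-comm _ _) (mono-+ (x ℕ.+ m ℕ.* j) (exponent m x j)))) ⟩
    scale ℤ.-1ℤ (scale (sgn j) (mono (exponent m x (suc j))))
      ≈⟨ coeffwise (λ n → sym (ℤ.*-assoc ℤ.-1ℤ (sgn j) _)) ⟩
    scale (sgn (suc j)) (mono (exponent m x (suc j))) ∎

  e∞ : PS
  e∞ = qpoch m

  e∞⊛d : ∀ r → Agree r (e∞ ⊛ d r) one
  e∞⊛d r i i≤r = trans
    (⊛-agree r {e∞} {qprodFin m r} {d r} {d r} (λ k k≤r → sym (qpoch-agree (a ℕ.+ suc b) r k k≤r)) (λ _ _ → refl) i i≤r)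
    (coeff (d-inverse r) i)

  -- The deviation of u from 1 starts at degree p + 1, and the monomial moves it to e + p + 1.
  term-⊛ : ∀ c e p u → Agree p u one → ∀ n → n ≤ e ℕ.+ p → (scale c (mono e) ⊛ u) n ≡ scale c (mono e) n
  term-⊛ c e p u u≡1 n n≤ = trans (coeff (scale-⊛ c (mono e) u) n)
    (cong (c *_) (trans (coeff (mono-⊛ e u) n) (shift-agree e p u≡1 n n≤)))

  term : ℕ → ℕ → PS
  term = twoSided (θ-term m (suc a)) (θ-term m (suc b))

  s-term : ∀ n r → s n r ≋ term n r
  s-term zero    r       = t-term (suc a) r
  s-term (suc n) zero    = t-term (suc b) (suc n)
  s-term (suc n) (suc r) = s-term n r

  -- `e∞` times `d r` is the tail of the Euler product after r factors, hence 1 up to degree r; the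
  -- weight is therefore 1 up to the smaller of r and N - r.
  weight : ℕ → ℕ → PS
  weight N r = e∞ ⊛ d r ⊛ (e∞ ⊛ d (N ∸ r))

  weight-agree : ∀ N r p → p ≤ r → p ≤ N ∸ r → Agree p (weight N r) one
  weight-agree N r p p≤r p≤N∸r i i≤p = trans
    (⊛-agree p (λ k k≤p → e∞⊛d r k (ℕ.≤-trans k≤p p≤r)) (λ k k≤p → e∞⊛d (N ∸ r) k (ℕ.≤-trans k≤p p≤N∸r)) i i≤p)
    (coeff (PSR.*-identityˡ one) i)

  -- A term at distance j from the centre has order at least j, and its weight is 1 + O(q^(n-j+1)).
  term-weight : ∀ n r → r ≤ n ℕ.+ n → (term n r ⊛ weight (n ℕ.+ n) r) n ≡ term n r n
  term-weight n r r≤2n = by (twoSided-index (θ-term m (suc a)) (θ-term m (suc b)) n r)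
    where
    by-exponent : ∀ j e p → term n r ≡ scale (sgn j) (mono e) → n ≤ e ℕ.+ p → p ≤ r → p ≤ n ℕ.+ n ∸ r →
      (term n r ⊛ weight (n ℕ.+ n) r) n ≡ term n r n
    by-exponent j e p eq n≤ p≤r p≤ = subst (λ f → (f ⊛ weight (n ℕ.+ n) r) n ≡ f n) (sym eq)
      (term-⊛ (sgn j) e p (weight (n ℕ.+ n) r) (weight-agree (n ℕ.+ n) r p p≤r p≤) n n≤)
    by : _ → (term n r ⊛ weight (n ℕ.+ n) r) n ≡ term n r n
    by (inj₁ (j , n+j≡r , eq)) = by-exponent j (exponent m (suc a) j) (n ∸ j) eq
      (ℕ.≤-trans (ℕ.m≤n+m∸n n j) (ℕ.+-monoˡ-≤ (n ∸ j) (exponent-≥ m a j)))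
      (ℕ.≤-trans (ℕ.m∸n≤m n j) (ℕ.≤-trans (ℕ.m≤m+n n j) (ℕ.≤-reflexive n+j≡r)))
      (ℕ.≤-reflexive (trans (sym (ℕ.[m+n]∸[m+o]≡n∸o n n j)) (cong (n ℕ.+ n ∸_) n+j≡r)))
    by (inj₂ (j , r+j≡n , eq)) = by-exponent j (exponent m (suc b) j) r eq
      (ℕ.≤-trans (ℕ.≤-reflexive (trans (sym r+j≡n) (ℕ.+-comm r j))) (ℕ.+-monoˡ-≤ r (exponent-≥ m b j)))
      ℕ.≤-refl
      (ℕ.m+n≤o⇒m≤o∸n r (ℕ.+-mono-≤ r≤n r≤n))
      where
      r≤n : r ≤ n
      r≤n = ℕ.≤-trans (ℕ.m≤m+n r j) (ℕ.≤-reflexive r+j≡n)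

  ∏-factor : ∀ x N → ∏ (λ j → one ⊕ ⊖ (mono (suc x) ⊛ Q ^ j)) N ≋ ∏ (λ j → factor (suc x ℕ.+ m ℕ.* j)) N
  ∏-factor x N = ∏-cong N λ j → ≋-sym (factor-Q^ x j)

  weighted-sum : ∀ n → e∞ ⊛ T (s n) (n ℕ.+ n) ⊛ e∞ ≋ ∑PS (λ r → term n r ⊛ weight (n ℕ.+ n) r) (n ℕ.+ n)
  weighted-sum n = begin
    e∞ ⊛ T (s n) (n ℕ.+ n) ⊛ e∞
      ≈⟨ Sol.solve 2 (λ x y → x :* y :* x := x :* x :* y) ≋-refl e∞ (T (s n) (n ℕ.+ n)) ⟩
    e∞ ⊛ e∞ ⊛ T (s n) (n ℕ.+ n)
      ≈⟨ ∑PS-⊛ˡ (e∞ ⊛ e∞) _ (n ℕ.+ n) ⟨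
    ∑PS (λ r → e∞ ⊛ e∞ ⊛ (s n r ⊛ (d r ⊛ d (n ℕ.+ n ∸ r)))) (n ℕ.+ n)
      ≈⟨ ∑PS-cong (n ℕ.+ n) (λ r _ → ≋-trans
           (Sol.solve 4 (λ e s x y → e :* e :* (s :* (x :* y)) := s :* (e :* x :* (e :* y))) ≋-refl e∞ (s n r) (d r) (d (n ℕ.+ n ∸ r)))
           (PSR.*-congʳ (s-term n r))) ⟩
    ∑PS (λ r → term n r ⊛ weight (n ℕ.+ n) r) (n ℕ.+ n) ∎
    where open Sol

  -- In degree n the finite identity with n factors on either side suffices. One `e∞` is given and
  -- another replaces (Q;Q) at 2n; together they turn the product of two values of `d` into a weight
  -- invisible in degree n.
  jacobi : ∀ n → (θ-product (suc a) (suc b) n ⊛ qpoch m) n ≡ θ-sum (suc a) (suc b) n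
  jacobi n = R.begin
    (θ-product (suc a) (suc b) n ⊛ e∞) n
      R.≡⟨ coeff (PSR.*-congʳ (PSR.*-cong (∏-factor a n) (∏-factor b n))) n ⟨
    (∏ (λ j → one ⊕ ⊖ (A ⊛ Q ^ j)) n ⊛ ∏ (λ j → one ⊕ ⊖ (B′ ⊛ Q ^ j)) n ⊛ e∞) n
      R.≡⟨ coeff (PSR.*-congʳ (finite-jacobi n n)) n ⟨
    (E (n ℕ.+ n) ⊛ T (s n) (n ℕ.+ n) ⊛ e∞) n
      R.≡⟨ coeff (PSR.*-congʳ (PSR.*-congʳ (E-qprodFin (n ℕ.+ n)))) n ⟩
    (qprodFin m (n ℕ.+ n) ⊛ T (s n) (n ℕ.+ n) ⊛ e∞) n
      R.≡⟨ ⊛-agree n {qprodFin m (n ℕ.+ n) ⊛ T (s n) (n ℕ.+ n)} {e∞ ⊛ T (s n) (n ℕ.+ n)} {e∞} {e∞}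
             (⊛-agree n {qprodFin m (n ℕ.+ n)} {e∞} {T (s n) (n ℕ.+ n)} {T (s n) (n ℕ.+ n)}
               (λ i i≤n → qpoch-agree (a ℕ.+ suc b) (n ℕ.+ n) i (ℕ.≤-trans i≤n (ℕ.m≤m+n n n))) (λ _ _ → refl))
             (λ _ _ → refl) n ℕ.≤-refl ⟩
    (e∞ ⊛ T (s n) (n ℕ.+ n) ⊛ e∞) n
      R.≡⟨ coeff (weighted-sum n) n ⟩
    ∑PS (λ r → term n r ⊛ weight (n ℕ.+ n) r) (n ℕ.+ n) n
      R.≡⟨ ∑PS-coeff _ (n ℕ.+ n) n ⟩
    sumTo (λ r → (term n r ⊛ weight (n ℕ.+ n) r) n) (n ℕ.+ n)
      R.≡⟨ sumTo-cong (n ℕ.+ n) (term-weight n) ⟩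
    sumTo (λ r → term n r n) (n ℕ.+ n) R.∎

-- Euler products for φ(-q), φ(-q³) and B.

⊕-agree : ∀ n {f f′ g g′} → Agree n f f′ → Agree n g g′ → Agree n (f ⊕ g) (f′ ⊕ g′)
⊕-agree n {f} {f′} {g} {g′} p r i i≤n =
  trans (⊕-coeff f g i) (trans (cong₂ _+_ (p i i≤n) (r i i≤n)) (sym (⊕-coeff f′ g′ i)))

⊖-agree : ∀ n {f f′} → Agree n f f′ → Agree n (⊖ f) (⊖ f′)
⊖-agree n {f} {f′} p i i≤n = trans (⊖-coeff f i) (trans (cong -_ (p i i≤n)) (sym (⊖-coeff f′ i)))

⊛-agreeʳ : ∀ n f {g g′} → Agree n g g′ → Agree n (f ⊛ g) (f ⊛ g′)
⊛-agreeʳ n f p = ⊛-agree n {f} {f} (λ _ _ → refl) p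

⊛-agreeˡ : ∀ n g {f f′} → Agree n f f′ → Agree n (f ⊛ g) (f′ ⊛ g)
⊛-agreeˡ n g p = ⊛-agree n {g = g} {g′ = g} p (λ _ _ → refl)

qpoch-agree′ : ∀ p {n N} → n ≤ N → Agree n (qprodFin (suc p) N) (qpoch (suc p))
qpoch-agree′ p {n} {N} n≤N i i≤n = qpoch-agree p N i (ℕ.≤-trans i≤n n≤N)

-- Write x as x d / d; up to degree n the product x d may be replaced by x d′ = f′, and then by f.
-- This passes from finite products to quotients of infinite ones.
agree-quotient : ∀ n {x d d′ f f′} → x ⊛ d′ ≋ f′ → Agree n d′ d → Agree n f′ f → d 0 ≡ + 1 → Agree n x (f ⊛ inv d)
agree-quotient n {x} {d} {d′} {f} {f′} xd′≋f′ d′~d f′~f d0≡1 i i≤n = R.begin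
  x i                    R.≡⟨ coeff (divideʳ d0≡1 ≋-refl) i ⟩
  (x ⊛ d ⊛ inv d) i      R.≡⟨ ⊛-agreeˡ n (inv d) {x ⊛ d′} {x ⊛ d} (⊛-agreeʳ n x d′~d) i i≤n ⟨
  (x ⊛ d′ ⊛ inv d) i     R.≡⟨ coeff (PSR.*-congʳ xd′≋f′) i ⟩
  (f′ ⊛ inv d) i         R.≡⟨ ⊛-agreeˡ n (inv d) {f′} {f} f′~f i i≤n ⟩
  (f ⊛ inv d) i          R.∎

qprodFin-+2 : ∀ m N → qprodFin m (2 ℕ.+ N) ≋ qprodFin m N ⊛ factor (m ℕ.* suc N) ⊛ factor (m ℕ.* (2 ℕ.+ N))
qprodFin-+2 m N = ≋-trans (qprodFin-suc m (suc N)) (PSR.*-congʳ (qprodFin-suc m N))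

qprodFin-+3 : ∀ m N → qprodFin m (3 ℕ.+ N) ≋
  qprodFin m N ⊛ factor (m ℕ.* suc N) ⊛ factor (m ℕ.* (2 ℕ.+ N)) ⊛ factor (m ℕ.* (3 ℕ.+ N))
qprodFin-+3 m N = ≋-trans (qprodFin-suc m (2 ℕ.+ N)) (PSR.*-congʳ (qprodFin-+2 m N))

qprodFin-index : ∀ m {N N′} → N ≡ N′ → qprodFin m N ≋ qprodFin m N′
qprodFin-index m refl = ≋-refl

factor-index : ∀ {e e′} → e ≡ e′ → factor e ≋ factor e′
factor-index refl = ≋-refl

module Gauss (a : ℕ) where
  p : ℕ
  p = suc a

  odd : ℕ → PS
  odd = ∏ (λ j → factor (p ℕ.+ (p ℕ.+ p) ℕ.* j))

  odd-even : ∀ N → odd N ⊛ qprodFin (p ℕ.+ p) N ≋ qprodFin p (2 ℕ.* N)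
  odd-even zero    = PSR.*-identityˡ one
  odd-even (suc N) = begin
    odd N ⊛ factor (p ℕ.+ (p ℕ.+ p) ℕ.* N) ⊛ qprodFin (p ℕ.+ p) (suc N)
      ≈⟨ PSR.*-congˡ (qprodFin-suc (p ℕ.+ p) N) ⟩
    odd N ⊛ factor (p ℕ.+ (p ℕ.+ p) ℕ.* N) ⊛ (qprodFin (p ℕ.+ p) N ⊛ factor ((p ℕ.+ p) ℕ.* suc N))
      ≈⟨ Sol.solve 4 (λ x y z w → x :* y :* (z :* w) := x :* z :* y :* w) ≋-refl _ _ _ _ ⟩
    odd N ⊛ qprodFin (p ℕ.+ p) N ⊛ factor (p ℕ.+ (p ℕ.+ p) ℕ.* N) ⊛ factor ((p ℕ.+ p) ℕ.* suc N)
      ≈⟨ PSR.*-cong (PSR.*-cong (odd-even N)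
           (factor-index (ℕ-Solver.solve 2 (λ p N → p :+′ (p :+′ p) :*′ N :=′ p :*′ (con′ 1 :+′ (N :+′ (N :+′ con′ 0)))) refl p N)))
           (factor-index (ℕ-Solver.solve 2 (λ p N → (p :+′ p) :*′ (con′ 1 :+′ N) :=′ p :*′ (con′ 2 :+′ (N :+′ (N :+′ con′ 0)))) refl p N)) ⟩
    qprodFin p (2 ℕ.* N) ⊛ factor (p ℕ.* suc (2 ℕ.* N)) ⊛ factor (p ℕ.* (2 ℕ.+ 2 ℕ.* N))
      ≈⟨ qprodFin-+2 p (2 ℕ.* N) ⟨
    qprodFin p (2 ℕ.+ 2 ℕ.* N)
      ≈⟨ qprodFin-index p (ℕ.*-suc 2 N) ⟨
    qprodFin p (2 ℕ.* suc N) ∎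
    where
    open Sol
    open ℕ-Solver using () renaming (_:+_ to _:+′_; _:*_ to _:*′_; _:=_ to _:=′_; con to con′)

  -- The product x over the odd multiples of p is the quotient of the Euler products at p and 2p,
  -- and Jacobi's product at equal exponents is x² times the one at 2p.
  gauss : θ-sum p p ⊛ qpoch (p ℕ.+ p) ≋ qpoch p ⊛ qpoch p
  gauss = begin
    θ-sum p p ⊛ f₂            ≈⟨ PSR.*-congʳ (coeffwise λ n → trans (sym (jacobi n)) (go n)) ⟩
    x ⊛ x ⊛ f₂ ⊛ f₂           ≈⟨ Sol.solve 2 (λ x y → x :* x :* y :* y := (x :* y) :* (x :* y)) ≋-refl x f₂ ⟩
    (x ⊛ f₂) ⊛ (x ⊛ f₂)       ≈⟨ PSR.*-cong xf₂ xf₂ ⟩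
    qpoch p ⊛ qpoch p         ∎
    where
    open Sol
    open JacobiTripleProduct a a
    f₂ x : PS
    f₂ = qpoch (p ℕ.+ p)
    x = qpoch p ⊛ inv f₂
    xf₂ : x ⊛ f₂ ≋ qpoch p
    xf₂ = ≋-trans (PSR.*-assoc _ _ _) (≋-trans (PSR.*-congˡ (≋-trans (PSR.*-comm _ _) (⊛-inv f₂ refl))) (PSR.*-identityʳ _))
    odd-agree : ∀ n → Agree n (odd n) x
    odd-agree n = agree-quotient n (odd-even n) (qpoch-agree′ _ ℕ.≤-refl) (qpoch-agree′ a (ℕ.m≤m+n n _)) refl
    go : ∀ n → (θ-product p p n ⊛ f₂) n ≡ (x ⊛ x ⊛ f₂) n
    go n = ⊛-agreeˡ n f₂ {θ-product p p n} {x ⊛ x} (⊛-agree n {odd n} {x} {odd n} {x} (odd-agree n) (odd-agree n)) n ℕ.≤-refl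

-- Inclusion-exclusion modulo 6: removing the multiples of 2 and of 3 from 1, ..., 6N leaves the
-- residues 1 and 5, and multiples of 6, removed twice, are put back once.
θ-product-1-5 : ∀ N → θ-product 1 5 N ⊛ (qprodFin 2 (3 ℕ.* N) ⊛ qprodFin 3 (2 ℕ.* N)) ≋ qprodFin 1 (6 ℕ.* N) ⊛ qprodFin 6 N
θ-product-1-5 zero    = Sol.solve 0 (k1 :* k1 :* (k1 :* k1) := k1 :* k1) ≋-refl
  where
  open Sol
  k1 : Polynomial 0
  k1 = con (+ 1)
θ-product-1-5 (suc N) = begin
  P₁ ⊛ g 1 ⊛ (P₅ ⊛ g 5) ⊛ (qprodFin 2 (3 ℕ.* suc N) ⊛ qprodFin 3 (2 ℕ.* suc N))
    ≈⟨ PSR.*-congˡ (PSR.*-cong two three) ⟩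
  P₁ ⊛ g 1 ⊛ (P₅ ⊛ g 5) ⊛ (Q₂ ⊛ g 2 ⊛ g 4 ⊛ g 6 ⊛ (Q₃ ⊛ g 3 ⊛ g 6))
    ≈⟨ Sol.solve 10 (λ a b c d g1 g2 g3 g4 g5 g6 →
         a :* g1 :* (b :* g5) :* (c :* g2 :* g4 :* g6 :* (d :* g3 :* g6))
         := a :* b :* (c :* d) :* (g1 :* g2 :* g3 :* g4 :* g5 :* g6 :* g6)) ≋-refl P₁ P₅ Q₂ Q₃ (g 1) (g 2) (g 3) (g 4) (g 5) (g 6) ⟩
  P₁ ⊛ P₅ ⊛ (Q₂ ⊛ Q₃) ⊛ (g 1 ⊛ g 2 ⊛ g 3 ⊛ g 4 ⊛ g 5 ⊛ g 6 ⊛ g 6)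
    ≈⟨ PSR.*-congʳ (θ-product-1-5 N) ⟩
  Q₁ ⊛ Q₆ ⊛ (g 1 ⊛ g 2 ⊛ g 3 ⊛ g 4 ⊛ g 5 ⊛ g 6 ⊛ g 6)
    ≈⟨ Sol.solve 8 (λ a b g1 g2 g3 g4 g5 g6 →
         a :* b :* (g1 :* g2 :* g3 :* g4 :* g5 :* g6 :* g6)
         := a :* g1 :* g2 :* g3 :* g4 :* g5 :* g6 :* (b :* g6)) ≋-refl Q₁ Q₆ (g 1) (g 2) (g 3) (g 4) (g 5) (g 6) ⟩
  Q₁ ⊛ g 1 ⊛ g 2 ⊛ g 3 ⊛ g 4 ⊛ g 5 ⊛ g 6 ⊛ (Q₆ ⊛ g 6)
    ≈⟨ PSR.*-cong sixfold (≋-trans (qprodFin-suc 6 N) (PSR.*-congˡ (factor-index (ℕ.*-suc 6 N)))) ⟨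
  qprodFin 1 (6 ℕ.* suc N) ⊛ qprodFin 6 (suc N) ∎
  where
  open Sol
  P₁ P₅ Q₁ Q₂ Q₃ Q₆ : PS
  P₁ = ∏ (λ j → factor (1 ℕ.+ 6 ℕ.* j)) N
  P₅ = ∏ (λ j → factor (5 ℕ.+ 6 ℕ.* j)) N
  Q₁ = qprodFin 1 (6 ℕ.* N)
  Q₂ = qprodFin 2 (3 ℕ.* N)
  Q₃ = qprodFin 3 (2 ℕ.* N)
  Q₆ = qprodFin 6 N
  g : ℕ → PS
  g i = factor (i ℕ.+ 6 ℕ.* N)
  index : ∀ m i c → m ℕ.* (i ℕ.+ c ℕ.* N) ≡ m ℕ.* i ℕ.+ (m ℕ.* c) ℕ.* N
  index m i c = trans (ℕ.*-distribˡ-+ m i (c ℕ.* N)) (cong (m ℕ.* i ℕ.+_) (sym (ℕ.*-assoc m c N)))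
  two : qprodFin 2 (3 ℕ.* suc N) ≋ Q₂ ⊛ g 2 ⊛ g 4 ⊛ g 6
  two = ≋-trans (qprodFin-index 2 (ℕ.*-suc 3 N)) (≋-trans (qprodFin-+3 2 (3 ℕ.* N))
    (PSR.*-cong (PSR.*-cong (PSR.*-congˡ (factor-index (index 2 1 3))) (factor-index (index 2 2 3))) (factor-index (index 2 3 3))))
  three : qprodFin 3 (2 ℕ.* suc N) ≋ Q₃ ⊛ g 3 ⊛ g 6
  three = ≋-trans (qprodFin-index 3 (ℕ.*-suc 2 N)) (≋-trans (qprodFin-+2 3 (2 ℕ.* N))
    (PSR.*-cong (PSR.*-congˡ (factor-index (index 3 1 2))) (factor-index (index 3 2 2))))
  sixfold : qprodFin 1 (6 ℕ.* suc N) ≋ Q₁ ⊛ g 1 ⊛ g 2 ⊛ g 3 ⊛ g 4 ⊛ g 5 ⊛ g 6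
  sixfold = ≋-trans (qprodFin-index 1 (ℕ.*-suc 6 N)) (≋-trans (qprodFin-+3 1 (3 ℕ.+ 6 ℕ.* N))
    (PSR.*-cong (PSR.*-cong (PSR.*-cong (≋-trans (qprodFin-+3 1 (6 ℕ.* N))
      (PSR.*-cong (PSR.*-cong (PSR.*-congˡ (factor-index (index 1 1 6))) (factor-index (index 1 2 6))) (factor-index (index 1 3 6))))
      (factor-index (index 1 4 6))) (factor-index (index 1 5 6))) (factor-index (index 1 6 6))))

B-eq : B ≋ qpoch 1 ⊛ (qpoch 6 ⊛ qpoch 6) ⊛ inv (mul (qpoch 2) (qpoch 3))
B-eq = begin
  mul (mul (qpoch 1) (mul (qpoch 6) (mul (qpoch 6) one))) (inv (mul (qpoch 2) (qpoch 3)))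
    ≈⟨ ⊛-mul _ _ ⟨
  mul (qpoch 1) (mul (qpoch 6) (mul (qpoch 6) one)) ⊛ inv (mul (qpoch 2) (qpoch 3))
    ≈⟨ PSR.*-congʳ (≋-trans (≋-sym (⊛-mul _ _)) (PSR.*-congˡ (≋-trans (≋-sym (⊛-mul _ _))
         (PSR.*-congˡ (≋-trans (≋-sym (⊛-mul (qpoch 6) one)) (PSR.*-identityʳ _)))))) ⟩
  qpoch 1 ⊛ (qpoch 6 ⊛ qpoch 6) ⊛ inv (mul (qpoch 2) (qpoch 3)) ∎

-- The residues 1 and 5 give f₁f₆/(f₂f₃), and the Euler product in Jacobi's identity supplies the
-- second f₆.
θ-1-5 : θ-sum 1 5 ≋ B
θ-1-5 = begin
  θ-sum 1 5         ≈⟨ coeffwise (λ n → trans (sym (jacobi n)) (go n)) ⟩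
  x ⊛ qpoch 6       ≈⟨ Sol.solve 3 (λ a b c → a :* b :* c :* b := a :* (b :* b) :* c) ≋-refl (qpoch 1) (qpoch 6) (inv f₂₃) ⟩
  qpoch 1 ⊛ (qpoch 6 ⊛ qpoch 6) ⊛ inv f₂₃ ≈⟨ B-eq ⟨
  B ∎
  where
  open Sol
  open JacobiTripleProduct 0 4
  f₂₃ x : PS
  f₂₃ = mul (qpoch 2) (qpoch 3)
  x = qpoch 1 ⊛ qpoch 6 ⊛ inv f₂₃
  go : ∀ n → (θ-product 1 5 n ⊛ qpoch 6) n ≡ (x ⊛ qpoch 6) n
  go n = ⊛-agreeˡ n (qpoch 6) {θ-product 1 5 n} {x}
    (agree-quotient n (θ-product-1-5 n)
      (λ i i≤n → trans (⊛-agree n (qpoch-agree′ 1 (ℕ.m≤m+n n _)) (qpoch-agree′ 2 (ℕ.m≤m+n n _)) i i≤n) (coeff (⊛-mul (qpoch 2) (qpoch 3)) i))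
      (⊛-agree n (qpoch-agree′ 0 (ℕ.m≤m+n n _)) (qpoch-agree′ 5 ℕ.≤-refl)) refl) n ℕ.≤-refl

-- The norm of an Euler product

residue-unique : ∀ {e n r r′} → r < 3 → r′ < 3 → 3 ℕ.* e ℕ.+ r ≡ 3 ℕ.* n ℕ.+ r′ → r ≡ r′
residue-unique {e} {n} {r} {r′} r<3 r′<3 eq = R.begin
  r                       R.≡⟨ residue e r r<3 ⟨
  (3 ℕ.* e ℕ.+ r) % 3     R.≡⟨ cong (_% 3) eq ⟩
  (3 ℕ.* n ℕ.+ r′) % 3    R.≡⟨ residue n r′ r′<3 ⟩
  r′                      R.∎
  where
  residue : ∀ e r → r < 3 → (3 ℕ.* e ℕ.+ r) % 3 ≡ r
  residue e r r<3 = trans (cong (_% 3) (trans (ℕ.+-comm (3 ℕ.* e) r) (cong (r ℕ.+_) (ℕ.*-comm 3 e))))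
    (trans ([m+kn]%n≡m%n r e 3) (m<n⇒m%n≡m r<3))

mono-cong : ∀ {e n e′ n′} → (e ≡ n → e′ ≡ n′) → (e′ ≡ n′ → e ≡ n) → mono e n ≡ mono e′ n′
mono-cong {e} {n} {e′} {n′} to from with e ℕ.≟ n
... | yes refl = trans (mono-self e) (sym (trans (cong (mono e′) (sym (to refl))) (mono-self e′)))
... | no e≢n   = trans (mono-≢ e n e≢n) (sym (mono-≢ e′ n′ (λ e′≡n′ → e≢n (from e′≡n′))))

section-mono : ∀ r e → section r (mono (3 ℕ.* e ℕ.+ r)) ≋ mono e
section-mono r e = coeffwise λ n → mono-cong
  (λ eq → ℕ.*-cancelˡ-≡ e n 3 (ℕ.+-cancelʳ-≡ r _ _ eq)) (cong (λ k → 3 ℕ.* k ℕ.+ r))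

section-mono-≢ : ∀ {r r′} e → r < 3 → r′ < 3 → r ≢ r′ → section r′ (mono (3 ℕ.* e ℕ.+ r)) ≋ zeroPS
section-mono-≢ {r} {r′} e r<3 r′<3 r≢r′ = coeffwise λ n →
  mono-≢ _ _ (λ eq → r≢r′ (residue-unique {e} {n} r<3 r′<3 eq))

section-cong : ∀ r {f g} → f ≋ g → section r f ≋ section r g
section-cong r f≋g = coeffwise λ n → coeff f≋g (3 ℕ.* n ℕ.+ r)

section-⊕⊖ : ∀ r f g → section r (f ⊕ ⊖ g) ≋ section r f ⊕ ⊖ section r g
section-⊕⊖ r f g = coeffwise λ n →
  trans (⊕-coeff f (⊖ g) _) (trans (cong (_+_ (section r f n)) (⊖-coeff g _))
    (sym (trans (⊕-coeff _ _ n) (cong (_+_ (section r f n)) (⊖-coeff _ n)))))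

section-factor : ∀ r e → section r (factor (suc e)) ≋ section r one ⊕ ⊖ section r (mono (suc e))
section-factor r e = ≋-trans (section-cong r (factor-mono e)) (section-⊕⊖ r one (mono (suc e)))

sectionNorm : PS → PS
sectionNorm f = norm (section 0 f) (section 1 f) (section 2 f)

sectionNorm-cong : ∀ {f g} → f ≋ g → sectionNorm f ≋ sectionNorm g
sectionNorm-cong p = norm-cong (section-cong 0 p) (section-cong 1 p) (section-cong 2 p)

sectionNorm-⊛ : ∀ f g → sectionNorm (f ⊛ g) ≋ sectionNorm f ⊛ sectionNorm g
sectionNorm-⊛ f g = ≋-trans (norm-cong (section₀-⊛ f g) (section₁-⊛ f g) (section₂-⊛ f g)) (norm-* _ _ _ _ _ _)

-- Coefficients up to n of the three sections reach degree 3n + 2 of the series.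
sectionNorm-agree : ∀ n {f g} → Agree (3 ℕ.* n ℕ.+ 2) f g → Agree n (sectionNorm f) (sectionNorm g)
sectionNorm-agree n {f} {g} p =
  ⊕-agree n (⊕-agree n (⊕-agree n (⊛-agree n (⊛-agree n (sec 0 z≤n) (sec 0 z≤n)) (sec 0 z≤n))
      (⊛-agreeʳ n q (⊛-agree n (⊛-agree n (sec 1 1≤2) (sec 1 1≤2)) (sec 1 1≤2))))
    (⊛-agreeʳ n (q ⊛ q) (⊛-agree n (⊛-agree n (sec 2 ℕ.≤-refl) (sec 2 ℕ.≤-refl)) (sec 2 ℕ.≤-refl))))
    (⊖-agree n (⊛-agreeʳ n (embed (+ 3) ⊛ q) (⊛-agree n (⊛-agree n (sec 0 z≤n) (sec 1 1≤2)) (sec 2 ℕ.≤-refl))))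
  where
  1≤2 : 1 ≤ 2
  1≤2 = s≤s z≤n
  sec : ∀ r → r ≤ 2 → Agree n (section r f) (section r g)
  sec r r≤2 i i≤n = p _ (ℕ.+-mono-≤ (ℕ.*-monoʳ-≤ 3 i≤n) r≤2)

section-one₀ : section 0 one ≋ one
section-one₀ = section-mono 0 0

one-⊖-zero : ∀ f → f ≋ zeroPS → one ⊕ ⊖ f ≋ one
one-⊖-zero f f≋0 = ≋-trans (PSR.+-congˡ (PSR.-‿cong f≋0)) (Sol.solve 0 (con (+ 1) :- con (+ 0) := con (+ 1)) ≋-refl)
  where open Sol

zero-⊖ : ∀ {f g} → f ≋ zeroPS → f ⊕ ⊖ g ≋ ⊖ g
zero-⊖ f≋0 = ≋-trans (PSR.+-congʳ f≋0) (PSR.+-identityˡ _)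

zero-⊖-zero : ∀ {f g} → f ≋ zeroPS → g ≋ zeroPS → f ⊕ ⊖ g ≋ zeroPS
zero-⊖-zero f≋0 g≋0 = ≋-trans (zero-⊖ f≋0) (≋-trans (PSR.-‿cong g≋0) (Sol.solve 0 (:- con (+ 0) := con (+ 0)) ≋-refl))
  where open Sol

0<3 : 0 < 3
0<3 = s≤s z≤n
1<3 : 1 < 3
1<3 = s≤s (s≤s z≤n)
2<3 : 2 < 3
2<3 = ℕ.≤-refl

section-one₁ : section 1 one ≋ zeroPS
section-one₁ = section-mono-≢ 0 0<3 1<3 λ ()

section-one₂ : section 2 one ≋ zeroPS
section-one₂ = section-mono-≢ 0 0<3 2<3 λ ()

-- The factor is a series in q³, so its three conjugates coincide and the norm is a cube.
sectionNorm-factor₀ : ∀ e k → suc e ≡ 3 ℕ.* suc k →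
  sectionNorm (factor (suc e)) ≋ factor (suc k) ⊛ factor (suc k) ⊛ factor (suc k)
sectionNorm-factor₀ e k eq = begin
  sectionNorm (factor (suc e))
    ≈⟨ norm-cong
         (≋-trans (section-factor 0 e) (≋-trans (PSR.+-cong section-one₀ (PSR.-‿cong (≋-trans (index 0) (section-mono 0 (suc k))))) (≋-sym (factor-mono k))))
         (≋-trans (section-factor 1 e) (zero-⊖-zero section-one₁ (≋-trans (index 1) (section-mono-≢ (suc k) 0<3 1<3 λ ()))))
         (≋-trans (section-factor 2 e) (zero-⊖-zero section-one₂ (≋-trans (index 2) (section-mono-≢ (suc k) 0<3 2<3 λ ())))) ⟩
  norm (factor (suc k)) zeroPS zeroPS
    ≈⟨ Sol.solve 2 (λ q f → let z = con (+ 0) in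
         f :* f :* f :+ q :* (z :* z :* z) :+ q :* q :* (z :* z :* z) :- con (+ 3) :* q :* (f :* z :* z) := f :* f :* f) ≋-refl q (factor (suc k)) ⟩
  factor (suc k) ⊛ factor (suc k) ⊛ factor (suc k) ∎
  where
  open Sol
  index : ∀ r → section r (mono (suc e)) ≋ section r (mono (3 ℕ.* suc k ℕ.+ 0))
  index r = section-cong r (coeffwise λ n → cong (λ j → mono j n) (trans eq (sym (ℕ.+-identityʳ _))))

mono-cube : ∀ k → mono k ⊛ mono k ⊛ mono k ≋ mono (3 ℕ.* k)
mono-cube k = ≋-trans (PSR.*-congʳ (mono-+ k k)) (≋-trans (mono-+ (k ℕ.+ k) k)
  (coeffwise λ n → cong (λ j → mono j n) (ℕ-Solver.solve 1 (λ k → k :+ k :+ k := k :+ (k :+ (k :+ con 0))) refl k)))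
  where open ℕ-Solver

-- For an exponent e prime to 3 the conjugates are 1 - ζ q^(e/3) with ζ running over the cube roots
-- of unity, and their product is 1 - q^e.
sectionNorm-factor₁ : ∀ e k → suc e ≡ 3 ℕ.* k ℕ.+ 1 → sectionNorm (factor (suc e)) ≋ factor (suc e)
sectionNorm-factor₁ e k eq = begin
  sectionNorm (factor (suc e))
    ≈⟨ norm-cong
         (≋-trans (section-factor 0 e) (≋-trans (PSR.+-congʳ section-one₀) (one-⊖-zero _ (≋-trans (index 0) (section-mono-≢ k 1<3 0<3 λ ())))))
         (≋-trans (section-factor 1 e) (≋-trans (zero-⊖ section-one₁) (PSR.-‿cong (≋-trans (index 1) (section-mono 1 k)))))
         (≋-trans (section-factor 2 e) (zero-⊖-zero section-one₂ (≋-trans (index 2) (section-mono-≢ k 1<3 2<3 λ ())))) ⟩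
  norm one (⊖ mono k) zeroPS
    ≈⟨ Sol.solve 2 (λ q f → let z = con (+ 0) ; i = con (+ 1) in
         i :* i :* i :+ q :* ((:- f) :* (:- f) :* (:- f)) :+ q :* q :* (z :* z :* z) :- con (+ 3) :* q :* (i :* (:- f) :* z)
         := i :- q :* (f :* f :* f)) ≋-refl q (mono k) ⟩
  one ⊕ ⊖ (q ⊛ (mono k ⊛ mono k ⊛ mono k))
    ≈⟨ PSR.+-congˡ (PSR.-‿cong (≋-trans (PSR.*-congˡ (mono-cube k)) (≋-trans (mono-+ 1 (3 ℕ.* k))
         (coeffwise λ n → cong (λ j → mono j n) (trans (ℕ.+-comm 1 (3 ℕ.* k)) (sym eq)))))) ⟩
  one ⊕ ⊖ mono (suc e)
    ≈⟨ factor-mono e ⟨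
  factor (suc e) ∎
  where
  open Sol
  index : ∀ r → section r (mono (suc e)) ≋ section r (mono (3 ℕ.* k ℕ.+ 1))
  index r = section-cong r (coeffwise λ n → cong (λ j → mono j n) eq)

sectionNorm-factor₂ : ∀ e k → suc e ≡ 3 ℕ.* k ℕ.+ 2 → sectionNorm (factor (suc e)) ≋ factor (suc e)
sectionNorm-factor₂ e k eq = begin
  sectionNorm (factor (suc e))
    ≈⟨ norm-cong
         (≋-trans (section-factor 0 e) (≋-trans (PSR.+-congʳ section-one₀) (one-⊖-zero _ (≋-trans (index 0) (section-mono-≢ k 2<3 0<3 λ ())))))
         (≋-trans (section-factor 1 e) (zero-⊖-zero section-one₁ (≋-trans (index 1) (section-mono-≢ k 2<3 1<3 λ ()))))
         (≋-trans (section-factor 2 e) (≋-trans (zero-⊖ section-one₂) (PSR.-‿cong (≋-trans (index 2) (section-mono 2 k))))) ⟩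
  norm one zeroPS (⊖ mono k)
    ≈⟨ Sol.solve 2 (λ q f → let z = con (+ 0) ; i = con (+ 1) in
         i :* i :* i :+ q :* (z :* z :* z) :+ q :* q :* ((:- f) :* (:- f) :* (:- f)) :- con (+ 3) :* q :* (i :* z :* (:- f))
         := i :- q :* q :* (f :* f :* f)) ≋-refl q (mono k) ⟩
  one ⊕ ⊖ (q ⊛ q ⊛ (mono k ⊛ mono k ⊛ mono k))
    ≈⟨ PSR.+-congˡ (PSR.-‿cong (≋-trans (PSR.*-cong (mono-+ 1 1) (mono-cube k)) (≋-trans (mono-+ 2 (3 ℕ.* k))
         (coeffwise λ n → cong (λ j → mono j n) (trans (ℕ.+-comm 2 (3 ℕ.* k)) (sym eq)))))) ⟩
  one ⊕ ⊖ mono (suc e)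
    ≈⟨ factor-mono e ⟨
  factor (suc e) ∎
  where
  open Sol
  index : ∀ r → section r (mono (suc e)) ≋ section r (mono (3 ℕ.* k ℕ.+ 2))
  index r = section-cong r (coeffwise λ n → cong (λ j → mono j n) eq)

-- The two hypotheses stand for 3 not dividing p: p(3M + 1) and p(3M + 2) are then prime to 3, but
-- which residue each has depends on p.
module QPochNorm (a : ℕ)
  (norm₁ : ∀ M → sectionNorm (factor (suc a ℕ.* suc (3 ℕ.* M))) ≋ factor (suc a ℕ.* suc (3 ℕ.* M)))
  (norm₂ : ∀ M → sectionNorm (factor (suc a ℕ.* (2 ℕ.+ 3 ℕ.* M))) ≋ factor (suc a ℕ.* (2 ℕ.+ 3 ℕ.* M))) where

  p : ℕ
  p = suc a

  -- Factors whose index is prime to 3 are their own norm; those of index 3k contribute cubes.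
  -- Multiplying by the product at 3p restores the missing factors of index 3k.
  finite : ∀ M → sectionNorm (qprodFin p (3 ℕ.* M)) ⊛ qprodFin (3 ℕ.* p) M ≋
                 qprodFin p (3 ℕ.* M) ⊛ (qprodFin p M ⊛ qprodFin p M ⊛ qprodFin p M)
  finite zero = PSR.*-cong
    (≋-trans (norm-cong section-one₀ section-one₁ section-one₂)
      (Sol.solve 1 (λ q → let z = con (+ 0) ; i = con (+ 1) in
         i :* i :* i :+ q :* (z :* z :* z) :+ q :* q :* (z :* z :* z) :- con (+ 3) :* q :* (i :* z :* z) := i) ≋-refl q))
    (Sol.solve 0 (con (+ 1) := con (+ 1) :* con (+ 1) :* con (+ 1)) ≋-refl)
    where open Sol
  finite (suc M) = begin
    sectionNorm (qprodFin p (3 ℕ.* suc M)) ⊛ qprodFin (3 ℕ.* p) (suc M)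
      ≈⟨ PSR.*-cong (≋-trans (sectionNorm-cong split) (≋-trans (sectionNorm-⊛ _ _)
           (PSR.*-cong (≋-trans (sectionNorm-⊛ _ _) (PSR.*-cong (sectionNorm-⊛ _ _) ≋-refl)) ≋-refl))) (qprodFin-suc (3 ℕ.* p) M) ⟩
    N ⊛ sectionNorm g₁ ⊛ sectionNorm g₂ ⊛ sectionNorm g₃ ⊛ (q₃ ⊛ factor (3 ℕ.* p ℕ.* suc M))
      ≈⟨ PSR.*-cong (PSR.*-cong (PSR.*-cong (PSR.*-congˡ (norm₁ M)) (norm₂ M)) (sectionNorm-factor₀ _ _ g₃-index))
           (PSR.*-congˡ (factor-index (sym (trans g₃-index (sym (ℕ.*-assoc 3 p (suc M))))))) ⟩
    N ⊛ g₁ ⊛ g₂ ⊛ (h ⊛ h ⊛ h) ⊛ (q₃ ⊛ g₃)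
      ≈⟨ Sol.solve 6 (λ n g₁ g₂ g₃ h q → n :* g₁ :* g₂ :* (h :* h :* h) :* (q :* g₃) := n :* q :* (g₁ :* g₂ :* g₃ :* (h :* h :* h))) ≋-refl N g₁ g₂ g₃ h q₃ ⟩
    N ⊛ q₃ ⊛ (g₁ ⊛ g₂ ⊛ g₃ ⊛ (h ⊛ h ⊛ h))
      ≈⟨ PSR.*-congʳ (finite M) ⟩
    qprodFin p (3 ℕ.* M) ⊛ (q₁ ⊛ q₁ ⊛ q₁) ⊛ (g₁ ⊛ g₂ ⊛ g₃ ⊛ (h ⊛ h ⊛ h))
      ≈⟨ Sol.solve 6 (λ n g₁ g₂ g₃ h q → n :* (q :* q :* q) :* (g₁ :* g₂ :* g₃ :* (h :* h :* h)) := n :* g₁ :* g₂ :* g₃ :* (q :* h :* (q :* h) :* (q :* h))) ≋-refl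
           (qprodFin p (3 ℕ.* M)) g₁ g₂ g₃ h q₁ ⟩
    qprodFin p (3 ℕ.* M) ⊛ g₁ ⊛ g₂ ⊛ g₃ ⊛ (q₁ ⊛ h ⊛ (q₁ ⊛ h) ⊛ (q₁ ⊛ h))
      ≈⟨ PSR.*-cong split (PSR.*-cong (PSR.*-cong (qprodFin-suc p M) (qprodFin-suc p M)) (qprodFin-suc p M)) ⟨
    qprodFin p (3 ℕ.* suc M) ⊛ (qprodFin p (suc M) ⊛ qprodFin p (suc M) ⊛ qprodFin p (suc M)) ∎
    where
    open Sol
    N q₁ q₃ g₁ g₂ g₃ h : PS
    N  = sectionNorm (qprodFin p (3 ℕ.* M))
    q₁ = qprodFin p M
    q₃ = qprodFin (3 ℕ.* p) M
    g₁ = factor (p ℕ.* suc (3 ℕ.* M))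
    g₂ = factor (p ℕ.* (2 ℕ.+ 3 ℕ.* M))
    g₃ = factor (p ℕ.* (3 ℕ.+ 3 ℕ.* M))
    h  = factor (p ℕ.* suc M)
    split : qprodFin p (3 ℕ.* suc M) ≋ qprodFin p (3 ℕ.* M) ⊛ g₁ ⊛ g₂ ⊛ g₃
    split = ≋-trans (qprodFin-index p (ℕ.*-suc 3 M)) (qprodFin-+3 p (3 ℕ.* M))
    g₃-index : p ℕ.* (3 ℕ.+ 3 ℕ.* M) ≡ 3 ℕ.* (p ℕ.* suc M)
    g₃-index = ℕ-Solver.solve 2 (λ p M → p :*′ (con′ 3 :+′ (con′ 3 :*′ M)) :=′ con′ 3 :*′ (p :*′ (con′ 1 :+′ M))) refl p M
      where open ℕ-Solver using () renaming (_:+_ to _:+′_; _:*_ to _:*′_; _:=_ to _:=′_; con to con′)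

  qpoch-norm : sectionNorm (qpoch p) ⊛ qpoch (3 ℕ.* p) ≋ qpoch p ⊛ (qpoch p ⊛ qpoch p ⊛ qpoch p)
  qpoch-norm = coeffwise λ n → R.begin
    (sectionNorm (qpoch p) ⊛ qpoch (3 ℕ.* p)) n
      -- The norm up to degree n depends on the product up to degree 3n + 2, which 3(n + 1) factors
      -- determine.
      R.≡⟨ ⊛-agree n
             (λ i i≤n → sectionNorm-agree i {qprodFin p (3 ℕ.* suc n)} {qpoch p} (qpoch-agree′ a (bound i i≤n)) i ℕ.≤-refl)
             (qpoch-agree′ _ (ℕ.n≤1+n n)) n ℕ.≤-refl ⟨
    (sectionNorm (qprodFin p (3 ℕ.* suc n)) ⊛ qprodFin (3 ℕ.* p) (suc n)) n
      R.≡⟨ coeff (finite (suc n)) n ⟩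
    (qprodFin p (3 ℕ.* suc n) ⊛ (qprodFin p (suc n) ⊛ qprodFin p (suc n) ⊛ qprodFin p (suc n))) n
      R.≡⟨ ⊛-agree n (qpoch-agree′ a (ℕ.≤-trans (ℕ.n≤1+n n) (ℕ.m≤m+n (suc n) _))) (⊛-agree n (⊛-agree n q₁ q₁) q₁) n ℕ.≤-refl ⟩
    (qpoch p ⊛ (qpoch p ⊛ qpoch p ⊛ qpoch p)) n R.∎
    where
    bound : ∀ {n} i → i ≤ n → 3 ℕ.* i ℕ.+ 2 ≤ 3 ℕ.* suc n
    bound {n} i i≤n = ℕ.≤-trans (ℕ.+-mono-≤ (ℕ.*-monoʳ-≤ 3 i≤n) (ℕ.n≤1+n 2)) (ℕ.≤-reflexive (trans (ℕ.+-comm (3 ℕ.* n) 3) (sym (ℕ.*-suc 3 n))))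
    q₁ : ∀ {n} → Agree n (qprodFin p (suc n)) (qpoch p)
    q₁ {n} = qpoch-agree′ a (ℕ.n≤1+n n)

qpoch-norm₁ : sectionNorm (qpoch 1) ⊛ qpoch 3 ≋ qpoch 1 ⊛ (qpoch 1 ⊛ qpoch 1 ⊛ qpoch 1)
qpoch-norm₁ = QPochNorm.qpoch-norm 0
  (λ M → sectionNorm-factor₁ _ M (solve 1 (λ M → con 1 :* (con 1 :+ con 3 :* M) := con 3 :* M :+ con 1) refl M))
  (λ M → sectionNorm-factor₂ _ M (solve 1 (λ M → con 1 :* (con 2 :+ con 3 :* M) := con 3 :* M :+ con 2) refl M))
  where open ℕ-Solver

-- Doubling swaps the residues 1 and 2 modulo 3, so the two factor lemmas exchange places.
qpoch-norm₂ : sectionNorm (qpoch 2) ⊛ qpoch 6 ≋ qpoch 2 ⊛ (qpoch 2 ⊛ qpoch 2 ⊛ qpoch 2)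
qpoch-norm₂ = QPochNorm.qpoch-norm 1
  (λ M → sectionNorm-factor₂ _ (2 ℕ.* M) (solve 1 (λ M → con 2 :* (con 1 :+ con 3 :* M) := con 3 :* (con 2 :* M) :+ con 2) refl M))
  (λ M → sectionNorm-factor₁ _ (1 ℕ.+ 2 ℕ.* M) (solve 1 (λ M → con 2 :* (con 2 :+ con 3 :* M) := con 3 :* (con 1 :+ con 2 :* M) :+ con 1) refl M))
  where open ℕ-Solver

-- Sections of φ(-q)

sumTo-+ : ∀ f g n → sumTo (λ i → f i + g i) n ≡ sumTo f n + sumTo g n
sumTo-+ f g zero    = refl
sumTo-+ f g (suc n) = trans (cong (_+ (f (suc n) + g (suc n))) (sumTo-+ f g n))
  (solve 4 (λ a b c d → a :+ b :+ (c :+ d) := a :+ c :+ (b :+ d)) refl (sumTo f n) (sumTo g n) (f (suc n)) (g (suc n)))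
  where open +-*-Solver

sumTo-* : ∀ c f n → sumTo (λ i → c * f i) n ≡ c * sumTo f n
sumTo-* c f zero    = refl
sumTo-* c f (suc n) = trans (cong (_+ c * f (suc n)) (sumTo-* c f n)) (sym (ℤ.*-distribˡ-+ c _ _))

sumTo-zero : ∀ f n → (∀ i → f i ≡ + 0) → sumTo f n ≡ + 0
sumTo-zero f zero    f≡0 = f≡0 0
sumTo-zero f (suc n) f≡0 = cong₂ _+_ (sumTo-zero f n f≡0) (f≡0 (suc n))

sumTo-extend : ∀ f n k → (∀ i → n < i → f i ≡ + 0) → sumTo f (k ℕ.+ n) ≡ sumTo f n
sumTo-extend f n zero    f≡0 = refl
sumTo-extend f n (suc k) f≡0 = trans (cong₂ _+_ (sumTo-extend f n k f≡0) (f≡0 _ (s≤s (ℕ.m≤n+m n k)))) (ℤ.+-identityʳ _)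

sumTo-3 : ∀ f n → sumTo f (3 ℕ.* n ℕ.+ 2) ≡
  sumTo (section 0 f) n + (sumTo (section 1 f) n + sumTo (section 2 f) n)
sumTo-3 f zero    = ℤ.+-assoc (f 0) (f 1) (f 2)
sumTo-3 f (suc n) = R.begin
  sumTo f (3 ℕ.* suc n ℕ.+ 2)
    R.≡⟨ cong (λ k → sumTo f (k ℕ.+ 2)) (ℕ.*-suc 3 n) ⟩
  sumTo f (3 ℕ.* n ℕ.+ 2) + f (1 ℕ.+ (3 ℕ.* n ℕ.+ 2)) + f (2 ℕ.+ (3 ℕ.* n ℕ.+ 2)) + f (3 ℕ.+ (3 ℕ.* n ℕ.+ 2))
    R.≡⟨ cong₂ _+_ (cong₂ _+_ (cong₂ _+_ (sumTo-3 f n)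
         (trans (section-+ 1 2 f n) (section-suc′ 0 f n)))
         (trans (section-+ 2 2 f n) (section-suc′ 1 f n)))
         (trans (section-+ 3 2 f n) (section-suc′ 2 f n)) ⟩
  x + (y + z) + a + b + c
    R.≡⟨ solve 6 (λ x y z a b c → x :+ (y :+ z) :+ a :+ b :+ c := x :+ a :+ (y :+ b :+ (z :+ c))) refl x y z a b c ⟩
  x + a + (y + b + (z + c)) R.∎
  where
  open +-*-Solver
  x = sumTo (section 0 f) n
  y = sumTo (section 1 f) n
  z = sumTo (section 2 f) n
  a = section 0 f (suc n)
  b = section 1 f (suc n)
  c = section 2 f (suc n)

twoSided-right : ∀ (u v : ℕ → ℤ) M j → twoSided u v M (M ℕ.+ j) ≡ u j
twoSided-right u v zero    j = refl
twoSided-right u v (suc M) j = twoSided-right u v M j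

twoSided-map : ∀ {A : Set} (f : A → ℤ) (u v : ℕ → A) M r → f (twoSided u v M r) ≡ twoSided (λ j → f (u j)) (λ j → f (v j)) M r
twoSided-map f u v zero    r       = refl
twoSided-map f u v (suc M) zero    = refl
twoSided-map f u v (suc M) (suc r) = twoSided-map f u v M r

-- Both halves on the right contain the centre, so it is added once more on the left.
sumTo-twoSided : ∀ u v → u 0 ≡ v 0 → ∀ M → sumTo (twoSided u v M) (M ℕ.+ M) + u 0 ≡ sumTo u M + sumTo v M
sumTo-twoSided u v u0≡v0 zero    = cong (_+_ (u 0)) u0≡v0
sumTo-twoSided u v u0≡v0 (suc M) = R.begin
  sumTo (twoSided u v (suc M)) (suc M ℕ.+ suc M) + u 0
    R.≡⟨ cong (λ k → sumTo (twoSided u v (suc M)) (suc k) + u 0) (ℕ.+-suc M M) ⟩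
  sumTo (twoSided u v (suc M)) (suc (M ℕ.+ M)) + twoSided u v M (suc (M ℕ.+ M)) + u 0
    R.≡⟨ cong₂ (λ x y → x + y + u 0) (sumTo-suc (twoSided u v (suc M)) (M ℕ.+ M))
         (trans (cong (twoSided u v M) (sym (ℕ.+-suc M M))) (twoSided-right u v M (suc M))) ⟩
  v (suc M) + sumTo (twoSided u v M) (M ℕ.+ M) + u (suc M) + u 0
    R.≡⟨ solve 4 (λ a b c d → a :+ b :+ c :+ d := (b :+ d) :+ (c :+ a)) refl (v (suc M)) (sumTo (twoSided u v M) (M ℕ.+ M)) (u (suc M)) (u 0) ⟩
  sumTo (twoSided u v M) (M ℕ.+ M) + u 0 + (u (suc M) + v (suc M))
    R.≡⟨ cong (_+ (u (suc M) + v (suc M))) (sumTo-twoSided u v u0≡v0 M) ⟩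
  sumTo u M + sumTo v M + (u (suc M) + v (suc M))
    R.≡⟨ solve 4 (λ a b c d → a :+ b :+ (c :+ d) := a :+ c :+ (b :+ d)) refl (sumTo u M) (sumTo v M) (u (suc M)) (v (suc M)) ⟩
  sumTo u (suc M) + sumTo v (suc M) R.∎
  where open +-*-Solver

θ-sum-split : ∀ a b n → θ-sum a b n + one n ≡
  sumTo (λ j → θ-term (a ℕ.+ b) a j n) n + sumTo (λ j → θ-term (a ℕ.+ b) b j n) n
θ-sum-split a b n = trans
  (cong₂ _+_ (sumTo-cong (n ℕ.+ n) λ r _ → twoSided-map (λ f → f n) (θ-term (a ℕ.+ b) a) (θ-term (a ℕ.+ b) b) n r) (sym (ℤ.*-identityˡ (one n))))
  (sumTo-twoSided _ _ refl n)

square : ℕ → ℕ → ℤ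
square N j = mono (j ℕ.* j) N

square-far : ∀ N j → N < j → square N j ≡ + 0
square-far N (suc j) N<j = mono-≢ (suc j ℕ.* suc j) N λ { refl → ℕ.<⇒≱ N<j (ℕ.m≤m+n (suc j) _) }

-- The doubling counts j and -j, and `one N` compensates for j = 0. The free bound `K` allows sums
-- up to 3n + 2, which split evenly into the residue classes of j.
φ-count : ∀ N K → N ≤ K → φ N + one N ≡ sumTo (square N) K + sumTo (square N) K
φ-count N K N≤K = R.begin
  φ N + one N
    R.≡⟨ cong (_+ one N) (sumTo-cong (N ℕ.+ N) indicator) ⟩
  sumTo (twoSided (square N) (square N) N) (N ℕ.+ N) + one N
    R.≡⟨ sumTo-twoSided (square N) (square N) refl N ⟩
  sumTo (square N) N + sumTo (square N) N
    R.≡⟨ cong₂ _+_ extend extend ⟨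
  sumTo (square N) K + sumTo (square N) K R.∎
  where
  extend : sumTo (square N) K ≡ sumTo (square N) N
  extend = trans (cong (sumTo (square N)) (sym (ℕ.m∸n+n≡m N≤K))) (sumTo-extend (square N) N (K ∸ N) (square-far N))

  indicator-square : ∀ j k → k * k ≡ + (j ℕ.* j) →
    (if does (k * k ℤ.≟ + N) then + 1 else + 0) ≡ square N j
  indicator-square j k k²≡j² with k * k ℤ.≟ + N
  ... | yes k²≡N = sym (trans (cong (λ e → mono e N) (ℤ.+-injective (trans (sym k²≡j²) k²≡N))) (mono-self N))
  ... | no k²≢N  = sym (mono-≢ _ N λ j²≡N → k²≢N (trans k²≡j² (cong +_ j²≡N)))

  indicator : ∀ i → i ≤ N ℕ.+ N →
    (let k = (+ i) - (+ N) in if does (k * k ℤ.≟ + N) then + 1 else + 0) ≡ twoSided (square N) (square N) N i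
  indicator i _ = by (twoSided-index (square N) (square N) N i)
    where
    open +-*-Solver
    by : _ → (let k = (+ i) - (+ N) in if does (k * k ℤ.≟ + N) then + 1 else + 0) ≡ twoSided (square N) (square N) N i
    by (inj₁ (j , N+j≡i , eq)) = trans (indicator-square j (+ i - + N) (trans (cong (λ k → k * k)
      (trans (cong (λ k → + k - + N) (sym N+j≡i)) (solve 2 (λ N j → N :+ j :- N := j) refl (+ N) (+ j)))) (sym (ℤ.pos-* j j)))) (sym eq)
    by (inj₂ (j , i+j≡N , eq)) = trans (indicator-square j (+ i - + N) (trans (cong (λ k → k * k)
      (trans (cong (λ k → + i - + k) (sym i+j≡N)) (solve 2 (λ i j → i :- (i :+ j) := :- j) refl (+ i) (+ j))))
      (trans (solve 1 (λ j → (:- j) :* (:- j) := j :* j) refl (+ j)) (sym (ℤ.pos-* j j))))) (sym eq)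

sgn-+ : ∀ i j → sgn (i ℕ.+ j) ≡ sgn i * sgn j
sgn-+ = ℤ.^-distribˡ-+-* ℤ.-1ℤ

sgn-square : ∀ j → sgn j * sgn j ≡ + 1
sgn-square zero    = refl
sgn-square (suc j) = trans (solve 1 (λ s → con ℤ.-1ℤ :* s :* (con ℤ.-1ℤ :* s) := s :* s) refl (sgn j)) (sgn-square j)
  where open +-*-Solver

sgn-j² : ∀ j → sgn (j ℕ.* j) ≡ sgn j
sgn-j² zero    = refl
sgn-j² (suc j) = R.begin
  ℤ.-1ℤ * sgn (j ℕ.+ j ℕ.* suc j)                R.≡⟨ cong (λ k → ℤ.-1ℤ * sgn (j ℕ.+ k)) (ℕ.*-suc j j) ⟩
  ℤ.-1ℤ * sgn (j ℕ.+ (j ℕ.+ j ℕ.* j))            R.≡⟨ cong (ℤ.-1ℤ *_) (trans (sgn-+ j _) (cong (sgn j *_) (sgn-+ j _))) ⟩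
  ℤ.-1ℤ * (sgn j * (sgn j * sgn (j ℕ.* j)))      R.≡⟨ cong (ℤ.-1ℤ *_) (sym (ℤ.*-assoc (sgn j) (sgn j) _)) ⟩
  ℤ.-1ℤ * (sgn j * sgn j * sgn (j ℕ.* j))        R.≡⟨ cong₂ (λ x y → ℤ.-1ℤ * (x * y)) (sgn-square j) (sgn-j² j) ⟩
  ℤ.-1ℤ * (+ 1 * sgn j)                          R.≡⟨ cong (ℤ.-1ℤ *_) (ℤ.*-identityˡ (sgn j)) ⟩
  ℤ.-1ℤ * sgn j R.∎

sgn-3* : ∀ i → sgn (3 ℕ.* i) ≡ sgn i
sgn-3* i = R.begin
  sgn (i ℕ.+ (i ℕ.+ (i ℕ.+ 0)))   R.≡⟨ cong (λ k → sgn (i ℕ.+ (i ℕ.+ k))) (ℕ.+-identityʳ i) ⟩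
  sgn (i ℕ.+ (i ℕ.+ i))           R.≡⟨ trans (sgn-+ i _) (cong (sgn i *_) (trans (sgn-+ i i) (sgn-square i))) ⟩
  sgn i * + 1                     R.≡⟨ ℤ.*-identityʳ (sgn i) ⟩
  sgn i R.∎

sgn-mono : ∀ e N → sgn N * mono e N ≡ sgn e * mono e N
sgn-mono e N with e ℕ.≟ N
... | yes refl = refl
... | no e≢N   = trans (cong (sgn N *_) (mono-≢ e N e≢N)) (trans (ℤ.*-zeroʳ (sgn N))
                   (sym (trans (cong (sgn e *_) (mono-≢ e N e≢N)) (ℤ.*-zeroʳ (sgn e)))))

ψ : PS
ψ = negq φ

signedSquare : ℕ → ℕ → ℤ
signedSquare N j = sgn j * square N j

ψ-count : ∀ N K → N ≤ K → ψ N + one N ≡ sumTo (signedSquare N) K + sumTo (signedSquare N) K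
ψ-count N K N≤K = R.begin
  sgn N * φ N + one N
    R.≡⟨ cong (_+_ (sgn N * φ N)) (trans (sgn-mono 0 N) (ℤ.*-identityˡ (one N))) ⟨
  sgn N * φ N + sgn N * one N
    R.≡⟨ ℤ.*-distribˡ-+ (sgn N) (φ N) (one N) ⟨
  sgn N * (φ N + one N)
    R.≡⟨ cong (sgn N *_) (φ-count N K N≤K) ⟩
  sgn N * (sumTo (square N) K + sumTo (square N) K)
    R.≡⟨ ℤ.*-distribˡ-+ (sgn N) _ _ ⟩
  sgn N * sumTo (square N) K + sgn N * sumTo (square N) K
    R.≡⟨ cong₂ _+_ signed signed ⟩
  sumTo (signedSquare N) K + sumTo (signedSquare N) K R.∎
  where
  signed : sgn N * sumTo (square N) K ≡ sumTo (signedSquare N) K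
  signed = trans (sym (sumTo-* (sgn N) (square N) K)) (sumTo-cong K λ j _ →
    trans (sgn-mono (j ℕ.* j) N) (cong (_* square N j) (sgn-j² j)))

exponent-square : ∀ p j → exponent (p ℕ.+ p) p j ≡ p ℕ.* (j ℕ.* j)
exponent-square p zero    = sym (ℕ.*-zeroʳ p)
exponent-square p (suc j) = trans (cong (p ℕ.+ (p ℕ.+ p) ℕ.* j ℕ.+_) (exponent-square p j))
  (solve 2 (λ p j → p :+ (p :+ p) :* j :+ p :* (j :* j) := p :* ((con 1 :+ j) :* (con 1 :+ j))) refl p j)
  where open ℕ-Solver

-- This is ((3j + 1)² - 1)/3, and the other half of `θ-sum 1 5` has ((3j + 2)² - 1)/3 at index j +
-- 1: together the halves run over the squares prime to 3.
exponent-6-5 : ∀ j → exponent 6 5 j ≡ 3 ℕ.* (j ℕ.* j) ℕ.+ 2 ℕ.* j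
exponent-6-5 zero    = refl
exponent-6-5 (suc j) = trans (cong (5 ℕ.+ 6 ℕ.* j ℕ.+_) (exponent-6-5 j))
  (solve 1 (λ j → con 5 :+ con 6 :* j :+ (con 3 :* (j :* j) :+ con 2 :* j)
                  := con 3 :* ((con 1 :+ j) :* (con 1 :+ j)) :+ con 2 :* (con 1 :+ j)) refl j)
  where open ℕ-Solver

exponent-6-1 : ∀ j → exponent 6 1 (suc j) ≡ 3 ℕ.* (j ℕ.* j) ℕ.+ 4 ℕ.* j ℕ.+ 1
exponent-6-1 zero    = refl
exponent-6-1 (suc j) = trans (cong (1 ℕ.+ 6 ℕ.* suc j ℕ.+_) (exponent-6-1 j))
  (solve 1 (λ j → con 1 :+ con 6 :* (con 1 :+ j) :+ (con 3 :* (j :* j) :+ con 4 :* j :+ con 1)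
                  := con 3 :* ((con 1 :+ j) :* (con 1 :+ j)) :+ con 4 :* (con 1 :+ j) :+ con 1) refl j)
  where open ℕ-Solver

θ-square : ∀ p j n → θ-term (p ℕ.+ p) p j n ≡ sgn j * mono (p ℕ.* (j ℕ.* j)) n
θ-square p j n = cong (λ e → sgn j * mono e n) (exponent-square p j)

+-cancel-one : ∀ {x y : ℤ} n → x + one n ≡ y + one n → x ≡ y
+-cancel-one {x} {y} n eq = R.begin
  x                       R.≡⟨ solve 2 (λ x o → x := x :+ o :- o) refl x (one n) ⟩
  x + one n - one n       R.≡⟨ cong (_- one n) eq ⟩
  y + one n - one n       R.≡⟨ solve 2 (λ x o → x :+ o :- o := x) refl y (one n) ⟩
  y R.∎
  where open +-*-Solver

ψ-θ : ψ ≋ θ-sum 1 1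
ψ-θ = coeffwise λ n → +-cancel-one n (trans (ψ-count n n ℕ.≤-refl) (trans (cong₂ _+_ (same n) (same n)) (sym (θ-sum-split 1 1 n))))
  where
  same : ∀ n → sumTo (signedSquare n) n ≡ sumTo (λ j → θ-term 2 1 j n) n
  same n = sumTo-cong n λ j _ → sym (trans (θ-square 1 j n) (cong (λ e → sgn j * mono e n) (ℕ.*-identityˡ (j ℕ.* j))))

square-3i : ∀ i → (3 ℕ.* i ℕ.+ 0) ℕ.* (3 ℕ.* i ℕ.+ 0) ≡ 3 ℕ.* (3 ℕ.* (i ℕ.* i)) ℕ.+ 0
square-3i = solve 1 (λ i → (con 3 :* i :+ con 0) :* (con 3 :* i :+ con 0) := con 3 :* (con 3 :* (i :* i)) :+ con 0) refl
  where open ℕ-Solver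

square-3i+1 : ∀ i → (3 ℕ.* i ℕ.+ 1) ℕ.* (3 ℕ.* i ℕ.+ 1) ≡ 3 ℕ.* (3 ℕ.* (i ℕ.* i) ℕ.+ 2 ℕ.* i) ℕ.+ 1
square-3i+1 = solve 1 (λ i → (con 3 :* i :+ con 1) :* (con 3 :* i :+ con 1) := con 3 :* (con 3 :* (i :* i) :+ con 2 :* i) :+ con 1) refl
  where open ℕ-Solver

square-3i+2 : ∀ i → (3 ℕ.* i ℕ.+ 2) ℕ.* (3 ℕ.* i ℕ.+ 2) ≡ 3 ℕ.* (3 ℕ.* (i ℕ.* i) ℕ.+ 4 ℕ.* i ℕ.+ 1) ℕ.+ 1
square-3i+2 = solve 1 (λ i → (con 3 :* i :+ con 2) :* (con 3 :* i :+ con 2) := con 3 :* (con 3 :* (i :* i) :+ con 4 :* i :+ con 1) :+ con 1) refl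
  where open ℕ-Solver

-- The quotients by 3 of (3i)², (3i + 1)² and (3i + 2)².
E₀ E₁ E₂ : ℕ → ℕ
E₀ i = 3 ℕ.* (i ℕ.* i)
E₁ i = 3 ℕ.* (i ℕ.* i) ℕ.+ 2 ℕ.* i
E₂ i = 3 ℕ.* (i ℕ.* i) ℕ.+ 4 ℕ.* i ℕ.+ 1

square-residue : ∀ r {r′ e j} n → j ℕ.* j ≡ 3 ℕ.* e ℕ.+ r′ → r′ < 3 → r < 3 → r′ ≢ r → square (3 ℕ.* n ℕ.+ r) j ≡ + 0
square-residue r {e = e} n eq r′<3 r<3 r′≢r = trans (cong (λ k → mono k (3 ℕ.* n ℕ.+ r)) eq) (coeff (section-mono-≢ e r′<3 r<3 r′≢r) n)

square-same : ∀ r {e j} n → j ℕ.* j ≡ 3 ℕ.* e ℕ.+ r → square (3 ℕ.* n ℕ.+ r) j ≡ mono e n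
square-same r {e} n eq = trans (cong (λ k → mono k (3 ℕ.* n ℕ.+ r)) eq) (coeff (section-mono r e) n)

signed-zero : ∀ N j → square N j ≡ + 0 → signedSquare N j ≡ + 0
signed-zero N j eq = trans (cong (sgn j *_) eq) (ℤ.*-zeroʳ (sgn j))

3n+r≤3n+2 : ∀ n {r} → r < 3 → 3 ℕ.* n ℕ.+ r ≤ 3 ℕ.* n ℕ.+ 2
3n+r≤3n+2 n r<3 = ℕ.+-monoʳ-≤ (3 ℕ.* n) (ℕ.≤-pred r<3)

φ-section₀ : ∀ n → φ (3 ℕ.* n ℕ.+ 0) + one n ≡ sumTo (λ i → mono (3 ℕ.* (i ℕ.* i)) n) n + sumTo (λ i → mono (3 ℕ.* (i ℕ.* i)) n) n
φ-section₀ n = R.begin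
  φ (3 ℕ.* n ℕ.+ 0) + one n
    R.≡⟨ cong (_+_ (φ (3 ℕ.* n ℕ.+ 0))) (coeff section-one₀ n) ⟨
  φ (3 ℕ.* n ℕ.+ 0) + one (3 ℕ.* n ℕ.+ 0)
    R.≡⟨ φ-count _ (3 ℕ.* n ℕ.+ 2) (3n+r≤3n+2 n 0<3) ⟩
  _ R.≡⟨ cong₂ _+_ squares squares ⟩
  sumTo (λ i → mono (3 ℕ.* (i ℕ.* i)) n) n + sumTo (λ i → mono (3 ℕ.* (i ℕ.* i)) n) n R.∎
  where
  squares : sumTo (square (3 ℕ.* n ℕ.+ 0)) (3 ℕ.* n ℕ.+ 2) ≡ sumTo (λ i → mono (3 ℕ.* (i ℕ.* i)) n) n
  squares = trans (sumTo-3 (square (3 ℕ.* n ℕ.+ 0)) n) (trans (cong₂ _+_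
    (sumTo-cong n λ i _ → square-same 0 {E₀ i} {3 ℕ.* i ℕ.+ 0} n (square-3i i))
    (cong₂ _+_ (sumTo-zero _ n λ i → square-residue 0 {e = E₁ i} {3 ℕ.* i ℕ.+ 1} n (square-3i+1 i) 1<3 0<3 λ ())
               (sumTo-zero _ n λ i → square-residue 0 {e = E₂ i} {3 ℕ.* i ℕ.+ 2} n (square-3i+2 i) 1<3 0<3 λ ())))
    (ℤ.+-identityʳ _))

section₀-ψ : section 0 ψ ≋ θ-sum 3 3
section₀-ψ = coeffwise λ n → +-cancel-one n (R.begin
  section 0 ψ n + one n
    R.≡⟨ cong (_+_ (section 0 ψ n)) (coeff section-one₀ n) ⟨
  ψ (3 ℕ.* n ℕ.+ 0) + one (3 ℕ.* n ℕ.+ 0)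
    R.≡⟨ ψ-count _ (3 ℕ.* n ℕ.+ 2) (3n+r≤3n+2 n 0<3) ⟩
  _ R.≡⟨ cong₂ _+_ (squares n) (squares n) ⟩
  sumTo (λ j → θ-term 6 3 j n) n + sumTo (λ j → θ-term 6 3 j n) n
    R.≡⟨ θ-sum-split 3 3 n ⟨
  θ-sum 3 3 n + one n R.∎)
  where
  squares : ∀ n → sumTo (signedSquare (3 ℕ.* n ℕ.+ 0)) (3 ℕ.* n ℕ.+ 2) ≡ sumTo (λ j → θ-term 6 3 j n) n
  squares n = trans (sumTo-3 (signedSquare (3 ℕ.* n ℕ.+ 0)) n) (trans (cong₂ _+_
    (sumTo-cong n λ i _ → trans
      (cong₂ _*_ (trans (cong sgn (ℕ.+-identityʳ (3 ℕ.* i))) (sgn-3* i)) (square-same 0 {E₀ i} {3 ℕ.* i ℕ.+ 0} n (square-3i i)))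
      (sym (θ-square 3 i n)))
    (cong₂ _+_ (sumTo-zero _ n λ i → signed-zero _ (3 ℕ.* i ℕ.+ 1) (square-residue 0 {e = E₁ i} {3 ℕ.* i ℕ.+ 1} n (square-3i+1 i) 1<3 0<3 λ ()))
               (sumTo-zero _ n λ i → signed-zero _ (3 ℕ.* i ℕ.+ 2) (square-residue 0 {e = E₂ i} {3 ℕ.* i ℕ.+ 2} n (square-3i+2 i) 1<3 0<3 λ ()))))
    (ℤ.+-identityʳ _))

-- The index 3i + 1 has sign -(-1)^i and gives term i of the half `v`; the index 3i + 2 has sign
-- -(-1)^(i + 1) and gives term i + 1 of the half `u`. The factor 2 comes from ±j.
section₁-ψ : ∀ n → section 1 ψ n ≡ - (θ-sum 1 5 n + θ-sum 1 5 n)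
section₁-ψ n = R.begin
  section 1 ψ n
    R.≡⟨ ℤ.+-identityʳ _ ⟨
  section 1 ψ n + + 0
    R.≡⟨ cong (_+_ (section 1 ψ n)) (coeff section-one₁ n) ⟨
  ψ (3 ℕ.* n ℕ.+ 1) + one (3 ℕ.* n ℕ.+ 1)
    R.≡⟨ ψ-count _ (3 ℕ.* n ℕ.+ 2) (3n+r≤3n+2 n 1<3) ⟩
  _ R.≡⟨ cong₂ _+_ squares squares ⟩
  - θ-sum 1 5 n + - θ-sum 1 5 n
    R.≡⟨ ℤ.neg-distrib-+ (θ-sum 1 5 n) (θ-sum 1 5 n) ⟨
  - (θ-sum 1 5 n + θ-sum 1 5 n) R.∎
  where
  u v : ℕ → ℤ
  u j = θ-term 6 1 j n
  v j = θ-term 6 5 j n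
  open +-*-Solver
  u-far : u (suc n) ≡ + 0
  u-far = trans (cong (sgn (suc n) *_) (mono-≢ _ n λ eq → ℕ.<⇒≱ (exponent-≥ 6 0 (suc n)) (ℕ.≤-reflexive eq))) (ℤ.*-zeroʳ (sgn (suc n)))
  at-3i+1 : ∀ i → signedSquare (3 ℕ.* n ℕ.+ 1) (3 ℕ.* i ℕ.+ 1) ≡ ℤ.-1ℤ * v i
  at-3i+1 i = R.begin
    sgn (3 ℕ.* i ℕ.+ 1) * square (3 ℕ.* n ℕ.+ 1) (3 ℕ.* i ℕ.+ 1)
      R.≡⟨ cong₂ _*_ (trans (sgn-+ (3 ℕ.* i) 1) (cong (_* ℤ.-1ℤ) (sgn-3* i)))
           (trans (square-same 1 {E₁ i} {3 ℕ.* i ℕ.+ 1} n (square-3i+1 i)) (cong (λ e → mono e n) (sym (exponent-6-5 i)))) ⟩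
    sgn i * ℤ.-1ℤ * mono (exponent 6 5 i) n
      R.≡⟨ solve 3 (λ s m x → s :* m :* x := m :* (s :* x)) refl (sgn i) ℤ.-1ℤ (mono (exponent 6 5 i) n) ⟩
    ℤ.-1ℤ * v i R.∎
  at-3i+2 : ∀ i → signedSquare (3 ℕ.* n ℕ.+ 1) (3 ℕ.* i ℕ.+ 2) ≡ ℤ.-1ℤ * u (suc i)
  at-3i+2 i = R.begin
    sgn (3 ℕ.* i ℕ.+ 2) * square (3 ℕ.* n ℕ.+ 1) (3 ℕ.* i ℕ.+ 2)
      R.≡⟨ cong₂ _*_ (trans (sgn-+ (3 ℕ.* i) 2) (cong (_* + 1) (sgn-3* i)))
           (trans (square-same 1 {E₂ i} {3 ℕ.* i ℕ.+ 2} n (square-3i+2 i)) (cong (λ e → mono e n) (sym (exponent-6-1 i)))) ⟩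
    sgn i * + 1 * mono (exponent 6 1 (suc i)) n
      R.≡⟨ solve 2 (λ s x → s :* con (+ 1) :* x := con ℤ.-1ℤ :* (con ℤ.-1ℤ :* s :* x)) refl (sgn i) (mono (exponent 6 1 (suc i)) n) ⟩
    ℤ.-1ℤ * u (suc i) R.∎
  squares : sumTo (signedSquare (3 ℕ.* n ℕ.+ 1)) (3 ℕ.* n ℕ.+ 2) ≡ - θ-sum 1 5 n
  squares = R.begin
    sumTo (signedSquare (3 ℕ.* n ℕ.+ 1)) (3 ℕ.* n ℕ.+ 2)
      R.≡⟨ sumTo-3 (signedSquare (3 ℕ.* n ℕ.+ 1)) n ⟩
    _ R.≡⟨ cong₂ _+_ (sumTo-zero _ n λ i → signed-zero _ (3 ℕ.* i ℕ.+ 0) (square-residue 1 {e = E₀ i} {3 ℕ.* i ℕ.+ 0} n (square-3i i) 0<3 1<3 λ ()))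
           (cong₂ _+_ (trans (sumTo-cong n λ i _ → at-3i+1 i) (sumTo-* ℤ.-1ℤ v n))
                      (trans (sumTo-cong n λ i _ → at-3i+2 i) (sumTo-* ℤ.-1ℤ (λ i → u (suc i)) n))) ⟩
    + 0 + (ℤ.-1ℤ * sumTo v n + ℤ.-1ℤ * sumTo (λ i → u (suc i)) n)
      -- The half `u` begins at index 1, so `u 0` is inserted and subtracted again; the surplus last
      -- term `u (suc n)` has degree above n.
      R.≡⟨ solve 3 (λ V U o → con (+ 0) :+ (con ℤ.-1ℤ :* V :+ con ℤ.-1ℤ :* U) := :- (o :+ U :+ V :- o)) refl (sumTo v n) (sumTo (λ i → u (suc i)) n) (u 0) ⟩
    - (u 0 + sumTo (λ i → u (suc i)) n + sumTo v n - u 0)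
      R.≡⟨ cong (λ x → - (x + sumTo v n - u 0)) (trans (sym (sumTo-suc u n)) (trans (cong (_+_ (sumTo u n)) u-far) (ℤ.+-identityʳ (sumTo u n)))) ⟩
    - (sumTo u n + sumTo v n - u 0)
      R.≡⟨ cong₂ (λ x y → - (x - y)) (sym (θ-sum-split 1 5 n)) (ℤ.*-identityˡ (one n)) ⟩
    - (θ-sum 1 5 n + one n - one n)
      R.≡⟨ solve 2 (λ x o → :- (x :+ o :- o) := :- x) refl (θ-sum 1 5 n) (one n) ⟩
    - θ-sum 1 5 n R.∎

section₁-ψ-B : section 1 ψ ≋ ⊖ (embed (+ 2) ⊛ B)
section₁-ψ-B = coeffwise λ n → R.begin
  section 1 ψ n                       R.≡⟨ section₁-ψ n ⟩
  - (θ-sum 1 5 n + θ-sum 1 5 n)       R.≡⟨ cong (λ x → - (x + x)) (coeff θ-1-5 n) ⟩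
  - (B n + B n)                       R.≡⟨ cong -_ (⊕-coeff B B n) ⟨
  - (B ⊕ B) n                         R.≡⟨ ⊖-coeff (B ⊕ B) n ⟨
  (⊖ (B ⊕ B)) n                       R.≡⟨ coeff (PSR.-‿cong (Sol.solve 1 (λ b → b Sol.:+ b Sol.:= Sol.con (+ 2) Sol.:* b) ≋-refl B)) n ⟩
  (⊖ (embed (+ 2) ⊛ B)) n R.∎

-- No square is 2 modulo 3.
section₂-ψ : section 2 ψ ≋ zeroPS
section₂-ψ = coeffwise λ n → R.begin
  section 2 ψ n
    R.≡⟨ ℤ.+-identityʳ _ ⟨
  section 2 ψ n + + 0
    R.≡⟨ cong (_+_ (section 2 ψ n)) (coeff section-one₂ n) ⟨
  ψ (3 ℕ.* n ℕ.+ 2) + one (3 ℕ.* n ℕ.+ 2)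
    R.≡⟨ ψ-count _ (3 ℕ.* n ℕ.+ 2) ℕ.≤-refl ⟩
  _ R.≡⟨ cong₂ _+_ (squares n) (squares n) ⟩
  + 0 R.∎
  where
  squares : ∀ n → sumTo (signedSquare (3 ℕ.* n ℕ.+ 2)) (3 ℕ.* n ℕ.+ 2) ≡ + 0
  squares n = trans (sumTo-3 (signedSquare (3 ℕ.* n ℕ.+ 2)) n) (cong₂ _+_
    (sumTo-zero _ n λ i → signed-zero _ (3 ℕ.* i ℕ.+ 0) (square-residue 2 {e = E₀ i} {3 ℕ.* i ℕ.+ 0} n (square-3i i) 0<3 2<3 λ ()))
    (cong₂ _+_ (sumTo-zero _ n λ i → signed-zero _ (3 ℕ.* i ℕ.+ 1) (square-residue 2 {e = E₁ i} {3 ℕ.* i ℕ.+ 1} n (square-3i+1 i) 1<3 2<3 λ ()))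
               (sumTo-zero _ n λ i → signed-zero _ (3 ℕ.* i ℕ.+ 2) (square-residue 2 {e = E₂ i} {3 ℕ.* i ℕ.+ 2} n (square-3i+2 i) 1<3 2<3 λ ()))))

φ-dil : ∀ n → φ (3 ℕ.* n ℕ.+ 0) ≡ dil 3 φ n
φ-dil n with n % 3 | m≡m%n+[m/n]*n n 3 | m%n<n n 3
... | zero    | n≡3m  | _   = +-cancel-one n (R.begin
  φ (3 ℕ.* n ℕ.+ 0) + one n
    R.≡⟨ φ-section₀ n ⟩
  sumTo (λ i → mono (3 ℕ.* (i ℕ.* i)) n) n + sumTo (λ i → mono (3 ℕ.* (i ℕ.* i)) n) n
    R.≡⟨ cong₂ _+_ squares squares ⟩
  sumTo (square (n / 3)) n + sumTo (square (n / 3)) n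
    R.≡⟨ φ-count (n / 3) n (m/n≤m n 3) ⟨
  φ (n / 3) + one (n / 3)
    R.≡⟨ cong (_+_ (φ (n / 3))) (trans (cong one n≡) (coeff section-one₀ (n / 3))) ⟨
  φ (n / 3) + one n R.∎)
  where
  n≡ : n ≡ 3 ℕ.* (n / 3) ℕ.+ 0
  n≡ = trans n≡3m (trans (ℕ.*-comm (n / 3) 3) (sym (ℕ.+-identityʳ _)))
  squares : sumTo (λ i → mono (3 ℕ.* (i ℕ.* i)) n) n ≡ sumTo (square (n / 3)) n
  squares = sumTo-cong n λ i _ → trans (cong₂ mono (sym (ℕ.+-identityʳ (3 ℕ.* (i ℕ.* i)))) n≡) (coeff (section-mono 0 (i ℕ.* i)) (n / 3))
... | suc r   | n≡3m+r | r<3 = R.begin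
  φ (3 ℕ.* n ℕ.+ 0)             R.≡⟨ ℤ.+-identityʳ _ ⟨
  φ (3 ℕ.* n ℕ.+ 0) + + 0       R.≡⟨ cong (_+_ (φ (3 ℕ.* n ℕ.+ 0))) (cong one n≡3m+r) ⟨
  φ (3 ℕ.* n ℕ.+ 0) + one n     R.≡⟨ φ-section₀ n ⟩
  _                             R.≡⟨ cong₂ _+_ squares squares ⟩
  + 0 R.∎
  where
  n≡ : n ≡ 3 ℕ.* (n / 3) ℕ.+ suc r
  n≡ = trans n≡3m+r (trans (ℕ.+-comm (suc r) _) (cong (ℕ._+ suc r) (ℕ.*-comm (n / 3) 3)))
  squares : sumTo (λ i → mono (3 ℕ.* (i ℕ.* i)) n) n ≡ + 0
  squares = sumTo-zero _ n λ i → trans (cong₂ mono (sym (ℕ.+-identityʳ (3 ℕ.* (i ℕ.* i)))) n≡)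
    (coeff (section-mono-≢ (i ℕ.* i) 0<3 r<3 λ ()) (n / 3))

section₀-ψ-dil : section 0 ψ ≋ negq (dil 3 φ)
section₀-ψ-dil = coeffwise λ n → cong₂ _*_ (trans (cong sgn (ℕ.+-identityʳ (3 ℕ.* n))) (sgn-3* n)) (φ-dil n)

-- Sections of the generating function

negq-cong : ∀ {f g} → f ≋ g → negq f ≋ negq g
negq-cong f≋g = coeffwise λ n → cong (sgn n *_) (coeff f≋g n)

negq-⊛ : ∀ f g → negq (f ⊛ g) ≋ negq f ⊛ negq g
negq-⊛ f g = coeffwise λ n → trans (cong (sgn n *_) (⊛-coeff f g n))
  (trans (sym (sumTo-* (sgn n) _ n)) (trans (sumTo-cong n (λ i → termwise n i)) (sym (⊛-coeff (negq f) (negq g) n))))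
  where
  open +-*-Solver
  termwise : ∀ n i → i ≤ n → sgn n * (f i * g (n ∸ i)) ≡ negq f i * negq g (n ∸ i)
  termwise n i i≤n = trans
    (cong (_* (f i * g (n ∸ i))) (trans (cong sgn (sym (ℕ.m+[n∸m]≡n i≤n))) (sgn-+ i (n ∸ i))))
    (solve 4 (λ s t x y → s :* t :* (x :* y) := s :* x :* (t :* y)) refl (sgn i) (sgn (n ∸ i)) (f i) (g (n ∸ i)))

negq-involutive : ∀ f → negq (negq f) ≋ f
negq-involutive f = coeffwise λ n →
  trans (sym (ℤ.*-assoc (sgn n) (sgn n) (f n))) (trans (cong (_* f n) (sgn-square n)) (ℤ.*-identityˡ (f n)))

negq-one : negq one ≋ one
negq-one = coeffwise λ n → trans (sgn-mono 0 n) (ℤ.*-identityˡ (one n))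

negq-mul : ∀ f g → negq (mul f g) ≋ negq f ⊛ negq g
negq-mul f g = ≋-trans (negq-cong (≋-sym (⊛-mul f g))) (negq-⊛ f g)

negq-scale : ∀ c f → negq (scale c f) ≋ scale c (negq f)
negq-scale c f = coeffwise λ n → solve 3 (λ s c x → s :* (c :* x) := c :* (s :* x)) refl (sgn n) c (f n)
  where open +-*-Solver

pow-suc : ∀ f k → pow f (suc k) ≋ f ⊛ pow f k
pow-suc f k = ≋-sym (⊛-mul f (pow f k))

pow-cong : ∀ {f g} k → f ≋ g → pow f k ≋ pow g k
pow-cong zero    f≋g = ≋-refl
pow-cong (suc k) f≋g = mul-cong f≋g (pow-cong k f≋g)

negq-pow : ∀ f k → negq (pow f k) ≋ pow (negq f) k
negq-pow f zero    = negq-one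
negq-pow f (suc k) = ≋-trans (negq-mul f (pow f k)) (≋-trans (PSR.*-congˡ (negq-pow f k)) (≋-sym (pow-suc (negq f) k)))

pow-2 : ∀ f → pow f 2 ≋ f ⊛ f
pow-2 f = ≋-trans (pow-suc f 1) (PSR.*-congˡ (≋-trans (pow-suc f 0) (PSR.*-identityʳ f)))

pow-3 : ∀ f → pow f 3 ≋ f ⊛ (f ⊛ f)
pow-3 f = ≋-trans (pow-suc f 2) (PSR.*-congˡ (pow-2 f))

pow-4 : ∀ f → pow f 4 ≋ f ⊛ (f ⊛ (f ⊛ f))
pow-4 f = ≋-trans (pow-suc f 3) (PSR.*-congˡ (pow-3 f))

pow-+ : ∀ f j k → pow f (j ℕ.+ k) ≋ pow f j ⊛ pow f k
pow-+ f zero    k = ≋-sym (PSR.*-identityˡ (pow f k))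
pow-+ f (suc j) k = begin
  pow f (suc (j ℕ.+ k))        ≈⟨ pow-suc f (j ℕ.+ k) ⟩
  f ⊛ pow f (j ℕ.+ k)          ≈⟨ PSR.*-congˡ (pow-+ f j k) ⟩
  f ⊛ (pow f j ⊛ pow f k)      ≈⟨ PSR.*-assoc f _ _ ⟨
  f ⊛ pow f j ⊛ pow f k        ≈⟨ PSR.*-congʳ (pow-suc f j) ⟨
  pow f (suc j) ⊛ pow f k      ∎

-- The automorphism q ↦ -q preserves the equation that defines the inverse.
negq-inv-pow : ∀ f k → pow f k 0 ≡ + 1 → pow (negq f) k ⊛ negq (inv (pow f k)) ≋ one
negq-inv-pow f k f0 = begin
  pow (negq f) k ⊛ negq (inv (pow f k))     ≈⟨ PSR.*-congʳ (negq-pow f k) ⟨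
  negq (pow f k) ⊛ negq (inv (pow f k))     ≈⟨ negq-⊛ _ _ ⟨
  negq (pow f k ⊛ inv (pow f k))            ≈⟨ negq-cong (⊛-inv (pow f k) f0) ⟩
  negq one                                  ≈⟨ negq-one ⟩
  one ∎

embed-scale : ∀ m f → embed (+ m) ⊛ f ≋ scale (+ m) f
embed-scale m f = ≋-trans (PSR.*-congʳ (go m)) (scale-one-⊛ (+ m) f)
  where
  go : ∀ m → embed (+ m) ≋ scale (+ m) one
  go zero    = coeffwise λ n → refl
  go (suc m) = ≋-trans (1+× m one) (≋-trans (PSR.+-congˡ (go m)) (coeffwise λ n →
    trans (⊕-coeff one (scale (+ m) one) n)
      (sym (ℤ.suc-* (+ m) (one n)))))

-- Sections of 1/ψ³ and the congruences.

a f₁ f₂ f₃ f₆ : PS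
a  = section 0 ψ
f₁ = qpoch 1
f₂ = qpoch 2
f₃ = qpoch 3
f₆ = qpoch 6

open CubeOfBinomial a B

ψ-quotient : ψ ⊛ f₂ ≋ f₁ ⊛ f₁
ψ-quotient = ≋-trans (PSR.*-congʳ ψ-θ) (Gauss.gauss 0)

a-quotient : a ⊛ f₆ ≋ f₃ ⊛ f₃
a-quotient = ≋-trans (PSR.*-congʳ section₀-ψ) (Gauss.gauss 2)

sectionNorm-ψ : sectionNorm ψ ≋ D
sectionNorm-ψ = ≋-trans (norm-cong ≋-refl section₁-ψ-B section₂-ψ) norm-binomial

-- Cleared of denominators: with N₂f₆ = f₂⁴, N₁f₃ = f₁⁴ and D N₂ = N₁², both sides times f₂⁴f₆
-- become f₁⁸f₆. The common factor has constant term 1 and cancels.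
D⊛a : D ⊛ a ≋ pow ψ 4
D⊛a = ⊛-cancelʳ (f₂ ⊛ (f₂ ⊛ f₂ ⊛ f₂) ⊛ f₆) unit (begin
  D ⊛ a ⊛ (f₂ ⊛ (f₂ ⊛ f₂ ⊛ f₂) ⊛ f₆)
    ≈⟨ PSR.*-congˡ (PSR.*-congʳ qpoch-norm₂) ⟨
  D ⊛ a ⊛ (N₂ ⊛ f₆ ⊛ f₆)
    ≈⟨ Sol.solve 4 (λ d a n f → d :* a :* (n :* f :* f) := d :* n :* (a :* f) :* f) ≋-refl D a N₂ f₆ ⟩
  D ⊛ N₂ ⊛ (a ⊛ f₆) ⊛ f₆
    ≈⟨ PSR.*-congʳ (PSR.*-cong norms a-quotient) ⟩
  N₁ ⊛ N₁ ⊛ (f₃ ⊛ f₃) ⊛ f₆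
    ≈⟨ Sol.solve 3 (λ n f g → n :* n :* (f :* f) :* g := (n :* f) :* (n :* f) :* g) ≋-refl N₁ f₃ f₆ ⟩
  N₁ ⊛ f₃ ⊛ (N₁ ⊛ f₃) ⊛ f₆
    ≈⟨ PSR.*-congʳ (PSR.*-cong qpoch-norm₁ qpoch-norm₁) ⟩
  f₁ ⊛ (f₁ ⊛ f₁ ⊛ f₁) ⊛ (f₁ ⊛ (f₁ ⊛ f₁ ⊛ f₁)) ⊛ f₆
    ≈⟨ Sol.solve 2 (λ f g → f :* (f :* f :* f) :* (f :* (f :* f :* f)) :* g := (f :* f) :* (f :* f) :* (f :* f) :* (f :* f) :* g) ≋-refl f₁ f₆ ⟩
  (f₁ ⊛ f₁) ⊛ (f₁ ⊛ f₁) ⊛ (f₁ ⊛ f₁) ⊛ (f₁ ⊛ f₁) ⊛ f₆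
    ≈⟨ PSR.*-congʳ (PSR.*-cong (PSR.*-cong (PSR.*-cong ψ-quotient ψ-quotient) ψ-quotient) ψ-quotient) ⟨
  (ψ ⊛ f₂) ⊛ (ψ ⊛ f₂) ⊛ (ψ ⊛ f₂) ⊛ (ψ ⊛ f₂) ⊛ f₆
    ≈⟨ Sol.solve 3 (λ p f g → (p :* f) :* (p :* f) :* (p :* f) :* (p :* f) :* g := p :* (p :* (p :* p)) :* (f :* (f :* f :* f) :* g)) ≋-refl ψ f₂ f₆ ⟩
  ψ ⊛ (ψ ⊛ (ψ ⊛ ψ)) ⊛ (f₂ ⊛ (f₂ ⊛ f₂ ⊛ f₂) ⊛ f₆)
    ≈⟨ PSR.*-congʳ (pow-4 ψ) ⟨
  pow ψ 4 ⊛ (f₂ ⊛ (f₂ ⊛ f₂ ⊛ f₂) ⊛ f₆) ∎)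
  where
  open Sol
  N₁ N₂ : PS
  N₁ = sectionNorm f₁
  N₂ = sectionNorm f₂
  norms : D ⊛ N₂ ≋ N₁ ⊛ N₁
  norms = begin
    D ⊛ N₂                    ≈⟨ PSR.*-congʳ sectionNorm-ψ ⟨
    sectionNorm ψ ⊛ N₂        ≈⟨ sectionNorm-⊛ ψ f₂ ⟨
    sectionNorm (ψ ⊛ f₂)      ≈⟨ sectionNorm-cong ψ-quotient ⟩
    sectionNorm (f₁ ⊛ f₁)     ≈⟨ sectionNorm-⊛ f₁ f₁ ⟩
    N₁ ⊛ N₁                   ∎
  ⊛-unit : ∀ {f g} → f 0 ≡ + 1 → g 0 ≡ + 1 → (f ⊛ g) 0 ≡ + 1
  ⊛-unit {f} {g} p r = trans (⊛-zero f g) (cong₂ _*_ p r)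
  unit : (f₂ ⊛ (f₂ ⊛ f₂ ⊛ f₂) ⊛ f₆) 0 ≡ + 1
  unit = ⊛-unit {g = f₆} (⊛-unit {f₂} refl (⊛-unit {g = f₂} (⊛-unit {f₂} {f₂} refl refl) refl)) refl

-- The inverse of ψ⁴, in the form in which 1/φ⁴ appears after q ↦ -q.
v : PS
v = negq (inv (pow φ 4))

Dav : D ⊛ a ⊛ v ≋ one
Dav = ≋-trans (PSR.*-congʳ D⊛a) (negq-inv-pow φ 4 refl)

ψ²-section₀ : section 0 (ψ ⊛ ψ) ≋ mul₀ a c zeroPS a c zeroPS
ψ²-section₀ = ≋-trans (section₀-⊛ ψ ψ) (mul₀-cong ≋-refl section₁-ψ-B section₂-ψ ≋-refl section₁-ψ-B section₂-ψ)

ψ²-section₁ : section 1 (ψ ⊛ ψ) ≋ mul₁ a c zeroPS a c zeroPS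
ψ²-section₁ = ≋-trans (section₁-⊛ ψ ψ) (mul₁-cong ≋-refl section₁-ψ-B section₂-ψ ≋-refl section₁-ψ-B section₂-ψ)

ψ²-section₂ : section 2 (ψ ⊛ ψ) ≋ mul₂ a c zeroPS a c zeroPS
ψ²-section₂ = ≋-trans (section₂-⊛ ψ ψ) (mul₂-cong ≋-refl section₁-ψ-B section₂-ψ ≋-refl section₁-ψ-B section₂-ψ)

ψ³-section₀ : section 0 (pow ψ 3) ≋ D
ψ³-section₀ = ≋-trans (section-cong 0 (pow-3 ψ)) (≋-trans (section₀-⊛ ψ (ψ ⊛ ψ))
  (≋-trans (mul₀-cong ≋-refl section₁-ψ-B section₂-ψ ψ²-section₀ ψ²-section₁ ψ²-section₂) cube₀))

ψ³-section₁ : section 1 (pow ψ 3) ≋ w₁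
ψ³-section₁ = ≋-trans (section-cong 1 (pow-3 ψ)) (≋-trans (section₁-⊛ ψ (ψ ⊛ ψ))
  (≋-trans (mul₁-cong ≋-refl section₁-ψ-B section₂-ψ ψ²-section₀ ψ²-section₁ ψ²-section₂) cube₁))

ψ³-section₂ : section 2 (pow ψ 3) ≋ w₂
ψ³-section₂ = ≋-trans (section-cong 2 (pow-3 ψ)) (≋-trans (section₂-⊛ ψ (ψ ⊛ ψ))
  (≋-trans (mul₂-cong ≋-refl section₁-ψ-B section₂-ψ ψ²-section₀ ψ²-section₁ ψ²-section₂) cube₂))

p₀ p₁ p₂ : PS
p₀ = section 0 pbar3
p₁ = section 1 pbar3
p₂ = section 2 pbar3

pbar3-inverse : pow ψ 3 ⊛ pbar3 ≋ one
pbar3-inverse = ⊛-inv (pow ψ 3) refl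

-- Trisecting ψ³ · `pbar3` = 1 gives three linear equations for the unknown sections, the system
-- that `Inverse` solves.
equation₀ : mul₀ D w₁ w₂ p₀ p₁ p₂ ≋ one
equation₀ = ≋-trans (≋-sym (≋-trans (section₀-⊛ (pow ψ 3) pbar3)
  (mul₀-cong ψ³-section₀ ψ³-section₁ ψ³-section₂ ≋-refl ≋-refl ≋-refl)))
  (≋-trans (section-cong 0 pbar3-inverse) section-one₀)

equation₁ : mul₁ D w₁ w₂ p₀ p₁ p₂ ≋ zeroPS
equation₁ = ≋-trans (≋-sym (≋-trans (section₁-⊛ (pow ψ 3) pbar3)
  (mul₁-cong ψ³-section₀ ψ³-section₁ ψ³-section₂ ≋-refl ≋-refl ≋-refl)))
  (≋-trans (section-cong 1 pbar3-inverse) section-one₁)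

equation₂ : mul₂ D w₁ w₂ p₀ p₁ p₂ ≋ zeroPS
equation₂ = ≋-trans (≋-sym (≋-trans (section₂-⊛ (pow ψ 3) pbar3)
  (mul₂-cong ψ³-section₀ ψ³-section₁ ψ³-section₂ ≋-refl ≋-refl ≋-refl)))
  (≋-trans (section-cong 2 pbar3-inverse) section-one₂)

open Sections Dav equation₀ equation₁ equation₂

-- From the exact identity p = g + m z the quotient is (-1)^n z n; f is recovered from g because q ↦
-- -q is an involution.
congruence : ∀ {p g z} m f → p ≋ g ⊕ embed (+ m) ⊛ z → negq f ≋ g → negq p ≡ f [mod + m ]
congruence {p} {g} {z} m f p≋ f≋ n = ∣⇒∣ᵤ (divides (sgn n * z n) (trans
  (cong₂ (λ x y → sgn n * x - y)
    (trans (coeff p≋ n) (trans (⊕-coeff g _ n) (cong (_+_ (g n)) (coeff (embed-scale m z) n))))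
    (trans (sym (coeff (negq-involutive f) n)) (cong (sgn n *_) (coeff f≋ n))))
  (solve 4 (λ s g m z → s :* (g :+ m :* z) :- s :* g := s :* z :* m) refl (sgn n) (g n) (+ m) (z n))))
  where open +-*-Solver

-- Both sides are inverse to ψ⁸ = ψ⁴ · ψ⁴.
negq-inv-φ⁸ : negq (inv (pow φ 8)) ≋ v ⊛ v
negq-inv-φ⁸ = ⊛-cancelʳ (pow ψ 8) refl (begin
  negq (inv (pow φ 8)) ⊛ pow ψ 8      ≈⟨ PSR.*-comm _ _ ⟩
  pow ψ 8 ⊛ negq (inv (pow φ 8))      ≈⟨ negq-inv-pow φ 8 refl ⟩
  one                                 ≈⟨ PSR.*-identityˡ one ⟨
  one ⊛ one                           ≈⟨ PSR.*-cong (negq-inv-pow φ 4 refl) (negq-inv-pow φ 4 refl) ⟨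
  pow ψ 4 ⊛ v ⊛ (pow ψ 4 ⊛ v)         ≈⟨ Sol.solve 2 (λ p v → p :* v :* (p :* v) := v :* v :* (p :* p)) ≋-refl (pow ψ 4) v ⟩
  v ⊛ v ⊛ (pow ψ 4 ⊛ pow ψ 4)         ≈⟨ PSR.*-congˡ (pow-+ ψ 4 4) ⟨
  v ⊛ v ⊛ pow ψ 8                     ∎)
  where open Sol

negq-dil-pow : ∀ k → negq (pow (dil 3 φ) k) ≋ pow a k
negq-dil-pow k = ≋-trans (negq-pow (dil 3 φ) k) (pow-cong k (≋-sym section₀-ψ-dil))

rhs₀ : negq (div (dil 3 φ) (pow φ 4)) ≋ a ⊛ v
rhs₀ = ≋-trans (negq-mul (dil 3 φ) _) (PSR.*-congʳ (≋-sym section₀-ψ-dil))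

rhs₁ : negq (scale (+ 6) (mul (div (pow (dil 3 φ) 4) (pow φ 8)) (negq B))) ≋ embed (+ 6) ⊛ (a ⊛ a ⊛ a ⊛ a ⊛ (v ⊛ v) ⊛ B)
rhs₁ = begin
  negq (scale (+ 6) (mul (div (pow (dil 3 φ) 4) (pow φ 8)) (negq B)))
    ≈⟨ negq-scale (+ 6) _ ⟩
  scale (+ 6) (negq (mul (div (pow (dil 3 φ) 4) (pow φ 8)) (negq B)))
    ≈⟨ embed-scale 6 _ ⟨
  embed (+ 6) ⊛ negq (mul (div (pow (dil 3 φ) 4) (pow φ 8)) (negq B))
    ≈⟨ PSR.*-congˡ (≋-trans (negq-mul _ (negq B)) (PSR.*-cong (negq-mul _ _) (negq-involutive B))) ⟩
  embed (+ 6) ⊛ (negq (pow (dil 3 φ) 4) ⊛ negq (inv (pow φ 8)) ⊛ B)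
    ≈⟨ PSR.*-congˡ (PSR.*-congʳ (PSR.*-cong (≋-trans (negq-dil-pow 4) (pow-4 a)) negq-inv-φ⁸)) ⟩
  embed (+ 6) ⊛ (a ⊛ (a ⊛ (a ⊛ a)) ⊛ (v ⊛ v) ⊛ B)
    ≈⟨ PSR.*-congˡ (PSR.*-congʳ (PSR.*-congʳ (Sol.solve 1 (λ a → a :* (a :* (a :* a)) := a :* a :* a :* a) ≋-refl a))) ⟩
  embed (+ 6) ⊛ (a ⊛ a ⊛ a ⊛ a ⊛ (v ⊛ v) ⊛ B) ∎
  where open Sol

rhs₂ : negq (scale (+ 24) (mul (div (pow (dil 3 φ) 3) (pow φ 8)) (pow (negq B) 2))) ≋ embed (+ 24) ⊛ (a ⊛ a ⊛ a ⊛ (v ⊛ v) ⊛ (B ⊛ B))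
rhs₂ = begin
  negq (scale (+ 24) (mul (div (pow (dil 3 φ) 3) (pow φ 8)) (pow (negq B) 2)))
    ≈⟨ negq-scale (+ 24) _ ⟩
  scale (+ 24) (negq (mul (div (pow (dil 3 φ) 3) (pow φ 8)) (pow (negq B) 2)))
    ≈⟨ embed-scale 24 _ ⟨
  embed (+ 24) ⊛ negq (mul (div (pow (dil 3 φ) 3) (pow φ 8)) (pow (negq B) 2))
    ≈⟨ PSR.*-congˡ (≋-trans (negq-mul _ (pow (negq B) 2)) (PSR.*-cong (negq-mul _ _)
         (≋-trans (negq-pow (negq B) 2) (≋-trans (pow-cong 2 (negq-involutive B)) (pow-2 B))))) ⟩
  embed (+ 24) ⊛ (negq (pow (dil 3 φ) 3) ⊛ negq (inv (pow φ 8)) ⊛ (B ⊛ B))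
    ≈⟨ PSR.*-congˡ (PSR.*-congʳ (PSR.*-cong (≋-trans (negq-dil-pow 3) (pow-3 a)) negq-inv-φ⁸)) ⟩
  embed (+ 24) ⊛ (a ⊛ (a ⊛ a) ⊛ (v ⊛ v) ⊛ (B ⊛ B))
    ≈⟨ PSR.*-congˡ (PSR.*-congʳ (PSR.*-congʳ (PSR.*-assoc a a a))) ⟨
  embed (+ 24) ⊛ (a ⊛ a ⊛ a ⊛ (v ⊛ v) ⊛ (B ⊛ B)) ∎

theorem3p4 : (section3 0 ≡ div (dil 3 φ) (pow φ 4) [mod + 72 ])
    × (section3 1 ≡ scale (+ 6) (mul (div (pow (dil 3 φ) 4) (pow φ 8)) (negq B)) [mod + 144 ])
    × (section3 2 ≡ scale (+ 24) (mul (div (pow (dil 3 φ) 3) (pow φ 8)) (pow (negq B) 2)) [mod + 288 ])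
theorem3p4 =
  congruence 72 (div (dil 3 φ) (pow φ 4)) p₀-eq rhs₀ ,
  congruence 144 (scale (+ 6) (mul (div (pow (dil 3 φ) 4) (pow φ 8)) (negq B))) p₁-eq rhs₁ ,
  congruence 288 (scale (+ 24) (mul (div (pow (dil 3 φ) 3) (pow φ 8)) (pow (negq B) 2))) p₂-eq rhs₂
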